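{- Consider an initial generalized torus seed $\mathbf{s} = \{ (e_i,(a_{i,j})) \}$, which defines the usual set of dual vectors $\{ f_i = d_i^{ -1}e_i^* \}$. If $\mathbf{s}'$ is a mutation equivalent generalized torus seed, then the $i$-th coordinates of the $g$-vectors for the cluster variables in $\mathbf{s}'$ are either all non-negative or all non-positive when expressed in the basis $\{ f_1, \dots, f_n \}$.
   Context: Let $k$ be a field of characteristic zero and $R=k[a_{i,j}]$ with formal variables $a_{i,j}$. Generalized fixed data: lattice $N$ with skew-symmetric form $\{\cdot,\cdot\}$, sublattice $N^\circ$ with basis $\{d_ie_i\}$, $M=\mathrm{Hom}(N,\mathbb{Z})$ with dual basis $\{e_i^*\}$, $M^\circ$ with basis $\{f_i=d_i^{ -1}e_i^*\}$, positive integers $r_i$, formal variables $a_{i,j}$ with reciprocity $a_{i,j}=a_{i,r_i-j}$, and the injectivity assumption. Generalized mutation in direction $k$ sends $e_i\mapsto e_i+r_k[\epsilon_{ik}]_+e_k$ ($i\ne k$), $e_k\mapsto -e_k$, where $\epsilon_{ij}=\{e_i,e_j\}d_j$. The $g$-vector of a cluster monomial of the generalized $\mathcal{A}$ cluster variety with respect to $\mathbf{s}$ is the $T_{N^\circ}$-weight of its lift to $\mathcal{A}_{\mathrm{prin}}$ determined by $\mathbf{s}$; equivalently, identifying $\mathcal{A}^\vee(\mathbb{R}^T)$ with $M^\circ_{\mathbb{R},\mathbf{s}}$, it is the point $m$ such that the monomial is $z^m$ on a seed torus. -}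

module Defs where

open import Level using (Level; _⊔_) renaming (suc to lsuc)
open import Data.Nat as ℕ using (ℕ; zero; suc; _≤_; _∸_)
open import Data.Integer as ℤ using (ℤ; +_; -[1+_]; 0ℤ; 1ℤ)
open import Data.Fin using (Fin; zero; suc; _≟_)
open import Data.Sum using (_⊎_; inj₁; inj₂)
open import Data.Product using (_×_)
open import Data.List using (List; []; _∷_; upTo; foldr; map)
open import Relation.Nullary using (¬_; yes; no)
open import Relation.Binary.PropositionalEquality using (_≡_)
open import Algebra.Bundles using (CommutativeRing)

record Field (c ℓ : Level) : Set (lsuc (c ⊔ ℓ)) where
  field
    commutativeRing : CommutativeRing c ℓ
  open CommutativeRing commutativeRing public
  field
    _⁻¹       : Carrier → Carrier
    ⁻¹-inverse : ∀ x → ¬ (x ≈ 0#) → (x * (x ⁻¹)) ≈ 1#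
    1≉0       : ¬ (1# ≈ 0#)

module _ {c ℓ} (F : Field c ℓ) where
  open Field F using (Carrier; _≈_; _+_; 0#; 1#)

  natF : ℕ → Carrier
  natF zero    = 0#
  natF (suc m) = 1# + natF m

  CharZero : Set ℓ
  CharZero = ∀ m → ¬ (natF (suc m) ≈ 0#)

[_]₊ : ℤ → ℕ
[ + m ]₊     = m
[ -[1+ m ] ]₊ = 0

Σℤ : ∀ {n} → (Fin n → ℤ) → ℤ
Σℤ {zero}  f = 0ℤ
Σℤ {suc n} f = f zero ℤ.+ Σℤ (λ i → f (suc i))

-- Generalized fixed data, written in the basis {e_i} of N.
--   d i      : the positive integers with N° spanned by {d_i e_i}
--   ε i j    : ε_{ij} = {e_i , e_j} d_j  (an integer)
--   skew     : {·,·} is skew-symmetric, i.e. {e_i,e_j} = ε_ij / d_j satisfies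
--              ε_ij / d_j = - ε_ji / d_i, i.e. d_i ε_ij = - d_j ε_ji
--   r i      : the positive integers r_i
--   injective: the injectivity assumption: n ↦ {n , ·}|_{N°} : N → M° is
--              injective; in coordinates {Σ v_i e_i , d_j e_j} = Σ_i v_i ε_ij.

record GenFixedData (n : ℕ) : Set where
  field
    d         : Fin n → ℕ
    d-pos     : ∀ i → 1 ≤ d i
    ε         : Fin n → Fin n → ℤ
    skew      : ∀ i j → (+ d i) ℤ.* ε i j ≡ ℤ.- ((+ d j) ℤ.* ε j i)
    r         : Fin n → ℕ
    r-pos     : ∀ i → 1 ≤ r i
    injective : ∀ (v : Fin n → ℤ) → (∀ j → Σℤ (λ i → v i ℤ.* ε i j) ≡ 0ℤ)
                → ∀ i → v i ≡ 0ℤ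

-- The principal-coefficient cluster variety A_prin.
-- Indices of Ñ = N ⊕ M°:  inj₁ i  ↔ (e_i , 0)  (unfrozen),
--                          inj₂ i  ↔ (0 , f_i)  (frozen).
-- Extended exchange matrix (rows = unfrozen indices):
--   ε̃_{i,j} = {ẽ_i, ẽ_j} d_j ;  initially ε̃_{i,inj₁ j} = ε_ij,
--   ε̃_{i,inj₂ j} = δ_ij.

Idx : ℕ → Set
Idx n = Fin n ⊎ Fin n

ExtMat : ℕ → Set
ExtMat n = Fin n → Idx n → ℤ

module GenCluster {c ℓ} (F : Field c ℓ) {n : ℕ} (D : GenFixedData n) where
  open Field F using (Carrier; _≈_; _+_; _*_; 0#; 1#; _⁻¹)
  open GenFixedData D

  _^ℕ_ : Carrier → ℕ → Carrier
  x ^ℕ zero  = 1#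
  x ^ℕ suc m = x * (x ^ℕ m)

  _^ℤ_ : Carrier → ℤ → Carrier
  x ^ℤ (+ m)     = x ^ℕ m
  x ^ℤ -[1+ m ]  = (x ⁻¹) ^ℕ suc m

  ∏Fin : ∀ {m} → (Fin m → Carrier) → Carrier
  ∏Fin {zero}  f = 1#
  ∏Fin {suc m} f = f zero * ∏Fin (λ i → f (suc i))

  ∏Idx : (Idx n → Carrier) → Carrier
  ∏Idx f = ∏Fin (λ i → f (inj₁ i)) * ∏Fin (λ i → f (inj₂ i))

  Σupto : ℕ → (ℕ → Carrier) → Carrier
  Σupto r f = foldr _+_ 0# (map f (upTo (suc r)))

  initMat : ExtMat n
  initMat i (inj₁ j) = ε i j
  initMat i (inj₂ j) with i ≟ j
  ... | yes _ = 1ℤ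
  ... | no  _ = 0ℤ

  -- generalized mutation of the exchange matrix in direction k, i.e. the
  -- matrix {ẽ'_i, ẽ'_j} d_j of the mutated basis
  -- ẽ'_i = ẽ_i + r_k [ε̃_ik]_+ ẽ_k (i ≠ k),  ẽ'_k = - ẽ_k.
  mutMat : Fin n → ExtMat n → ExtMat n
  mutMat k B i j with i ≟ k
  ... | yes _ = ℤ.- B i j
  ... | no  _ with j
  ...   | inj₂ j' = B i (inj₂ j') ℤ.+ (+ r k) ℤ.* ((+ [ B i (inj₁ k) ]₊) ℤ.* B k (inj₂ j')
                      ℤ.+ B i (inj₁ k) ℤ.* (+ [ ℤ.- B k (inj₂ j') ]₊))
  ...   | inj₁ j' with j' ≟ k
  ...     | yes _ = ℤ.- B i (inj₁ j')
  ...     | no  _ = B i (inj₁ j') ℤ.+ (+ r k) ℤ.* ((+ [ B i (inj₁ k) ]₊) ℤ.* B k (inj₁ j')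
                      ℤ.+ B i (inj₁ k) ℤ.* (+ [ ℤ.- B k (inj₁ j') ]₊))

  -- A point of (the initial seed torus of) A_prin over F, together with
  -- values of the formal variables a_{i,j}:
  --   A i = A_i (unfrozen), t i = frozen variable, a i j = a_{i,j}.
  record Point : Set c where
    field
      A : Fin n → Carrier
      t : Fin n → Carrier
      a : Fin n → ℕ → Carrier

  coef : Point → Fin n → ℕ → Carrier
  coef p k zero = 1#
  coef p k (suc j) with suc j ℕ.≟ r k
  ... | yes _ = 1#
  ... | no  _ = Point.a p k (suc j)

  GoodPoint : Point → Set ℓ
  GoodPoint p = (∀ i → ¬ (Point.A p i ≈ 0#)) × (∀ i → ¬ (Point.t p i ≈ 0#))
              × (∀ i j → j ≤ r i → Point.a p i j ≈ Point.a p i (r i ∸ j))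

  -- state of a seed of A_prin: extended exchange matrix + values of the
  -- unfrozen cluster variables (frozen ones never change)
  record State : Set c where
    field
      mat : ExtMat n
      clu : Fin n → Carrier

  initState : Point → State
  initState p = record { mat = initMat ; clu = Point.A p }

  step : Point → State → Fin n → State
  step p s k = record { mat = mutMat k (State.mat s) ; clu = newClu }
    where
      X : Idx n → Carrier
      X (inj₁ l) = State.clu s l
      X (inj₂ l) = Point.t p l
      newVar : Carrier
      newVar = (State.clu s k ⁻¹) * Σupto (r k) (λ j → coef p k j *
                 ∏Idx (λ l → X l ^ℕ (j ℕ.* [ State.mat s k l ]₊
                                    ℕ.+ (r k ∸ j) ℕ.* [ ℤ.- State.mat s k l ]₊)))
      newClu : Fin n → Carrier
      newClu i with i ≟ k
      ... | yes _ = newVar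
      ... | no  _ = State.clu s i

  runFrom : Point → State → List (Fin n) → State
  runFrom p s []       = s
  runFrom p s (k ∷ ks) = runFrom p (step p s k) ks

  clusterVar : List (Fin n) → Point → Fin n → Carrier
  clusterVar ks p = State.clu (runFrom p (initState p) ks)

  -- all cluster variables along the mutation path are nonzero at p
  -- (so that p lies in the domain of all the seed tori involved)
  NZ : Point → State → List (Fin n) → Set ℓ
  NZ p s []       = ∀ i → ¬ (State.clu s i ≈ 0#)
  NZ p s (k ∷ ks) = (∀ i → ¬ (State.clu s i ≈ 0#)) × NZ p (step p s k) ks

  -- action of λ ∈ T_{N°} (coordinates λ_i = z^{f_i}(λ)) on A_prin:
  -- weight of A_i is f_i, weight of the frozen t_j is -Σ_l ε_jl f_l,
  -- the a_{i,j} have weight 0.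
  act : (Fin n → Carrier) → Point → Point
  act λ' p = record
    { A = λ i → λ' i * Point.A p i
    ; t = λ j → ∏Fin (λ l → λ' l ^ℤ (ℤ.- ε j l)) * Point.t p j
    ; a = Point.a p }

  char : (Fin n → Carrier) → (Fin n → ℤ) → Carrier
  char λ' m = ∏Fin (λ i → λ' i ^ℤ m i)

  -- g is the g-vector (in the basis f_1..f_n) of the l-th cluster variable of
  -- the seed μ_{ks}(s): its lift to A_prin is a T_{N°}-eigenfunction of weight g
  IsGVector : List (Fin n) → Fin n → (Fin n → ℤ) → Set (c ⊔ ℓ)
  IsGVector ks l g = ∀ (p : Point) (λ' : Fin n → Carrier)
    → GoodPoint p → NZ p (initState p) ks → (∀ i → ¬ (λ' i ≈ 0#))
    → clusterVar ks (act λ' p) l ≈ char λ' g * clusterVar ks p l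

{-# OPTIONS --safe #-}
-- Setting the coefficients a_{i,j} aside, everything is tested on the binomial
-- exchange relations x_k x_k' = M⁺ + M⁻ over positive rational points.
--
-- 1. Cluster variables are Laurent polynomials in every seed.  Along a path i, k, …
--    a cluster variable is Laurent in the seeds reached by i and by i, k, i, so its
--    denominator divides both a power of 1 + Y_i and a polynomial 1 + ω; for a
--    grading with deg Y_i = 0 and ω of positive degree the expansion of 1 / (1 + ω)
--    shows that the denominator is trivial.
-- 2. Therefore the tropicalisation E(w) of a cluster variable, the rate of decay
--    along x · 2^(-Nw), is superadditive in w in every seed.
-- 3. c-vectors are sign-coherent: while they are, E is linear on the orthant y ≥ 0,
--    and if the next c_j had mixed signs, superadditivity in the seed beyond the
--    wall c_j = 0 would force the kernel vector dual to c_j to be nonnegative.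
-- 4. Across the facet y_i = 0 of the orthant, E_l bends by s · g_{li} with s
--    independent of l.  Superadditivity in the initial seed and in its mutation at i
--    gives s g_{li} ≥ 0 and (s + r_i) g_{li} ≥ 0, so row i cannot have mixed signs.
--
-- The g-vectors enter as the values of E on the kernel of w ↦ y(w), where E is
-- linear: evaluate the T_{N°}-action at the all-ones point with λ_i = 2.

module Submission where

open import Defs
open import Level using (Level; 0ℓ)
open import Function using (_∘_)
open import Data.Nat as ℕ using (ℕ; zero; suc)
import Data.Nat.Properties as ℕₚ
open import Data.Integer as ℤ using (ℤ; +_; -[1+_]; 0ℤ; 1ℤ; _≤_)
import Data.Integer.Properties as ℤₚ
open import Data.Rational as ℚ using (ℚ; 0ℚ; 1ℚ)
import Data.Rational.Properties as ℚₚ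
open import Data.Fin using (Fin; zero; suc; _≟_)
open import Data.Fin.Properties using (any?)
open import Data.List using (List; []; _∷_; _++_; map; foldr; applyUpTo; length; reverse; _∷ʳ_)
import Data.List.Properties as Listₚ
open import Data.List.Relation.Unary.All as All using (All; []; _∷_)
import Data.List.Relation.Unary.All.Properties as Allₚ
open import Data.Sum as Sum using (_⊎_; inj₁; inj₂)
open import Data.Product using (∃; _×_; _,_; proj₁; proj₂)
open import Data.Empty using (⊥; ⊥-elim)
open import Relation.Nullary using (¬_; Dec; yes; no)
open import Relation.Binary.PropositionalEquality using (_≡_; _≢_; _≗_; refl; sym; trans; cong; cong₂; subst; subst₂; isEquivalence; module ≡-Reasoning)
open import Algebra.Bundles using (CommutativeMonoid)
import Algebra.Solver.CommutativeMonoid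
open import Data.Integer.Tactic.RingSolver using (solve-∀)
open import Tactic.RingSolver using () renaming (solve-∀ to solve-ring)
open import Tactic.RingSolver.Core.AlmostCommutativeRing using (AlmostCommutativeRing; fromCommutativeRing)
import Data.Rational.Unnormalised as ℚᵘ
import Data.Rational.Unnormalised.Properties as ℚᵘₚ
open import Relation.Nullary.Decidable using (dec⇒maybe)
open import Data.Unit using (⊤; tt)
import Relation.Binary.Definitions as Tri
import Relation.Binary.Reasoning.Setoid
import Algebra.Properties.Ring

-- The coefficients can be set aside because a weight of T_{N°} gives all r_k + 1 terms of an
-- exchange polynomial the same degree. The weights of cluster variables therefore follow a linear
-- recursion that sees only an extreme monomial, and the binomial relation obeys the same recursion.
-- The obstacle is that positivity of Laurent coefficients is not at hand. Positivity of values
-- takes its place: the relations are subtraction-free, so at positive points nothing cancels and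
-- the rate of decay is exactly the min-plus value, while a Laurent polynomial with that decay at
-- every positive point has an expansion whose exponents obey the matching inequality. Coprimality
-- of denominators is likewise replaced by a grading, so all identities are between functions on
-- positive rational points and no factorisation of polynomials occurs. Superadditivity says
-- something new in each seed because tropical mutation does not respect addition of weights: two
-- vectors with opposite values S and -S on the wall of k acquire the defect r_k S in coordinate k.
-- This defect excludes mixed c-vectors and also turns s into s + r_i.

infix 8 _⁺

_⁺ : ℤ → ℤ
x ⁺ = + [ x ]₊

⁺-nonneg : ∀ x → 0ℤ ≤ x ⁺
⁺-nonneg x = ℤ.+≤+ ℕ.z≤n

⁺-split : ∀ x → x ⁺ ≡ x ℤ.+ (ℤ.- x) ⁺
⁺-split (+ zero)   = refl
⁺-split (+ suc m)  = sym (ℤₚ.+-identityʳ _)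
⁺-split (-[1+ m ]) = sym (ℤₚ.+-inverseʳ (+ suc m))

⁺-of-nonpos : ∀ {x} → x ≤ 0ℤ → x ⁺ ≡ 0ℤ
⁺-of-nonpos {+ zero}   _ = refl
⁺-of-nonpos {+ suc _}  (ℤ.+≤+ ())
⁺-of-nonpos { -[1+ _ ]} _ = refl

⁺-scale : ∀ m x → (+ m ℤ.* x) ⁺ ≡ + m ℤ.* x ⁺
⁺-scale m (+ k) rewrite sym (ℤₚ.pos-* m k) = refl
⁺-scale zero    -[1+ k ] = refl
⁺-scale (suc m) -[1+ k ] = sym (ℤₚ.*-zeroʳ (+ suc m))

neg-nonneg : ∀ {x} → 0ℤ ≤ x → ℤ.- x ≤ 0ℤ
neg-nonneg = ℤₚ.neg-mono-≤

neg-nonpos : ∀ {x} → x ≤ 0ℤ → 0ℤ ≤ ℤ.- x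
neg-nonpos = ℤₚ.neg-mono-≤

-- Semifields and monomials over them

-- A semifield in logarithmic notation: _∙_ is its multiplication, _·_ the
-- integer powers, and φ y stands for 1 ⊕ y.
record Semifield : Set₁ where
  infixl 6 _∙_
  infixr 7 _·_
  field
    Carrier   : Set
    _∙_       : Carrier → Carrier → Carrier
    ε         : Carrier
    _·_       : ℤ → Carrier → Carrier
    φ         : Carrier → Carrier
    assoc     : ∀ x y z → (x ∙ y) ∙ z ≡ x ∙ (y ∙ z)
    comm      : ∀ x y → x ∙ y ≡ y ∙ x
    identityˡ : ∀ x → ε ∙ x ≡ x
    ·-+       : ∀ a b x → (a ℤ.+ b) · x ≡ a · x ∙ b · x
    ·-∙       : ∀ a x y → a · (x ∙ y) ≡ a · x ∙ a · y
    ·-*       : ∀ a b x → (a ℤ.* b) · x ≡ a · b · x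
    ·-1       : ∀ x → 1ℤ · x ≡ x
    ·-0       : ∀ x → 0ℤ · x ≡ ε
    -- The two monomials of an exchange relation are interchangeable through this law; `step-neg`
    -- and `step-involutive` rest on it.
    φ-flip    : ∀ y → φ y ≡ y ∙ φ (ℤ.-1ℤ · y)

  commutativeMonoid : CommutativeMonoid 0ℓ 0ℓ
  commutativeMonoid = record
    { Carrier = Carrier ; _≈_ = _≡_ ; _∙_ = _∙_ ; ε = ε
    ; isCommutativeMonoid = record
      { isMonoid = record
        { isSemigroup = record
          { isMagma = record { isEquivalence = isEquivalence ; ∙-cong = cong₂ _∙_ }
          ; assoc = assoc }
        ; identity = identityˡ , λ x → trans (comm x ε) (identityˡ x) }
      ; comm = comm } }

  identityʳ : ∀ x → x ∙ ε ≡ x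
  identityʳ x = trans (comm x ε) (identityˡ x)

  ·-ε : ∀ a → a · ε ≡ ε
  ·-ε a = begin
    a · ε            ≡⟨ cong (a ·_) (sym (·-0 ε)) ⟩
    a · 0ℤ · ε       ≡⟨ sym (·-* a 0ℤ ε) ⟩
    (a ℤ.* 0ℤ) · ε   ≡⟨ cong (_· ε) (ℤₚ.*-zeroʳ a) ⟩
    0ℤ · ε           ≡⟨ ·-0 ε ⟩
    ε                ∎
    where open ≡-Reasoning

  ·-cancel : ∀ {a b} x → a ℤ.+ b ≡ 0ℤ → a · x ∙ b · x ≡ ε
  ·-cancel {a} {b} x e = trans (sym (·-+ a b x)) (trans (cong (_· x) e) (·-0 x))

  inverseʳ : ∀ x → x ∙ ℤ.-1ℤ · x ≡ ε
  inverseʳ x = trans (cong (_∙ ℤ.-1ℤ · x) (sym (·-1 x))) (·-cancel {1ℤ} {ℤ.-1ℤ} x refl)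

  neg-· : ∀ a x → (ℤ.- a) · x ≡ ℤ.-1ℤ · a · x
  neg-· a x = trans (cong (_· x) (sym (ℤₚ.-1*i≡-i a))) (·-* ℤ.-1ℤ a x)

  interchange : ∀ p q u v → (p ∙ q) ∙ (u ∙ v) ≡ (p ∙ u) ∙ (q ∙ v)
  interchange = solve 4 (λ p q u v → (p ⊕ q) ⊕ (u ⊕ v) ⊜ (p ⊕ u) ⊕ (q ⊕ v)) refl
    where open Algebra.Solver.CommutativeMonoid commutativeMonoid

module Pairing (S : Semifield) where
  open Semifield S

  pairFin : ∀ {m} → (Fin m → ℤ) → (Fin m → Carrier) → Carrier
  pairFin {zero}  a x = ε
  pairFin {suc m} a x = a zero · x zero ∙ pairFin (a ∘ suc) (x ∘ suc)

  pairFin-cong : ∀ {m} {a b : Fin m → ℤ} {x y : Fin m → Carrier}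
    → a ≗ b → x ≗ y → pairFin a x ≡ pairFin b y
  pairFin-cong {zero}  p q = refl
  pairFin-cong {suc m} p q = cong₂ _∙_ (cong₂ _·_ (p zero) (q zero)) (pairFin-cong (p ∘ suc) (q ∘ suc))

  pairFin-+ : ∀ {m} (a b : Fin m → ℤ) x
    → pairFin (λ l → a l ℤ.+ b l) x ≡ pairFin a x ∙ pairFin b x
  pairFin-+ {zero}  a b x = sym (identityˡ ε)
  pairFin-+ {suc m} a b x = trans (cong₂ _∙_ (·-+ _ _ _) (pairFin-+ (a ∘ suc) (b ∘ suc) (x ∘ suc)))
                                  (interchange _ _ _ _)

  pairFin-∙ : ∀ {m} (a : Fin m → ℤ) x y
    → pairFin a (λ l → x l ∙ y l) ≡ pairFin a x ∙ pairFin a y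
  pairFin-∙ {zero}  a x y = sym (identityˡ ε)
  pairFin-∙ {suc m} a x y = trans (cong₂ _∙_ (·-∙ _ _ _) (pairFin-∙ (a ∘ suc) (x ∘ suc) (y ∘ suc)))
                                  (interchange _ _ _ _)

  pairFin-* : ∀ {m} c (a : Fin m → ℤ) x → pairFin (λ l → c ℤ.* a l) x ≡ c · pairFin a x
  pairFin-* {zero}  c a x = sym (·-ε c)
  pairFin-* {suc m} c a x = trans (cong₂ _∙_ (·-* _ _ _) (pairFin-* c (a ∘ suc) (x ∘ suc)))
                                  (sym (·-∙ _ _ _))

  pairFin-· : ∀ {m} c (a : Fin m → ℤ) x → pairFin a (λ l → c · x l) ≡ c · pairFin a x
  pairFin-· c a x = trans (helper a x) (pairFin-* c a x)
    where
    helper : ∀ {m} (a : Fin m → ℤ) x → pairFin a (λ l → c · x l) ≡ pairFin (λ l → c ℤ.* a l) x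
    helper {zero}  a x = refl
    helper {suc m} a x = cong₂ _∙_ (trans (sym (·-* _ _ _)) (cong (_· x zero) (ℤₚ.*-comm (a zero) c)))
                                   (helper (a ∘ suc) (x ∘ suc))

  pairFin-ε : ∀ {m} (a : Fin m → ℤ) x → (∀ l → a l ≡ 0ℤ ⊎ x l ≡ ε) → pairFin a x ≡ ε
  pairFin-ε {zero}  a x h = refl
  pairFin-ε {suc m} a x h = trans (cong₂ _∙_ (head (h zero)) (pairFin-ε _ _ (h ∘ suc))) (identityˡ ε)
    where
    head : a zero ≡ 0ℤ ⊎ x zero ≡ ε → a zero · x zero ≡ ε
    head (inj₁ e) = trans (cong (_· x zero) e) (·-0 _)
    head (inj₂ e) = trans (cong (a zero ·_) e) (·-ε _)

  pairFin-single : ∀ {m} k (a : Fin m → ℤ) x → (∀ l → l ≢ k → a l ≡ 0ℤ ⊎ x l ≡ ε)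
    → pairFin a x ≡ a k · x k
  pairFin-single zero    a x h =
    trans (cong (a zero · x zero ∙_) (pairFin-ε _ _ (λ l → h (suc l) λ ()))) (identityʳ _)
  pairFin-single (suc k) a x h =
    trans (cong₂ _∙_ (trans (sym (identityʳ _)) (pairFin-ε {1} (λ _ → a zero) (λ _ → x zero) (λ _ → h zero λ ())))
                     (pairFin-single k (a ∘ suc) (x ∘ suc) (λ l ne → h (suc l) (λ { refl → ne refl }))))
          (identityˡ _)

  module _ {n : ℕ} where

    opaque
      -- The Laurent monomial x^a in the extended cluster. Over the tropical semifield it is the
      -- scalar product of `a` and `x`.
      pair : (Idx n → ℤ) → (Idx n → Carrier) → Carrier
      pair a x = pairFin (a ∘ inj₁) (x ∘ inj₁) ∙ pairFin (a ∘ inj₂) (x ∘ inj₂)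

      pair-def : ∀ (a : Idx n → ℤ) x
        → pair a x ≡ pairFin (a ∘ inj₁) (x ∘ inj₁) ∙ pairFin (a ∘ inj₂) (x ∘ inj₂)
      pair-def a x = refl

      pair-cong : ∀ {a b : Idx n → ℤ} {x y} → a ≗ b → x ≗ y → pair a x ≡ pair b y
      pair-cong p q = cong₂ _∙_ (pairFin-cong (p ∘ inj₁) (q ∘ inj₁)) (pairFin-cong (p ∘ inj₂) (q ∘ inj₂))

      pair-+ : ∀ (a b : Idx n → ℤ) x → pair (λ l → a l ℤ.+ b l) x ≡ pair a x ∙ pair b x
      pair-+ a b x = trans (cong₂ _∙_ (pairFin-+ (a ∘ inj₁) (b ∘ inj₁) _) (pairFin-+ (a ∘ inj₂) (b ∘ inj₂) _)) (interchange _ _ _ _)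

      pair-∙ : ∀ (a : Idx n → ℤ) x y → pair a (λ l → x l ∙ y l) ≡ pair a x ∙ pair a y
      pair-∙ a x y = trans (cong₂ _∙_ (pairFin-∙ _ (x ∘ inj₁) (y ∘ inj₁)) (pairFin-∙ _ (x ∘ inj₂) (y ∘ inj₂))) (interchange _ _ _ _)

      pair-* : ∀ c (a : Idx n → ℤ) x → pair (λ l → c ℤ.* a l) x ≡ c · pair a x
      pair-* c a x = trans (cong₂ _∙_ (pairFin-* c (a ∘ inj₁) _) (pairFin-* c (a ∘ inj₂) _)) (sym (·-∙ _ _ _))

      pair-· : ∀ c (a : Idx n → ℤ) x → pair a (λ l → c · x l) ≡ c · pair a x
      pair-· c a x = trans (cong₂ _∙_ (pairFin-· c _ (x ∘ inj₁)) (pairFin-· c _ (x ∘ inj₂))) (sym (·-∙ _ _ _))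

      pair-ε : ∀ (a : Idx n → ℤ) x → (∀ l → a l ≡ 0ℤ ⊎ x l ≡ ε) → pair a x ≡ ε
      pair-ε a x h = trans (cong₂ _∙_ (pairFin-ε _ _ (h ∘ inj₁)) (pairFin-ε _ _ (h ∘ inj₂))) (identityˡ ε)

      pair-single : ∀ k (a : Idx n → ℤ) x → (∀ l → l ≢ inj₁ k → a l ≡ 0ℤ ⊎ x l ≡ ε)
        → pair a x ≡ a (inj₁ k) · x (inj₁ k)
      pair-single k a x h =
        trans (cong₂ _∙_ (pairFin-single k _ _ (λ l ne → h (inj₁ l) (λ { refl → ne refl })))
                         (pairFin-ε _ _ (λ l → h (inj₂ l) λ ())))
              (identityʳ _)

      pair-agree : ∀ (a : Idx n → ℤ) x y → (∀ l → a l ≡ 0ℤ ⊎ x l ≡ y l) → pair a x ≡ pair a y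
      pair-agree a x y h = cong₂ _∙_ (go _ _ _ (h ∘ inj₁)) (go _ _ _ (h ∘ inj₂))
        where
        go : ∀ {m} (a : Fin m → ℤ) x y → (∀ l → a l ≡ 0ℤ ⊎ x l ≡ y l) → pairFin a x ≡ pairFin a y
        go {zero}  a x y h = refl
        go {suc m} a x y h = cong₂ _∙_ (head (h zero)) (go _ _ _ (h ∘ suc))
          where
          head : a zero ≡ 0ℤ ⊎ x zero ≡ y zero → a zero · x zero ≡ a zero · y zero
          head (inj₁ e) = trans (cong (_· x zero) e) (trans (·-0 _) (trans (sym (·-0 _)) (cong (_· y zero) (sym e))))
          head (inj₂ e) = cong (a zero ·_) e

    pair-update : ∀ k u (a : Idx n → ℤ) x y → (∀ l → l ≢ inj₁ k → x l ≡ y l)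
      → y (inj₁ k) ≡ x (inj₁ k) ∙ u → pair a y ≡ pair a x ∙ a (inj₁ k) · u
    pair-update k u a x y off at = begin
      pair a y                        ≡⟨ pair-cong (λ _ → refl) split ⟩
      pair a (λ l → x l ∙ δ l)        ≡⟨ pair-∙ a x δ ⟩
      pair a x ∙ pair a δ             ≡⟨ cong (pair a x ∙_) (pair-single k a δ (λ l ne → inj₂ (δ-off l ne))) ⟩
      pair a x ∙ a (inj₁ k) · δ (inj₁ k) ≡⟨ cong (λ v → pair a x ∙ a (inj₁ k) · v) δ-at ⟩
      pair a x ∙ a (inj₁ k) · u       ∎
      where
      open ≡-Reasoning
      δ : Idx n → Carrier
      δ (inj₁ l) with l ≟ k
      ... | yes _ = u
      ... | no  _ = ε
      δ (inj₂ l) = ε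
      δ-at : δ (inj₁ k) ≡ u
      δ-at with k ≟ k
      ... | yes _ = refl
      ... | no ne = ⊥-elim (ne refl)
      δ-off : ∀ l → l ≢ inj₁ k → δ l ≡ ε
      δ-off (inj₁ l) ne with l ≟ k
      ... | yes refl = ⊥-elim (ne refl)
      ... | no  _ = refl
      δ-off (inj₂ l) ne = refl
      split : ∀ l → y l ≡ x l ∙ δ l
      split (inj₁ l) with l ≟ k
      ... | yes refl = at
      ... | no ne    = trans (sym (off (inj₁ l) (λ { refl → ne refl }))) (sym (identityʳ _))
      split (inj₂ l) = trans (sym (off (inj₂ l) λ ())) (sym (identityʳ _))

-- Generalized mutation of extended exchange matrices

module Mutation {n : ℕ} (D : GenFixedData n) where
  open GenFixedData D using (d; d-pos; r)

  R : Fin n → ℤ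
  R k = + r k

  δ : Fin n → Idx n → ℤ
  δ k (inj₁ l) with l ≟ k
  ... | yes _ = 1ℤ
  ... | no  _ = 0ℤ
  δ k (inj₂ l) = 0ℤ

  δ-same : ∀ k → δ k (inj₁ k) ≡ 1ℤ
  δ-same k with k ≟ k
  ... | yes _ = refl
  ... | no ne = ⊥-elim (ne refl)

  δ-other : ∀ k l → l ≢ inj₁ k → δ k l ≡ 0ℤ
  δ-other k (inj₁ l) ne with l ≟ k
  ... | yes refl = ⊥-elim (ne refl)
  ... | no  _ = refl
  δ-other k (inj₂ l) ne = refl

  -- The last summand turns the generic formula, which gives B c k in column k,
  -- into - B c k; this makes the row a linear combination of fixed rows.
  μrow : Fin n → ExtMat n → Fin n → Idx n → ℤ
  μrow k B c l = (B c l ℤ.+ ((R k ℤ.* B c (inj₁ k) ⁺) ℤ.* B k l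
                             ℤ.+ B c (inj₁ k) ℤ.* (R k ℤ.* (ℤ.- B k l) ⁺)))
                 ℤ.+ (ℤ.- + 2 ℤ.* B c (inj₁ k)) ℤ.* δ k l

  μ : Fin n → ExtMat n → ExtMat n
  μ k B c l with c ≟ k
  ... | yes _ = ℤ.- B c l
  ... | no  _ = μrow k B c l

  μ-same : ∀ k B l → μ k B k l ≡ ℤ.- B k l
  μ-same k B l with k ≟ k
  ... | yes _ = refl
  ... | no ne = ⊥-elim (ne refl)

  μ-other : ∀ k B {c} → c ≢ k → ∀ l → μ k B c l ≡ μrow k B c l
  μ-other k B {c} ne l with c ≟ k
  ... | yes e = ⊥-elim (ne e)
  ... | no  _ = refl

  infix 4 _≗₂_

  _≗₂_ : ExtMat n → ExtMat n → Set
  B ≗₂ B′ = ∀ c l → B c l ≡ B′ c l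

  neg : ExtMat n → ExtMat n
  neg B c l = ℤ.- B c l

  μrow-cong : ∀ k {B B′} → B ≗₂ B′ → ∀ c l → μrow k B c l ≡ μrow k B′ c l
  μrow-cong k p c l rewrite p c l | p c (inj₁ k) | p k l = refl

  μ-cong : ∀ k {B B′} → B ≗₂ B′ → μ k B ≗₂ μ k B′
  μ-cong k p c l with c ≟ k
  ... | yes _ = cong ℤ.-_ (p c l)
  ... | no  _ = μrow-cong k p c l

  μ-col : ∀ k B → B k (inj₁ k) ≡ 0ℤ → ∀ c → μ k B c (inj₁ k) ≡ ℤ.- B c (inj₁ k)
  μ-col k B diag c with c ≟ k
  ... | yes _ = refl
  ... | no  _ rewrite diag | δ-same k = lemma (R k) (B c (inj₁ k) ⁺) (B c (inj₁ k))
    where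
    lemma : ∀ R bp b → (b ℤ.+ ((R ℤ.* bp) ℤ.* 0ℤ ℤ.+ b ℤ.* (R ℤ.* 0ℤ))) ℤ.+ (ℤ.- + 2 ℤ.* b) ℤ.* 1ℤ ≡ ℤ.- b
    lemma = solve-∀

  -- By x⁺ = x + (-x)⁺ the mutation rule can be written with either choice of positive and negative
  -- parts. Hence the sign of one entry, or of one c-vector, may be fixed at will.
  μ-neg : ∀ k B → μ k (neg B) ≗₂ neg (μ k B)
  μ-neg k B c l with c ≟ k
  ... | yes _ = refl
  ... | no  _ = begin
    μrow k (neg B) c l
      ≡⟨ cong (λ v → (ℤ.- B c l ℤ.+ ((R k ℤ.* (ℤ.- b) ⁺) ℤ.* (ℤ.- K) ℤ.+ (ℤ.- b) ℤ.* (R k ℤ.* v)))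
                     ℤ.+ (ℤ.- + 2 ℤ.* (ℤ.- b)) ℤ.* δ k l)
              (trans (cong _⁺ (ℤₚ.neg-involutive K)) (⁺-split K)) ⟩
    _ ≡⟨ lemma (B c l) (R k) b ((ℤ.- b) ⁺) K ((ℤ.- K) ⁺) (δ k l) ⟩
    ℤ.- ((B c l ℤ.+ ((R k ℤ.* (b ℤ.+ (ℤ.- b) ⁺)) ℤ.* K ℤ.+ b ℤ.* (R k ℤ.* (ℤ.- K) ⁺)))
         ℤ.+ (ℤ.- + 2 ℤ.* b) ℤ.* δ k l)
      ≡⟨ cong (λ v → ℤ.- ((B c l ℤ.+ ((R k ℤ.* v) ℤ.* K ℤ.+ b ℤ.* (R k ℤ.* (ℤ.- K) ⁺)))
                          ℤ.+ (ℤ.- + 2 ℤ.* b) ℤ.* δ k l)) (sym (⁺-split b)) ⟩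
    ℤ.- μrow k B c l ∎
    where
    open ≡-Reasoning
    b = B c (inj₁ k)
    K = B k l
    lemma : ∀ x R b bm K Km e →
      (ℤ.- x ℤ.+ ((R ℤ.* bm) ℤ.* (ℤ.- K) ℤ.+ (ℤ.- b) ℤ.* (R ℤ.* (K ℤ.+ Km)))) ℤ.+ (ℤ.- + 2 ℤ.* (ℤ.- b)) ℤ.* e
      ≡ ℤ.- ((x ℤ.+ ((R ℤ.* (b ℤ.+ bm)) ℤ.* K ℤ.+ b ℤ.* (R ℤ.* Km))) ℤ.+ (ℤ.- + 2 ℤ.* b) ℤ.* e)
    lemma = solve-∀

  μ-involutive : ∀ k B → B k (inj₁ k) ≡ 0ℤ → μ k (μ k B) ≗₂ B
  μ-involutive k B diag c l with c ≟ k
  ... | yes refl = trans (cong ℤ.-_ (μ-same k B l)) (ℤₚ.neg-involutive (B k l))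
  ... | no ne = begin
    μrow k (μ k B) c l
      ≡⟨ cong (λ v → v ℤ.+ (ℤ.- + 2 ℤ.* μ k B c (inj₁ k)) ℤ.* δ k l)
           (cong₂ ℤ._+_ (μ-other k B ne l)
              (cong₂ ℤ._+_ (cong₂ (λ u v → (R k ℤ.* u ⁺) ℤ.* v) (μ-col k B diag c) (μ-same k B l))
                           (cong₂ (λ u v → u ℤ.* (R k ℤ.* v)) (μ-col k B diag c)
                              (trans (cong (λ v → (ℤ.- v) ⁺) (μ-same k B l))
                                     (trans (cong _⁺ (ℤₚ.neg-involutive K)) (⁺-split K)))))) ⟩
    (μrow k B c l ℤ.+ ((R k ℤ.* (ℤ.- b) ⁺) ℤ.* (ℤ.- K) ℤ.+ (ℤ.- b) ℤ.* (R k ℤ.* (K ℤ.+ (ℤ.- K) ⁺))))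
      ℤ.+ (ℤ.- + 2 ℤ.* μ k B c (inj₁ k)) ℤ.* δ k l
      ≡⟨ cong₂ (λ u v → (((B c l ℤ.+ ((R k ℤ.* u) ℤ.* K ℤ.+ b ℤ.* (R k ℤ.* (ℤ.- K) ⁺))) ℤ.+ (ℤ.- + 2 ℤ.* b) ℤ.* δ k l)
                  ℤ.+ ((R k ℤ.* (ℤ.- b) ⁺) ℤ.* (ℤ.- K) ℤ.+ (ℤ.- b) ℤ.* (R k ℤ.* (K ℤ.+ (ℤ.- K) ⁺))))
                  ℤ.+ (ℤ.- + 2 ℤ.* v) ℤ.* δ k l) (⁺-split b) (μ-col k B diag c) ⟩
    _ ≡⟨ lemma (B c l) (R k) b ((ℤ.- b) ⁺) K ((ℤ.- K) ⁺) (δ k l) ⟩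
    B c l ∎
    where
    open ≡-Reasoning
    b = B c (inj₁ k)
    K = B k l
    lemma : ∀ x R b bm K Km e →
      (((x ℤ.+ ((R ℤ.* (b ℤ.+ bm)) ℤ.* K ℤ.+ b ℤ.* (R ℤ.* Km))) ℤ.+ (ℤ.- + 2 ℤ.* b) ℤ.* e)
        ℤ.+ ((R ℤ.* bm) ℤ.* (ℤ.- K) ℤ.+ (ℤ.- b) ℤ.* (R ℤ.* (K ℤ.+ Km))))
        ℤ.+ (ℤ.- + 2 ℤ.* (ℤ.- b)) ℤ.* e ≡ x
    lemma = solve-∀

  -- For the initial matrix, d_i ε_ij is the value of the form on (d_i e_i , d_j e_j), so this is
  -- its skew-symmetry on N°. Frozen columns are left free.
  record Skew (B : ExtMat n) : Set where
    constructor mkSkew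
    field skew : ∀ i j → + d i ℤ.* B i (inj₁ j) ≡ ℤ.- (+ d j ℤ.* B j (inj₁ i))
  open Skew

  instance
    d-nonZero : ∀ {i} → ℕ.NonZero (d i)
    d-nonZero {i} = ℕ.>-nonZero (d-pos i)

  skew-diag : ∀ {B} → Skew B → ∀ k → B k (inj₁ k) ≡ 0ℤ
  skew-diag {B} sk k = ℤₚ.*-cancelˡ-≡ (+ d k) _ _ (trans (self-neg _ (skew sk k k)) (sym (ℤₚ.*-zeroʳ (+ d k))))
    where
    self-neg : ∀ x → x ≡ ℤ.- x → x ≡ 0ℤ
    self-neg (+ zero)   _ = refl
    self-neg (+ suc _)  ()
    self-neg -[1+ _ ]   ()

  skew-⁺ : ∀ {B} → Skew B → ∀ i j → + d i ℤ.* B i (inj₁ j) ⁺ ≡ + d j ℤ.* (ℤ.- B j (inj₁ i)) ⁺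
  skew-⁺ {B} sk i j = begin
    + d i ℤ.* B i (inj₁ j) ⁺          ≡⟨ sym (⁺-scale (d i) _) ⟩
    (+ d i ℤ.* B i (inj₁ j)) ⁺        ≡⟨ cong _⁺ (skew sk i j) ⟩
    (ℤ.- (+ d j ℤ.* B j (inj₁ i))) ⁺  ≡⟨ cong _⁺ (ℤₚ.neg-distribʳ-* (+ d j) _) ⟩
    (+ d j ℤ.* ℤ.- B j (inj₁ i)) ⁺    ≡⟨ ⁺-scale (d j) _ ⟩
    + d j ℤ.* (ℤ.- B j (inj₁ i)) ⁺    ∎
    where open ≡-Reasoning

  skew-neg : ∀ {B} → Skew B → Skew (neg B)
  skew (skew-neg {B} sk) i j = trans (sym (ℤₚ.neg-distribʳ-* (+ d i) _))
    (cong ℤ.-_ (trans (skew sk i j) (ℤₚ.neg-distribʳ-* (+ d j) _)))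

  skew-nonpos : ∀ {B} → Skew B → ∀ i j → 0ℤ ≤ B i (inj₁ j) → B j (inj₁ i) ≤ 0ℤ
  skew-nonpos {B} sk i j le = ℤₚ.*-cancelˡ-≤-pos (B j (inj₁ i)) 0ℤ (+ d j) {{ℤ.positive (ℤ.+<+ (d-pos j))}} (begin
    + d j ℤ.* B j (inj₁ i)        ≡⟨ skew sk j i ⟩
    ℤ.- (+ d i ℤ.* B i (inj₁ j))  ≤⟨ ℤₚ.neg-mono-≤ (subst (_≤ + d i ℤ.* B i (inj₁ j)) (ℤₚ.*-zeroʳ (+ d i))
                                        (ℤₚ.*-monoˡ-≤-nonNeg (+ d i) le)) ⟩
    0ℤ                            ≡⟨ sym (ℤₚ.*-zeroʳ (+ d j)) ⟩
    + d j ℤ.* 0ℤ                  ∎)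
    where open ℤₚ.≤-Reasoning

  skew-zero : ∀ {B} → Skew B → ∀ i j → B i (inj₁ j) ≡ 0ℤ → B j (inj₁ i) ≡ 0ℤ
  skew-zero {B} sk i j e = ℤₚ.*-cancelˡ-≡ (+ d j) _ _ (begin
    + d j ℤ.* B j (inj₁ i)        ≡⟨ skew sk j i ⟩
    ℤ.- (+ d i ℤ.* B i (inj₁ j))  ≡⟨ cong (λ v → ℤ.- (+ d i ℤ.* v)) e ⟩
    ℤ.- (+ d i ℤ.* 0ℤ)            ≡⟨ cong ℤ.-_ (ℤₚ.*-zeroʳ (+ d i)) ⟩
    0ℤ                            ≡⟨ sym (ℤₚ.*-zeroʳ (+ d j)) ⟩
    + d j ℤ.* 0ℤ                  ∎)
    where open ≡-Reasoning

  skew-μ : ∀ {B} k → Skew B → Skew (μ k B)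
  skew (skew-μ {B} k sk) i j = cases (i ≟ k) (j ≟ k)
    where
    open ≡-Reasoning
    diag = skew-diag sk k
    cases : Dec (i ≡ k) → Dec (j ≡ k) → + d i ℤ.* μ k B i (inj₁ j) ≡ ℤ.- (+ d j ℤ.* μ k B j (inj₁ i))
    cases (yes refl) _ = begin
      + d k ℤ.* μ k B k (inj₁ j)        ≡⟨ cong (+ d k ℤ.*_) (μ-same k B _) ⟩
      + d k ℤ.* ℤ.- B k (inj₁ j)        ≡⟨ skew (skew-neg sk) k j ⟩
      ℤ.- (+ d j ℤ.* ℤ.- B j (inj₁ k))  ≡⟨ cong (λ v → ℤ.- (+ d j ℤ.* v)) (sym (μ-col k B diag j)) ⟩
      ℤ.- (+ d j ℤ.* μ k B j (inj₁ k))  ∎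
    cases _ (yes refl) = begin
      + d i ℤ.* μ k B i (inj₁ k)        ≡⟨ cong (+ d i ℤ.*_) (μ-col k B diag i) ⟩
      + d i ℤ.* ℤ.- B i (inj₁ k)        ≡⟨ skew (skew-neg sk) i k ⟩
      ℤ.- (+ d k ℤ.* ℤ.- B k (inj₁ i))  ≡⟨ cong (λ v → ℤ.- (+ d k ℤ.* v)) (sym (μ-same k B _)) ⟩
      ℤ.- (+ d k ℤ.* μ k B k (inj₁ i))  ∎
    cases (no i≢k) (no j≢k) = begin
      + d i ℤ.* μ k B i (inj₁ j)
        ≡⟨ cong (+ d i ℤ.*_) (μ-off i≢k j≢k) ⟩
      _ ≡⟨ expand (+ d i) (B i (inj₁ j)) (R k) (B i (inj₁ k) ⁺) (B k (inj₁ j)) (B i (inj₁ k)) ((ℤ.- B k (inj₁ j)) ⁺) ⟩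
      + d i ℤ.* B i (inj₁ j) ℤ.+ R k ℤ.* ((+ d i ℤ.* B i (inj₁ k) ⁺) ℤ.* B k (inj₁ j) ℤ.+ (+ d i ℤ.* B i (inj₁ k)) ℤ.* (ℤ.- B k (inj₁ j)) ⁺)
        ≡⟨ cong₂ ℤ._+_ (skew sk i j) (cong (R k ℤ.*_) (cong₂ (λ u v → u ℤ.* B k (inj₁ j) ℤ.+ v ℤ.* (ℤ.- B k (inj₁ j)) ⁺) (skew-⁺ sk i k) (skew sk i k))) ⟩
      ℤ.- (+ d j ℤ.* B j (inj₁ i)) ℤ.+ R k ℤ.* ((+ d k ℤ.* (ℤ.- B k (inj₁ i)) ⁺) ℤ.* B k (inj₁ j) ℤ.+ ℤ.- (+ d k ℤ.* B k (inj₁ i)) ℤ.* (ℤ.- B k (inj₁ j)) ⁺)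
        ≡⟨ regroup (ℤ.- (+ d j ℤ.* B j (inj₁ i))) (R k) (+ d k) ((ℤ.- B k (inj₁ i)) ⁺) (B k (inj₁ j)) (B k (inj₁ i)) ((ℤ.- B k (inj₁ j)) ⁺) ⟩
      ℤ.- (+ d j ℤ.* B j (inj₁ i)) ℤ.+ R k ℤ.* ((ℤ.- B k (inj₁ i)) ⁺ ℤ.* (+ d k ℤ.* B k (inj₁ j)) ℤ.+ ℤ.- (B k (inj₁ i) ℤ.* (+ d k ℤ.* (ℤ.- B k (inj₁ j)) ⁺)))
        ≡⟨ cong₂ (λ u v → ℤ.- (+ d j ℤ.* B j (inj₁ i)) ℤ.+ R k ℤ.* ((ℤ.- B k (inj₁ i)) ⁺ ℤ.* u ℤ.+ ℤ.- (B k (inj₁ i) ℤ.* v))) (skew sk k j) (sym (skew-⁺ sk j k)) ⟩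
      _ ≡⟨ collect (+ d j) (B j (inj₁ i)) (R k) (B j (inj₁ k) ⁺) (B k (inj₁ i)) (B j (inj₁ k)) ((ℤ.- B k (inj₁ i)) ⁺) ⟩
      _ ≡⟨ cong (λ v → ℤ.- (+ d j ℤ.* v)) (sym (μ-off j≢k i≢k)) ⟩
      ℤ.- (+ d j ℤ.* μ k B j (inj₁ i))  ∎
      where
      μ-off : ∀ {c l} → c ≢ k → l ≢ k → μ k B c (inj₁ l)
        ≡ (B c (inj₁ l) ℤ.+ ((R k ℤ.* B c (inj₁ k) ⁺) ℤ.* B k (inj₁ l)
             ℤ.+ B c (inj₁ k) ℤ.* (R k ℤ.* (ℤ.- B k (inj₁ l)) ⁺))) ℤ.+ (ℤ.- + 2 ℤ.* B c (inj₁ k)) ℤ.* 0ℤ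
      μ-off {c} {l} c≢k l≢k = trans (μ-other k B c≢k _)
        (cong (λ v → (B c (inj₁ l) ℤ.+ ((R k ℤ.* B c (inj₁ k) ⁺) ℤ.* B k (inj₁ l)
             ℤ.+ B c (inj₁ k) ℤ.* (R k ℤ.* (ℤ.- B k (inj₁ l)) ⁺))) ℤ.+ (ℤ.- + 2 ℤ.* B c (inj₁ k)) ℤ.* v)
          (δ-other k (inj₁ l) (λ { refl → l≢k refl })))
      expand : ∀ D x R bp K b Km → D ℤ.* ((x ℤ.+ ((R ℤ.* bp) ℤ.* K ℤ.+ b ℤ.* (R ℤ.* Km))) ℤ.+ (ℤ.- + 2 ℤ.* b) ℤ.* 0ℤ)
        ≡ D ℤ.* x ℤ.+ R ℤ.* ((D ℤ.* bp) ℤ.* K ℤ.+ (D ℤ.* b) ℤ.* Km)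
      expand = solve-∀
      regroup : ∀ x R D bm K b Km → x ℤ.+ R ℤ.* ((D ℤ.* bm) ℤ.* K ℤ.+ ℤ.- (D ℤ.* b) ℤ.* Km)
        ≡ x ℤ.+ R ℤ.* (bm ℤ.* (D ℤ.* K) ℤ.+ ℤ.- (b ℤ.* (D ℤ.* Km)))
      regroup = solve-∀
      collect : ∀ D x R bp K b Km → ℤ.- (D ℤ.* x) ℤ.+ R ℤ.* (Km ℤ.* ℤ.- (D ℤ.* b) ℤ.+ ℤ.- (K ℤ.* (D ℤ.* bp)))
        ≡ ℤ.- (D ℤ.* ((x ℤ.+ ((R ℤ.* bp) ℤ.* K ℤ.+ b ℤ.* (R ℤ.* Km))) ℤ.+ (ℤ.- + 2 ℤ.* b) ℤ.* 0ℤ))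
      collect = solve-∀

  mutations : List (Fin n) → ExtMat n → ExtMat n
  mutations []       B = B
  mutations (k ∷ ks) B = mutations ks (μ k B)

-- Exchange relations over a semifield

module Seeds {n : ℕ} (D : GenFixedData n) (S : Semifield) where
  open Mutation D
  open Semifield S
  open Pairing S

  Cluster : Set
  Cluster = Idx n → Carrier

  module CM = Algebra.Solver.CommutativeMonoid commutativeMonoid

  M⁻ : Fin n → ExtMat n → Cluster → Carrier
  M⁻ k B x = pair (λ l → R k ℤ.* (ℤ.- B k l) ⁺) x

  Ŷ : Fin n → ExtMat n → Cluster → Carrier
  Ŷ k B x = R k · pair (B k) x

  -- `Ŷ` is the quotient M⁺ / M⁻, so M⁻ · φ Ŷ is M⁺ ⊕ M⁻: the exchange polynomial reduced to its two
  -- extreme terms, with φ as the only addition.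
  exchange : Fin n → ExtMat n → Cluster → Carrier
  exchange k B x = ℤ.-1ℤ · x (inj₁ k) ∙ (M⁻ k B x ∙ φ (Ŷ k B x))

  step : Fin n → ExtMat n → Cluster → Cluster
  step k B x (inj₁ l) with l ≟ k
  ... | yes _ = exchange k B x
  ... | no  _ = x (inj₁ l)
  step k B x (inj₂ l) = x (inj₂ l)

  step-same : ∀ k B x → step k B x (inj₁ k) ≡ exchange k B x
  step-same k B x with k ≟ k
  ... | yes _ = refl
  ... | no ne = ⊥-elim (ne refl)

  step-other : ∀ k B x l → l ≢ inj₁ k → step k B x l ≡ x l
  step-other k B x (inj₁ l) ne with l ≟ k
  ... | yes refl = ⊥-elim (ne refl)
  ... | no  _ = refl
  step-other k B x (inj₂ l) ne = refl

  pair-δ : ∀ k x → pair (δ k) x ≡ x (inj₁ k)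
  pair-δ k x = trans (pair-single k (δ k) x (λ l ne → inj₁ (δ-other k l ne)))
                     (trans (cong (_· x (inj₁ k)) (δ-same k)) (·-1 _))

  -- y is obtained from x by an exchange relation in direction k in which the
  -- factor φ (Ŷ k B x) is replaced by an arbitrary z.
  module _ {k : Fin n} {B : ExtMat n} (diag : B k (inj₁ k) ≡ 0ℤ) {x y : Cluster} {z : Carrier}
           (off : ∀ l → l ≢ inj₁ k → y l ≡ x l)
           (at : y (inj₁ k) ≡ ℤ.-1ℤ · x (inj₁ k) ∙ (M⁻ k B x ∙ z)) where

    private
      xₖ = x (inj₁ k)
      u  = (ℤ.- + 2) · xₖ ∙ (M⁻ k B x ∙ z)

      at′ : y (inj₁ k) ≡ xₖ ∙ u
      at′ = begin
        y (inj₁ k)                                    ≡⟨ at ⟩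
        ℤ.-1ℤ · xₖ ∙ (M⁻ k B x ∙ z)                   ≡⟨ cong (_∙ (M⁻ k B x ∙ z)) (·-+ 1ℤ (ℤ.- + 2) xₖ) ⟩
        (1ℤ · xₖ ∙ (ℤ.- + 2) · xₖ) ∙ (M⁻ k B x ∙ z)   ≡⟨ assoc _ _ _ ⟩
        1ℤ · xₖ ∙ u                                   ≡⟨ cong (_∙ u) (·-1 xₖ) ⟩
        xₖ ∙ u                                        ∎
        where open ≡-Reasoning

      pair-y : ∀ a → pair a y ≡ pair a x ∙ a (inj₁ k) · u
      pair-y a = pair-update k u a x y (λ l ne → sym (off l ne)) at′

    pair-exchange-same : pair (μ k B k) y ≡ ℤ.-1ℤ · pair (B k) x
    pair-exchange-same = begin
      pair (μ k B k) y                            ≡⟨ pair-cong (λ l → trans (μ-same k B l) (sym (ℤₚ.-1*i≡-i _))) (λ _ → refl) ⟩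
      pair (λ l → ℤ.-1ℤ ℤ.* B k l) y              ≡⟨ pair-* _ _ _ ⟩
      ℤ.-1ℤ · pair (B k) y                        ≡⟨ cong (ℤ.-1ℤ ·_) (pair-agree (B k) y x agree) ⟩
      ℤ.-1ℤ · pair (B k) x                        ∎
      where
      open ≡-Reasoning
      agree : ∀ l → B k l ≡ 0ℤ ⊎ y l ≡ x l
      agree (inj₁ l) with l ≟ k
      ... | yes refl = inj₁ diag
      ... | no ne    = inj₂ (off (inj₁ l) (λ { refl → ne refl }))
      agree (inj₂ l) = inj₂ (off (inj₂ l) λ ())

    -- The mutation rule of ŷ-variables. The powers of x_k and of M⁻ contributed by `μrow` cancel
    -- those brought in by the new variable, whose exponent is -B c k. With z = φ Ŷ this is the true
    -- exchange; with z the unit it is a monomial change of variables.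
    pair-exchange-other : ∀ {c} → c ≢ k → pair (μ k B c) y
      ≡ pair (B c) x ∙ ((R k ℤ.* B c (inj₁ k) ⁺) · pair (B k) x ∙ (ℤ.- B c (inj₁ k)) · z)
    pair-exchange-other {c} ne = begin
      pair (μ k B c) y
        ≡⟨ pair-y (μ k B c) ⟩
      pair (μ k B c) x ∙ μ k B c (inj₁ k) · u
        ≡⟨ cong₂ _∙_ row (cong (_· u) (μ-col k B diag c)) ⟩
      (P ∙ (ρ · K ∙ b · q)) ∙ (ℤ.- + 2 ℤ.* b) · xₖ ∙ (ℤ.- b) · u
        ≡⟨ cong ((P ∙ (ρ · K ∙ b · q)) ∙ (ℤ.- + 2 ℤ.* b) · xₖ ∙_)
             (trans (·-∙ _ _ _) (cong₂ _∙_ (sym (·-* _ _ _)) (·-∙ _ _ _))) ⟩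
      (P ∙ (ρ · K ∙ b · q)) ∙ (ℤ.- + 2 ℤ.* b) · xₖ ∙ ((ℤ.- b ℤ.* ℤ.- + 2) · xₖ ∙ ((ℤ.- b) · q ∙ (ℤ.- b) · z))
        ≡⟨ CM.solve 7 (λ p v w s s′ w′ t → ((p CM.⊕ (v CM.⊕ w)) CM.⊕ s) CM.⊕ (s′ CM.⊕ (w′ CM.⊕ t))
             CM.⊜ ((s CM.⊕ s′) CM.⊕ (w CM.⊕ w′)) CM.⊕ (p CM.⊕ (v CM.⊕ t))) refl
             P (ρ · K) (b · q) ((ℤ.- + 2 ℤ.* b) · xₖ) ((ℤ.- b ℤ.* ℤ.- + 2) · xₖ) ((ℤ.- b) · q) ((ℤ.- b) · z) ⟩
      ((ℤ.- + 2 ℤ.* b) · xₖ ∙ (ℤ.- b ℤ.* ℤ.- + 2) · xₖ) ∙ (b · q ∙ (ℤ.- b) · q) ∙ (P ∙ (ρ · K ∙ (ℤ.- b) · z))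
        ≡⟨ cong (_∙ (P ∙ (ρ · K ∙ (ℤ.- b) · z)))
             (trans (cong₂ _∙_ (·-cancel xₖ (lemma b)) (·-cancel q (ℤₚ.+-inverseʳ b))) (identityˡ ε)) ⟩
      ε ∙ (P ∙ (ρ · K ∙ (ℤ.- b) · z))
        ≡⟨ identityˡ _ ⟩
      P ∙ (ρ · K ∙ (ℤ.- b) · z) ∎
      where
      open ≡-Reasoning
      b = B c (inj₁ k)
      ρ = R k ℤ.* b ⁺
      P = pair (B c) x
      K = pair (B k) x
      q = M⁻ k B x
      lemma : ∀ b → ℤ.- + 2 ℤ.* b ℤ.+ ℤ.- b ℤ.* ℤ.- + 2 ≡ 0ℤ
      lemma = solve-∀
      row : pair (μ k B c) x ≡ (P ∙ (ρ · K ∙ b · q)) ∙ (ℤ.- + 2 ℤ.* b) · xₖ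
      row = begin
        pair (μ k B c) x     ≡⟨ pair-cong (μ-other k B ne) (λ _ → refl) ⟩
        pair (μrow k B c) x  ≡⟨ pair-+ _ _ x ⟩
        pair (λ l → B c l ℤ.+ (ρ ℤ.* B k l ℤ.+ b ℤ.* (R k ℤ.* (ℤ.- B k l) ⁺))) x ∙ pair (λ l → (ℤ.- + 2 ℤ.* b) ℤ.* δ k l) x
          ≡⟨ cong₂ _∙_ (trans (pair-+ _ _ x) (cong (P ∙_) (trans (pair-+ _ _ x) (cong₂ _∙_ (pair-* _ _ _) (pair-* _ _ _)))))
                       (trans (pair-* _ _ _) (cong ((ℤ.- + 2 ℤ.* b) ·_) (pair-δ k x))) ⟩
        (P ∙ (ρ · K ∙ b · q)) ∙ (ℤ.- + 2 ℤ.* b) · xₖ ∎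

  ŷ-step-same : ∀ k {B} x → B k (inj₁ k) ≡ 0ℤ → pair (μ k B k) (step k B x) ≡ ℤ.-1ℤ · pair (B k) x
  ŷ-step-same k {B} x diag = pair-exchange-same diag (step-other k B x) (step-same k B x)

  ŷ-step-other : ∀ k {B} x → B k (inj₁ k) ≡ 0ℤ → ∀ {c} → c ≢ k → pair (μ k B c) (step k B x)
      ≡ pair (B c) x ∙ ((R k ℤ.* B c (inj₁ k) ⁺) · pair (B k) x ∙ (ℤ.- B c (inj₁ k)) · φ (Ŷ k B x))
  ŷ-step-other k {B} x diag = pair-exchange-other diag (step-other k B x) (step-same k B x)

  exchange-cong : ∀ k {B B′ x x′} → (∀ l → B k l ≡ B′ k l) → x ≗ x′ → exchange k B x ≡ exchange k B′ x′
  exchange-cong k p q = cong₂ (λ u v → ℤ.-1ℤ · u ∙ v) (q (inj₁ k))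
    (cong₂ (λ u v → u ∙ φ (R k · v)) (pair-cong (λ l → cong (λ v → R k ℤ.* (ℤ.- v) ⁺) (p l)) q) (pair-cong p q))

  step-cong : ∀ k {B B′ x x′} → (∀ l → B k l ≡ B′ k l) → x ≗ x′ → step k B x ≗ step k B′ x′
  step-cong k {B} {B′} p q (inj₁ l) with l ≟ k
  ... | yes _ = exchange-cong k {B} {B′} p q
  ... | no  _ = q (inj₁ l)
  step-cong k p q (inj₂ l) = q (inj₂ l)

  pair-neg : ∀ (a : Idx n → ℤ) x → pair (λ l → ℤ.- a l) x ≡ ℤ.-1ℤ · pair a x
  pair-neg a x = trans (pair-cong (λ l → sym (ℤₚ.-1*i≡-i _)) (λ _ → refl)) (pair-* _ _ _)

  M⁺-eq : ∀ k B x → pair (λ l → R k ℤ.* (ℤ.- (ℤ.- B k l)) ⁺) x ≡ Ŷ k B x ∙ M⁻ k B x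
  M⁺-eq k B x = begin
    pair (λ l → R k ℤ.* (ℤ.- (ℤ.- B k l)) ⁺) x
      ≡⟨ pair-cong (λ l → trans (cong (R k ℤ.*_) (trans (cong _⁺ (ℤₚ.neg-involutive (B k l))) (⁺-split (B k l))))
                                (ℤₚ.*-distribˡ-+ (R k) _ _)) (λ _ → refl) ⟩
    pair (λ l → R k ℤ.* B k l ℤ.+ R k ℤ.* (ℤ.- B k l) ⁺) x ≡⟨ pair-+ _ _ x ⟩
    pair (λ l → R k ℤ.* B k l) x ∙ M⁻ k B x                ≡⟨ cong (_∙ M⁻ k B x) (pair-* _ _ _) ⟩
    Ŷ k B x ∙ M⁻ k B x                                     ∎
    where open ≡-Reasoning

  ·-swap : ∀ a b x → a · b · x ≡ b · a · x
  ·-swap a b x = trans (sym (·-* a b x)) (trans (cong (_· x) (ℤₚ.*-comm a b)) (·-* b a x))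

  -- Negation swaps M⁺ and M⁻, whose sum is unchanged.
  step-neg : ∀ k B x → step k (neg B) x ≗ step k B x
  step-neg k B x (inj₂ l) = refl
  step-neg k B x (inj₁ l) with l ≟ k
  ... | no  _ = refl
  ... | yes _ = cong (ℤ.-1ℤ · x (inj₁ k) ∙_) (begin
    pair (λ l → R k ℤ.* (ℤ.- (ℤ.- B k l)) ⁺) x ∙ φ (Ŷ k (neg B) x)
      ≡⟨ cong₂ (λ u v → u ∙ φ v) (M⁺-eq k B x) (trans (cong (R k ·_) (pair-neg (B k) x)) (·-swap _ _ _)) ⟩
    (Ŷ k B x ∙ M⁻ k B x) ∙ φ (ℤ.-1ℤ · Ŷ k B x)
      ≡⟨ CM.solve 3 (λ y m f → (y CM.⊕ m) CM.⊕ f CM.⊜ m CM.⊕ (y CM.⊕ f)) refl (Ŷ k B x) (M⁻ k B x) (φ (ℤ.-1ℤ · Ŷ k B x)) ⟩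
    M⁻ k B x ∙ (Ŷ k B x ∙ φ (ℤ.-1ℤ · Ŷ k B x))
      ≡⟨ cong (M⁻ k B x ∙_) (sym (φ-flip _)) ⟩
    M⁻ k B x ∙ φ (Ŷ k B x) ∎)
    where open ≡-Reasoning

  pair-step-avoid : ∀ k B x a → a (inj₁ k) ≡ 0ℤ → pair a (step k B x) ≡ pair a x
  pair-step-avoid k B x a e = pair-agree a _ _ agree
    where
    agree : ∀ l → a l ≡ 0ℤ ⊎ step k B x l ≡ x l
    agree (inj₁ l) with l ≟ k
    ... | yes refl = inj₁ e
    ... | no ne    = inj₂ refl
    agree (inj₂ l) = inj₂ refl

  -- The second exchange has `Ŷ` inverted and M⁺ in place of M⁻; neither involves x_k since the
  -- diagonal entry vanishes, so its sum equals the first one and cancels it.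
  step-involutive : ∀ k {B} x → B k (inj₁ k) ≡ 0ℤ → step k (μ k B) (step k B x) ≗ x
  step-involutive k {B} x diag (inj₂ l) = refl
  step-involutive k {B} x diag (inj₁ l) with l ≟ k
  ... | no ne = step-other k B x (inj₁ l) (λ { refl → ne refl })
  ... | yes refl = begin
    ℤ.-1ℤ · step k B x (inj₁ k) ∙ (M⁻ k (μ k B) (step k B x) ∙ φ (Ŷ k (μ k B) (step k B x)))
      ≡⟨ cong₂ (λ u v → ℤ.-1ℤ · u ∙ v) (step-same k B x)
           (cong₂ (λ u v → u ∙ φ v) monomial (trans (cong (R k ·_) (ŷ-step-same k x diag)) (·-swap _ _ _))) ⟩
    ℤ.-1ℤ · (ℤ.-1ℤ · xₖ ∙ (q ∙ φ y)) ∙ ((y ∙ q) ∙ φ (ℤ.-1ℤ · y))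
      ≡⟨ cong (_∙ ((y ∙ q) ∙ φ (ℤ.-1ℤ · y)))
           (trans (·-∙ _ _ _) (cong₂ _∙_ (trans (sym (·-* _ _ _)) (·-1 xₖ)) (·-∙ _ _ _))) ⟩
    (xₖ ∙ (ℤ.-1ℤ · q ∙ ℤ.-1ℤ · φ y)) ∙ ((y ∙ q) ∙ φ (ℤ.-1ℤ · y))
      ≡⟨ CM.solve 6 (λ a q⁻ f⁻ y q g → (a CM.⊕ (q⁻ CM.⊕ f⁻)) CM.⊕ ((y CM.⊕ q) CM.⊕ g)
            CM.⊜ a CM.⊕ ((q CM.⊕ q⁻) CM.⊕ ((y CM.⊕ g) CM.⊕ f⁻))) refl xₖ (ℤ.-1ℤ · q) (ℤ.-1ℤ · φ y) y q (φ (ℤ.-1ℤ · y)) ⟩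
    xₖ ∙ ((q ∙ ℤ.-1ℤ · q) ∙ ((y ∙ φ (ℤ.-1ℤ · y)) ∙ ℤ.-1ℤ · φ y))
      ≡⟨ cong (xₖ ∙_) (cong₂ _∙_ (inverseʳ q) (trans (cong (_∙ ℤ.-1ℤ · φ y) (sym (φ-flip y))) (inverseʳ (φ y)))) ⟩
    xₖ ∙ (ε ∙ ε) ≡⟨ trans (cong (xₖ ∙_) (identityˡ ε)) (identityʳ xₖ) ⟩
    xₖ ∎
    where
    open ≡-Reasoning
    xₖ = x (inj₁ k)
    q  = M⁻ k B x
    y  = Ŷ k B x
    monomial : M⁻ k (μ k B) (step k B x) ≡ y ∙ q
    monomial = begin
      M⁻ k (μ k B) (step k B x)
        ≡⟨ pair-cong (λ l → cong (λ v → R k ℤ.* (ℤ.- v) ⁺) (μ-same k B l)) (λ _ → refl) ⟩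
      pair (λ l → R k ℤ.* (ℤ.- (ℤ.- B k l)) ⁺) (step k B x)
        ≡⟨ pair-step-avoid k B x _ (trans (cong (λ v → R k ℤ.* (ℤ.- (ℤ.- v)) ⁺) diag) (ℤₚ.*-zeroʳ (R k))) ⟩
      pair (λ l → R k ℤ.* (ℤ.- (ℤ.- B k l)) ⁺) x ≡⟨ M⁺-eq k B x ⟩
      y ∙ q ∎

  run : List (Fin n) → ExtMat n → Cluster → Cluster
  run []       B x = x
  run (k ∷ ks) B x = run ks (μ k B) (step k B x)

  run-cong : ∀ ks {B B′ x x′} → B ≗₂ B′ → x ≗ x′ → run ks B x ≗ run ks B′ x′
  run-cong []       p q = q
  run-cong (k ∷ ks) p q = run-cong ks (μ-cong k p) (step-cong k (p k) q)

  run-neg : ∀ ks B x → run ks (neg B) x ≗ run ks B x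
  run-neg []       B x l = refl
  run-neg (k ∷ ks) B x l = trans (run-cong ks (μ-neg k B) (step-neg k B x) l) (run-neg ks (μ k B) (step k B x) l)

  run-∷ʳ : ∀ ks k B x → run (ks ∷ʳ k) B x ≡ step k (mutations ks B) (run ks B x)
  run-∷ʳ []       k B x = refl
  run-∷ʳ (j ∷ ks) k B x = run-∷ʳ ks k (μ j B) (step j B x)

  mutations-∷ʳ : ∀ ks k B → mutations (ks ∷ʳ k) B ≡ μ k (mutations ks B)
  mutations-∷ʳ []       k B = refl
  mutations-∷ʳ (j ∷ ks) k B = mutations-∷ʳ ks k (μ j B)

-- Two semifields: min-plus integers, which record rates of decay, and positive rationals

tropical : Semifield
tropical = record
  { Carrier = ℤ ; _∙_ = ℤ._+_ ; ε = 0ℤ ; _·_ = ℤ._*_ ; φ = 0ℤ ℤ.⊓_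
  ; assoc = ℤₚ.+-assoc ; comm = ℤₚ.+-comm ; identityˡ = ℤₚ.+-identityˡ
  ; ·-+ = λ a b x → ℤₚ.*-distribʳ-+ x a b
  ; ·-∙ = ℤₚ.*-distribˡ-+
  ; ·-* = ℤₚ.*-assoc
  ; ·-1 = ℤₚ.*-identityˡ
  ; ·-0 = ℤₚ.*-zeroˡ
  ; φ-flip = flip
  }
  where
  flip : ∀ y → 0ℤ ℤ.⊓ y ≡ y ℤ.+ (0ℤ ℤ.⊓ (ℤ.-1ℤ ℤ.* y))
  flip y = trans (helper y) (cong (λ v → y ℤ.+ (0ℤ ℤ.⊓ v)) (sym (ℤₚ.-1*i≡-i y)))
    where
    helper : ∀ y → 0ℤ ℤ.⊓ y ≡ y ℤ.+ (0ℤ ℤ.⊓ (ℤ.- y))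
    helper (+ zero)  = refl
    helper (+ suc m) = sym (ℤₚ.+-inverseʳ (+ suc m))
    helper -[1+ m ]  = refl

module IntegerPowers {A : Set} (_∙_ : A → A → A) (ε : A) (inv : A → A)
  (assoc : ∀ x y z → (x ∙ y) ∙ z ≡ x ∙ (y ∙ z)) (comm : ∀ x y → x ∙ y ≡ y ∙ x)
  (identityˡ : ∀ x → ε ∙ x ≡ x) (inverseʳ : ∀ x → x ∙ inv x ≡ ε) where

  open ≡-Reasoning

  pow : A → ℕ → A
  pow x zero    = ε
  pow x (suc m) = x ∙ pow x m

  identityʳ : ∀ x → x ∙ ε ≡ x
  identityʳ x = trans (comm x ε) (identityˡ x)

  interchange : ∀ p q u v → (p ∙ q) ∙ (u ∙ v) ≡ (p ∙ u) ∙ (q ∙ v)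
  interchange p q u v = begin
    (p ∙ q) ∙ (u ∙ v)  ≡⟨ assoc p q _ ⟩
    p ∙ (q ∙ (u ∙ v))  ≡⟨ cong (p ∙_) (trans (sym (assoc q u v)) (trans (cong (_∙ v) (comm q u)) (assoc u q v))) ⟩
    p ∙ (u ∙ (q ∙ v))  ≡⟨ sym (assoc p u _) ⟩
    (p ∙ u) ∙ (q ∙ v)  ∎

  inv-unique : ∀ x y → x ∙ y ≡ ε → y ≡ inv x
  inv-unique x y e = begin
    y                 ≡⟨ sym (identityˡ y) ⟩
    ε ∙ y             ≡⟨ cong (_∙ y) (trans (sym (inverseʳ x)) (comm x _)) ⟩
    (inv x ∙ x) ∙ y   ≡⟨ assoc _ _ _ ⟩
    inv x ∙ (x ∙ y)   ≡⟨ cong (inv x ∙_) e ⟩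
    inv x ∙ ε         ≡⟨ identityʳ _ ⟩
    inv x             ∎

  inv-∙ : ∀ x y → inv (x ∙ y) ≡ inv x ∙ inv y
  inv-∙ x y = sym (inv-unique (x ∙ y) _
    (trans (interchange x y (inv x) (inv y)) (trans (cong₂ _∙_ (inverseʳ x) (inverseʳ y)) (identityˡ ε))))

  inv-ε : inv ε ≡ ε
  inv-ε = sym (inv-unique ε ε (identityˡ ε))

  inv-inv : ∀ x → inv (inv x) ≡ x
  inv-inv x = sym (inv-unique (inv x) x (trans (comm _ _) (inverseʳ x)))

  pow-+ : ∀ x m m′ → pow x (m ℕ.+ m′) ≡ pow x m ∙ pow x m′
  pow-+ x zero    m′ = sym (identityˡ _)
  pow-+ x (suc m) m′ = trans (cong (x ∙_) (pow-+ x m m′)) (sym (assoc _ _ _))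

  pow-∙ : ∀ x y m → pow (x ∙ y) m ≡ pow x m ∙ pow y m
  pow-∙ x y zero    = sym (identityˡ ε)
  pow-∙ x y (suc m) = trans (cong ((x ∙ y) ∙_) (pow-∙ x y m)) (interchange _ _ _ _)

  pow-inv : ∀ x m → pow (inv x) m ≡ inv (pow x m)
  pow-inv x zero    = sym inv-ε
  pow-inv x (suc m) = trans (cong (inv x ∙_) (pow-inv x m)) (sym (inv-∙ x _))

  infixr 7 _·_

  _·_ : ℤ → A → A
  (+ m)    · x = pow x m
  -[1+ m ] · x = pow (inv x) (suc m)

  ⊖-· : ∀ m m′ x → (m ℤ.⊖ m′) · x ≡ pow x m ∙ pow (inv x) m′
  ⊖-· zero    zero     x = sym (identityˡ ε)
  ⊖-· zero    (suc m′) x = sym (identityˡ _)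
  ⊖-· (suc m) zero     x = sym (identityʳ _)
  ⊖-· (suc m) (suc m′) x = begin
    (suc m ℤ.⊖ suc m′) · x                          ≡⟨ cong (_· x) (ℤₚ.[1+m]⊖[1+n]≡m⊖n m m′) ⟩
    (m ℤ.⊖ m′) · x                                  ≡⟨ ⊖-· m m′ x ⟩
    pow x m ∙ pow (inv x) m′                        ≡⟨ sym (identityˡ _) ⟩
    ε ∙ (pow x m ∙ pow (inv x) m′)                  ≡⟨ cong (_∙ (pow x m ∙ pow (inv x) m′)) (sym (inverseʳ x)) ⟩
    (x ∙ inv x) ∙ (pow x m ∙ pow (inv x) m′)        ≡⟨ interchange _ _ _ _ ⟩
    pow x (suc m) ∙ pow (inv x) (suc m′)            ∎

  ·-+ : ∀ a b x → (a ℤ.+ b) · x ≡ (a · x) ∙ (b · x)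
  ·-+ (+ m)    (+ m′)    x = pow-+ x m m′
  ·-+ (+ m)    -[1+ m′ ] x = ⊖-· m (suc m′) x
  ·-+ -[1+ m ] (+ m′)    x = trans (⊖-· m′ (suc m) x) (comm _ _)
  ·-+ -[1+ m ] -[1+ m′ ] x =
    trans (cong (λ v → pow (inv x) (suc v)) (sym (ℕₚ.+-suc m m′))) (pow-+ (inv x) (suc m) (suc m′))

  ·-∙ : ∀ a x y → a · (x ∙ y) ≡ (a · x) ∙ (a · y)
  ·-∙ (+ m)    x y = pow-∙ x y m
  ·-∙ -[1+ m ] x y = trans (cong (λ v → pow v (suc m)) (inv-∙ x y)) (pow-∙ (inv x) (inv y) (suc m))

  neg-· : ∀ a x → (ℤ.- a) · x ≡ inv (a · x)
  neg-· (+ zero)  x = sym inv-ε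
  neg-· (+ suc m) x = pow-inv x (suc m)
  neg-· -[1+ m ]  x = sym (trans (cong inv (pow-inv x (suc m))) (inv-inv _))

  ·-* : ∀ a b x → (a ℤ.* b) · x ≡ a · b · x
  ·-* (+ m) b x = natural m
    where
    natural : ∀ m → (+ m ℤ.* b) · x ≡ pow (b · x) m
    natural zero    = cong (_· x) (ℤₚ.*-zeroˡ b)
    natural (suc m) = trans (cong (_· x) (ℤₚ.suc-* (+ m) b))
                            (trans (·-+ b (+ m ℤ.* b) x) (cong ((b · x) ∙_) (natural m)))
  ·-* -[1+ m ] b x = begin
    (-[1+ m ] ℤ.* b) · x          ≡⟨ cong (_· x) (sym (ℤₚ.neg-distribˡ-* (+ suc m) b)) ⟩
    (ℤ.- (+ suc m ℤ.* b)) · x     ≡⟨ neg-· (+ suc m ℤ.* b) x ⟩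
    inv ((+ suc m ℤ.* b) · x)     ≡⟨ cong inv (·-* (+ suc m) b x) ⟩
    inv (pow (b · x) (suc m))     ≡⟨ sym (pow-inv (b · x) (suc m)) ⟩
    pow (inv (b · x)) (suc m)     ∎

-- Positivity is an irrelevant field, so that the semifield laws hold as equalities as soon as the
-- values agree.
record ℚ⁺ : Set where
  constructor _,⁺_
  field
    val  : ℚ
    .pos : ℚ.Positive val

open ℚ⁺ public

ℚ⁺-≡ : ∀ {p q} → val p ≡ val q → p ≡ q
ℚ⁺-≡ {_ ,⁺ _} {_ ,⁺ _} refl = refl

_*⁺_ : ℚ⁺ → ℚ⁺ → ℚ⁺
(p ,⁺ pp) *⁺ (q ,⁺ qp) = (p ℚ.* q) ,⁺ ℚₚ.pos*pos⇒pos p {{pp}} q {{qp}}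

1⁺ : ℚ⁺
1⁺ = 1ℚ ,⁺ _

inv⁺ : ℚ⁺ → ℚ⁺
inv⁺ (p ,⁺ pp) = (ℚ.1/ p) {{ℚₚ.pos⇒nonZero p {{pp}}}} ,⁺ ℚₚ.1/pos⇒pos p {{pp}}

1+⁺ : ℚ⁺ → ℚ⁺
1+⁺ (p ,⁺ pp) = (1ℚ ℚ.+ p) ,⁺ ℚₚ.pos+pos⇒pos 1ℚ p {{pp}}

inv⁺-inverse : ∀ x → x *⁺ inv⁺ x ≡ 1⁺
inv⁺-inverse (p ,⁺ pp) = ℚ⁺-≡ (ℚₚ.*-inverseʳ p {{ℚₚ.pos⇒nonZero p {{pp}}}})

module Pow = IntegerPowers _*⁺_ 1⁺ inv⁺
  (λ x y z → ℚ⁺-≡ (ℚₚ.*-assoc (val x) (val y) (val z)))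
  (λ x y → ℚ⁺-≡ (ℚₚ.*-comm (val x) (val y)))
  (λ x → ℚ⁺-≡ (ℚₚ.*-identityˡ (val x)))
  inv⁺-inverse

positiveRationals : Semifield
positiveRationals = record
  { Carrier = ℚ⁺ ; _∙_ = _*⁺_ ; ε = 1⁺ ; _·_ = Pow._·_ ; φ = 1+⁺
  ; assoc = λ x y z → ℚ⁺-≡ (ℚₚ.*-assoc (val x) (val y) (val z))
  ; comm = λ x y → ℚ⁺-≡ (ℚₚ.*-comm (val x) (val y))
  ; identityˡ = λ x → ℚ⁺-≡ (ℚₚ.*-identityˡ (val x))
  ; ·-+ = Pow.·-+ ; ·-∙ = Pow.·-∙ ; ·-* = Pow.·-* ; ·-1 = Pow.identityʳ ; ·-0 = λ _ → refl
  ; φ-flip = flip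
  }
  where
  flip : ∀ y → 1+⁺ y ≡ y *⁺ 1+⁺ (ℤ.-1ℤ Pow.· y)
  flip y = ℚ⁺-≡ (sym (begin
    val y ℚ.* (1ℚ ℚ.+ val (ℤ.-1ℤ Pow.· y))
      ≡⟨ cong (λ v → val y ℚ.* (1ℚ ℚ.+ val v)) (Pow.identityʳ (inv⁺ y)) ⟩
    val y ℚ.* (1ℚ ℚ.+ val (inv⁺ y))
      ≡⟨ ℚₚ.*-distribˡ-+ (val y) 1ℚ _ ⟩
    val y ℚ.* 1ℚ ℚ.+ val (y *⁺ inv⁺ y)
      ≡⟨ cong₂ ℚ._+_ (ℚₚ.*-identityʳ (val y)) (cong val (inv⁺-inverse y)) ⟩
    val y ℚ.+ 1ℚ
      ≡⟨ ℚₚ.+-comm (val y) 1ℚ ⟩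
    1ℚ ℚ.+ val y ∎))
    where open ≡-Reasoning

open Pairing tropical public using () renaming (pair to ⟨_,_⟩)
module Trop = Pairing tropical

-- Matrices admitting gradings with prescribed ŷ-degrees

module GoodMatrices {n : ℕ} (D : GenFixedData n) where
  open Mutation D
  open Skew

  -- Surjectivity is full rank in an integral form, supplied at the start by the principal
  -- coefficients. It yields the grading that `RankTwo` needs, in which one ŷ-variable has degree 1
  -- and the others degree 0.
  record Good (B : ExtMat n) : Set where
    field
      isSkew : Skew B
      surjective : ∀ (η : Fin n → ℤ) → ∃ λ (w : Idx n → ℤ) → ∀ c → ⟨ B c , w ⟩ ≡ η c

    diag : ∀ k → B k (inj₁ k) ≡ 0ℤ
    diag = skew-diag isSkew

  open Good

  good-neg : ∀ {B} → Good B → Good (neg B)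
  good-neg gB .isSkew = skew-neg (isSkew gB)
  good-neg {B} gB .surjective η with surjective gB (λ c → ℤ.- η c)
  ... | w , p = w , λ c → trans (Seeds.pair-neg D tropical (B c) w)
                     (trans (cong (ℤ.-1ℤ ℤ.*_) (p c)) (trans (ℤₚ.-1*i≡-i _) (ℤₚ.neg-involutive _)))

  -- The vector w is mutated with z the tropical unit. Then the pairings change by an invertible
  -- linear rule, and η₀ is the target η pulled back through it.
  good-μ : ∀ k {B} → Good B → Good (μ k B)
  good-μ k gB .isSkew = skew-μ k (isSkew gB)
  good-μ k {B} gB .surjective η with surjective gB η₀
    where
    η₀ : Fin n → ℤ
    η₀ c with c ≟ k
    ... | yes _ = ℤ.- η k
    ... | no  _ = η c ℤ.+ (R k ℤ.* B c (inj₁ k) ⁺) ℤ.* η k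
  ... | w , p = w′ , λ c → cases c (c ≟ k)
    where
    open Seeds D tropical
    w′ : Idx n → ℤ
    w′ (inj₁ l) with l ≟ k
    ... | yes _ = ℤ.-1ℤ ℤ.* w (inj₁ k) ℤ.+ (M⁻ k B w ℤ.+ 0ℤ)
    ... | no  _ = w (inj₁ l)
    w′ (inj₂ l) = w (inj₂ l)
    off : ∀ l → l ≢ inj₁ k → w′ l ≡ w l
    off (inj₁ l) ne with l ≟ k
    ... | yes refl = ⊥-elim (ne refl)
    ... | no  _ = refl
    off (inj₂ l) ne = refl
    at : w′ (inj₁ k) ≡ ℤ.-1ℤ ℤ.* w (inj₁ k) ℤ.+ (M⁻ k B w ℤ.+ 0ℤ)
    at with k ≟ k
    ... | yes _ = refl
    ... | no ne = ⊥-elim (ne refl)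
    pₖ : ⟨ B k , w ⟩ ≡ ℤ.- η k
    pₖ with k ≟ k | p k
    ... | yes _ | e = e
    ... | no ne | _ = ⊥-elim (ne refl)
    p′ : ∀ {c} → c ≢ k → ⟨ B c , w ⟩ ≡ η c ℤ.+ (R k ℤ.* B c (inj₁ k) ⁺) ℤ.* η k
    p′ {c} ne with c ≟ k | p c
    ... | yes e | _ = ⊥-elim (ne e)
    ... | no _  | e = e
    lemma : ∀ h ρ hₖ b → (h ℤ.+ ρ ℤ.* hₖ) ℤ.+ (ρ ℤ.* (ℤ.- hₖ) ℤ.+ (ℤ.- b) ℤ.* 0ℤ) ≡ h
    lemma = solve-∀
    cases : ∀ c → Dec (c ≡ k) → ⟨ μ k B c , w′ ⟩ ≡ η c
    cases c (yes refl) = trans (pair-exchange-same (diag gB k) off at)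
      (trans (cong (ℤ.-1ℤ ℤ.*_) pₖ) (trans (ℤₚ.-1*i≡-i _) (ℤₚ.neg-involutive _)))
    cases c (no ne) = trans (pair-exchange-other (diag gB k) off at ne)
      (trans (cong₂ (λ u v → u ℤ.+ ((R k ℤ.* B c (inj₁ k) ⁺) ℤ.* v ℤ.+ (ℤ.- B c (inj₁ k)) ℤ.* 0ℤ)) (p′ ne) pₖ)
             (lemma (η c) (R k ℤ.* B c (inj₁ k) ⁺) (η k) (B c (inj₁ k))))

-- Growth and decay of rational sequences

ℚ-ring : AlmostCommutativeRing 0ℓ 0ℓ
ℚ-ring = fromCommutativeRing ℚₚ.+-*-commutativeRing (λ x → dec⇒maybe (0ℚ ℚₚ.≟ x))

natℚ : ℕ → ℚ
natℚ zero    = 0ℚ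
natℚ (suc m) = 1ℚ ℚ.+ natℚ m

toℚᵘ-natℚ : ∀ m → ℚ.toℚᵘ (natℚ m) ℚᵘ.≃ ℚᵘ.mkℚᵘ (+ m) 0
toℚᵘ-natℚ zero    = ℚᵘₚ.≃-refl
toℚᵘ-natℚ (suc m) = ℚᵘₚ.≃-trans (ℚₚ.toℚᵘ-homo-+ 1ℚ (natℚ m))
  (ℚᵘₚ.≃-trans (ℚᵘₚ.+-congʳ (ℚ.toℚᵘ 1ℚ) (toℚᵘ-natℚ m)) (ℚᵘ.*≡* (cong (λ v → (1ℤ ℤ.+ v) ℤ.* 1ℤ) (ℤₚ.*-identityʳ (+ m)))))

i≤∣i∣ : ∀ i → i ≤ + ℤ.∣ i ∣
i≤∣i∣ (+ _)    = ℤₚ.≤-refl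
i≤∣i∣ -[1+ _ ] = ℤ.-≤+

archimedean : ∀ C → ∃ λ m → C ℚ.≤ natℚ m
archimedean C = m , ℚₚ.toℚᵘ-cancel-≤ (ℚᵘₚ.≤-trans (le C) (ℚᵘₚ.≤-reflexive (ℚᵘₚ.≃-sym (toℚᵘ-natℚ m))))
  where
  m = ℤ.∣ ℚ.↥ C ∣
  i≤∣i∣*suc : ∀ i p → i ℤ.* 1ℤ ≤ + ℤ.∣ i ∣ ℤ.* + suc p
  i≤∣i∣*suc i p = ℤₚ.≤-trans (ℤₚ.≤-trans (ℤₚ.≤-reflexive (ℤₚ.*-identityʳ i)) (i≤∣i∣ i))
    (ℤₚ.≤-trans (ℤ.+≤+ (ℕₚ.m≤m*n ℤ.∣ i ∣ (suc p))) (ℤₚ.≤-reflexive (ℤₚ.pos-* ℤ.∣ i ∣ (suc p))))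
  le : ∀ C → ℚ.toℚᵘ C ℚᵘ.≤ ℚᵘ.mkℚᵘ (+ ℤ.∣ ℚ.↥ C ∣) 0
  le (ℚ.mkℚ i p _) = ℚᵘ.*≤* (i≤∣i∣*suc i p)

2ℚ : ℚ
2ℚ = 1ℚ ℚ.+ 1ℚ

natℚ-nonNeg : ∀ m → 0ℚ ℚ.≤ natℚ m
natℚ-nonNeg zero    = ℚₚ.≤-refl
natℚ-nonNeg (suc m) = ℚₚ.+-mono-≤ (ℚₚ.nonNegative⁻¹ 1ℚ) (natℚ-nonNeg m)

*-monoʳ : ∀ {p q} r → 0ℚ ℚ.≤ r → p ℚ.≤ q → p ℚ.* r ℚ.≤ q ℚ.* r
*-monoʳ r r≥0 = ℚₚ.*-monoʳ-≤-nonNeg r {{ℚ.nonNegative r≥0}}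

*-monoˡ : ∀ {p q} r → 0ℚ ℚ.≤ r → p ℚ.≤ q → r ℚ.* p ℚ.≤ r ℚ.* q
*-monoˡ r r≥0 = ℚₚ.*-monoˡ-≤-nonNeg r {{ℚ.nonNegative r≥0}}

*-nonNeg : ∀ {p q} → 0ℚ ℚ.≤ p → 0ℚ ℚ.≤ q → 0ℚ ℚ.≤ p ℚ.* q
*-nonNeg {p} {q} p≥0 q≥0 = subst (ℚ._≤ p ℚ.* q) (ℚₚ.*-zeroˡ q) (*-monoʳ q q≥0 p≥0)

≤-add-nonNeg : ∀ {p q} → 0ℚ ℚ.≤ q → p ℚ.≤ p ℚ.+ q
≤-add-nonNeg {p} {q} q≥0 = subst (ℚ._≤ p ℚ.+ q) (ℚₚ.+-identityʳ p) (ℚₚ.+-monoʳ-≤ p q≥0)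

val-pos : ∀ x → 0ℚ ℚ.< val x
val-pos (p ,⁺ pp) = ℚₚ.positive⁻¹ p {{pp}}

val-nonNeg : ∀ x → 0ℚ ℚ.≤ val x
val-nonNeg x = ℚₚ.<⇒≤ (val-pos x)

val-inv : ∀ x → val x ℚ.* val (inv⁺ x) ≡ 1ℚ
val-inv x = cong val (inv⁺-inverse x)

val-cancelʳ : ∀ {p q} x → p ℚ.* val x ≡ q ℚ.* val x → p ≡ q
val-cancelʳ {p} {q} x e = trans (expand p) (trans (cong (ℚ._* val (inv⁺ x)) e) (sym (expand q)))
  where
  expand : ∀ p → p ≡ (p ℚ.* val x) ℚ.* val (inv⁺ x)
  expand p = sym (trans (ℚₚ.*-assoc p _ _) (trans (cong (p ℚ.*_) (val-inv x)) (ℚₚ.*-identityʳ p)))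

∣*val∣ : ∀ p x → ℚ.∣ p ℚ.* val x ∣ ≡ ℚ.∣ p ∣ ℚ.* val x
∣*val∣ p x = trans (ℚₚ.∣p*q∣≡∣p∣*∣q∣ p (val x)) (cong (ℚ.∣ p ∣ ℚ.*_) (ℚₚ.0≤p⇒∣p∣≡p (val-nonNeg x)))

Bounded : (ℕ → ℚ) → Set
Bounded u = ∃ λ C → ∀ N → ℚ.∣ u N ∣ ℚ.≤ C

-- A nonzero value would grow at least linearly, as in Bernoulli's inequality: `growth` gives |u (j
-- + N)| ≥ (1 + j) |u N|, which passes any bound by the archimedean property.
geometric-bounded : ∀ u b → 2ℚ ℚ.≤ val b → (∀ N → u (suc N) ≡ val b ℚ.* u N) → Bounded u → ∀ N → u N ≡ 0ℚ
geometric-bounded u b b≥2 rec (C , bound) N with u N ℚₚ.≟ 0ℚ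
... | yes e = e
... | no ne = ⊥-elim (ℚₚ.<-irrefl refl (begin-strict
    C                                   ≡⟨ cancel C v ⟩
    (C ℚ.* val (inv⁺ v)) ℚ.* val v      ≤⟨ *-monoʳ (val v) (val-nonNeg v) (proj₂ (archimedean (C ℚ.* val (inv⁺ v)))) ⟩
    natℚ j ℚ.* val v                    <⟨ subst₂ ℚ._<_ (ℚₚ.+-identityˡ _) (expand (natℚ j) (val v)) (ℚₚ.+-monoˡ-< (natℚ j ℚ.* val v) (val-pos v)) ⟩
    (1ℚ ℚ.+ natℚ j) ℚ.* val v           ≤⟨ growth j ⟩
    ℚ.∣ u (j ℕ.+ N) ∣                   ≤⟨ bound (j ℕ.+ N) ⟩
    C                                   ∎))
  where
  open ℚₚ.≤-Reasoning
  v : ℚ⁺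
  v = ℚ.∣ u N ∣ ,⁺ ℚₚ.nonNeg∧nonZero⇒pos ℚ.∣ u N ∣ {{ℚₚ.∣-∣-nonNeg (u N)}} {{ℚ.≢-nonZero (λ e → ne (ℚₚ.∣p∣≡0⇒p≡0 (u N) e))}}
  j = proj₁ (archimedean (C ℚ.* val (inv⁺ v)))
  cancel : ∀ C v → C ≡ (C ℚ.* val (inv⁺ v)) ℚ.* val v
  cancel C v = sym (trans (ℚₚ.*-assoc C _ _) (trans (cong (C ℚ.*_) (trans (ℚₚ.*-comm _ (val v)) (val-inv v))) (ℚₚ.*-identityʳ C)))
  expand : ∀ k v → v ℚ.+ k ℚ.* v ≡ (1ℚ ℚ.+ k) ℚ.* v
  expand = solve-ring ℚ-ring
  double : ∀ k v → (1ℚ ℚ.+ (1ℚ ℚ.+ k)) ℚ.* v ℚ.+ k ℚ.* v ≡ 2ℚ ℚ.* ((1ℚ ℚ.+ k) ℚ.* v)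
  double = solve-ring ℚ-ring
  growth : ∀ j → (1ℚ ℚ.+ natℚ j) ℚ.* val v ℚ.≤ ℚ.∣ u (j ℕ.+ N) ∣
  growth zero = ℚₚ.≤-reflexive (ℚₚ.*-identityˡ (val v))
  growth (suc j) = begin
    (1ℚ ℚ.+ (1ℚ ℚ.+ natℚ j)) ℚ.* val v
      ≤⟨ ≤-add-nonNeg (*-nonNeg (natℚ-nonNeg j) (val-nonNeg v)) ⟩
    (1ℚ ℚ.+ (1ℚ ℚ.+ natℚ j)) ℚ.* val v ℚ.+ natℚ j ℚ.* val v
      ≡⟨ double (natℚ j) (val v) ⟩
    2ℚ ℚ.* ((1ℚ ℚ.+ natℚ j) ℚ.* val v)
      ≤⟨ *-monoˡ 2ℚ (ℚₚ.nonNegative⁻¹ 2ℚ) (growth j) ⟩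
    2ℚ ℚ.* ℚ.∣ u (j ℕ.+ N) ∣
      ≤⟨ *-monoʳ _ (ℚₚ.0≤∣p∣ _) b≥2 ⟩
    val b ℚ.* ℚ.∣ u (j ℕ.+ N) ∣
      ≡⟨ trans (ℚₚ.*-comm (val b) _) (trans (sym (∣*val∣ (u (j ℕ.+ N)) b)) (cong ℚ.∣_∣ (trans (ℚₚ.*-comm (u (j ℕ.+ N)) (val b)) (sym (rec (j ℕ.+ N)))))) ⟩
    ℚ.∣ u (suc j ℕ.+ N) ∣ ∎

-- u is annihilated by the product of the operators (shift - b), b ∈ bs.
Annihilated : List ℚ⁺ → (ℕ → ℚ) → Set
Annihilated []       u = ∀ N → u N ≡ 0ℚ
Annihilated (b ∷ bs) u = Annihilated bs (λ N → u (suc N) ℚ.- val b ℚ.* u N)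

annihilated-cong : ∀ bs {u v} → (∀ N → u N ≡ v N) → Annihilated bs u → Annihilated bs v
annihilated-cong []       e h N = trans (sym (e N)) (h N)
annihilated-cong (b ∷ bs) e h = annihilated-cong bs (λ N → cong₂ (λ p q → p ℚ.- val b ℚ.* q) (e (suc N)) (e N)) h

annihilated-0 : ∀ bs → Annihilated bs (λ _ → 0ℚ)
annihilated-0 []       N = refl
annihilated-0 (b ∷ bs) = annihilated-cong bs (λ _ → lemma (val b)) (annihilated-0 bs)
  where
  lemma : ∀ b → 0ℚ ≡ 0ℚ ℚ.- b ℚ.* 0ℚ
  lemma b = sym (trans (cong (λ v → 0ℚ ℚ.- v) (ℚₚ.*-zeroʳ b)) refl)

annihilated-comb : ∀ bs c {u v} → Annihilated bs u → Annihilated bs v → Annihilated bs (λ N → u N ℚ.+ c ℚ.* v N)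
annihilated-comb [] c hu hv N = trans (cong₂ (λ p q → p ℚ.+ c ℚ.* q) (hu N) (hv N)) (trans (cong (0ℚ ℚ.+_) (ℚₚ.*-zeroʳ c)) refl)
annihilated-comb (b ∷ bs) c {u} {v} hu hv =
  annihilated-cong bs (λ N → lemma (val b) c (u (suc N)) (u N) (v (suc N)) (v N)) (annihilated-comb bs c hu hv)
  where
  lemma : ∀ b c u′ u v′ v → (u′ ℚ.+ ℚ.- (b ℚ.* u)) ℚ.+ c ℚ.* (v′ ℚ.+ ℚ.- (b ℚ.* v)) ≡ (u′ ℚ.+ c ℚ.* v′) ℚ.+ ℚ.- (b ℚ.* (u ℚ.+ c ℚ.* v))
  lemma = solve-ring ℚ-ring

annihilated-shift : ∀ bs {u} → Annihilated bs u → Annihilated bs (u ∘ suc)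
annihilated-shift []       h N = h (suc N)
annihilated-shift (b ∷ bs) h = annihilated-shift bs h

-- The operators (shift - b) have constant coefficients and commute, so a further factor may be put
-- in front.
annihilated-∷ : ∀ b bs {u} → Annihilated bs u → Annihilated (b ∷ bs) u
annihilated-∷ b bs {u} h = annihilated-cong bs
  (λ N → cong (u (suc N) ℚ.+_) (sym (ℚₚ.neg-distribˡ-* (val b) (u N))))
  (annihilated-comb bs (ℚ.- val b) (annihilated-shift bs h) h)

annihilated-geometric : ∀ b bs c → Annihilated (b ∷ bs) (λ N → c ℚ.* val (Pow.pow b N))
annihilated-geometric b bs c = annihilated-cong bs (λ N → lemma c (val b) (val (Pow.pow b N))) (annihilated-0 bs)
  where
  lemma : ∀ c b p → 0ℚ ≡ c ℚ.* (b ℚ.* p) ℚ.+ ℚ.- (b ℚ.* (c ℚ.* p))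
  lemma = solve-ring ℚ-ring

-- One factor is peeled off: u (N + 1) - b u N is bounded and annihilated by the remaining factors,
-- hence zero by induction, and u is then geometric with ratio at least 2. The argument allows
-- repeated bases.
annihilated-bounded : ∀ bs {u} → All (λ b → 2ℚ ℚ.≤ val b) bs → Annihilated bs u → Bounded u → ∀ N → u N ≡ 0ℚ
annihilated-bounded []       []           h bd = h
annihilated-bounded (b ∷ bs) {u} (b≥2 ∷ bs≥2) h (C , bound) =
  geometric-bounded u b b≥2 (λ N → solve-rec _ _ (annihilated-bounded bs bs≥2 h (C ℚ.+ C ℚ.* val b , bound′) N)) (C , bound)
  where
  solve-rec : ∀ p q → p ℚ.- q ≡ 0ℚ → p ≡ q
  solve-rec p q e = trans (lemma p q) (trans (cong (ℚ._+ q) e) (ℚₚ.+-identityˡ q))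
    where
    lemma : ∀ p q → p ≡ (p ℚ.+ ℚ.- q) ℚ.+ q
    lemma = solve-ring ℚ-ring
  open ℚₚ.≤-Reasoning
  bound′ : ∀ N → ℚ.∣ u (suc N) ℚ.- val b ℚ.* u N ∣ ℚ.≤ C ℚ.+ C ℚ.* val b
  bound′ N = begin
    ℚ.∣ u (suc N) ℚ.- val b ℚ.* u N ∣            ≤⟨ ℚₚ.∣p-q∣≤∣p∣+∣q∣ (u (suc N)) (val b ℚ.* u N) ⟩
    ℚ.∣ u (suc N) ∣ ℚ.+ ℚ.∣ val b ℚ.* u N ∣      ≡⟨ cong (λ v → ℚ.∣ u (suc N) ∣ ℚ.+ v) (trans (cong ℚ.∣_∣ (ℚₚ.*-comm (val b) _)) (∣*val∣ (u N) b)) ⟩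
    ℚ.∣ u (suc N) ∣ ℚ.+ ℚ.∣ u N ∣ ℚ.* val b      ≤⟨ ℚₚ.+-mono-≤ (bound (suc N)) (*-monoʳ (val b) (val-nonNeg b) (bound N)) ⟩
    C ℚ.+ C ℚ.* val b                            ∎

½⁺ : ℚ⁺
½⁺ = ℚ.½ ,⁺ _

opaque
  T : ℤ → ℚ⁺
  T e = e Pow.· ½⁺

  T-def : ∀ e → T e ≡ e Pow.· ½⁺
  T-def e = refl

  T-0 : T 0ℤ ≡ 1⁺
  T-0 = refl

  T-+ : ∀ a b → T (a ℤ.+ b) ≡ T a *⁺ T b
  T-+ a b = Pow.·-+ a b ½⁺

  T-* : ∀ N a → T (+ N ℤ.* a) ≡ Pow.pow (T a) N
  T-* N a = Pow.·-* (+ N) a ½⁺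

  T-≤1 : ∀ {a} → 0ℤ ≤ a → val (T a) ℚ.≤ 1ℚ
  T-≤1 {+ m} _ = go m
    where
    go : ∀ m → val (Pow.pow ½⁺ m) ℚ.≤ 1ℚ
    go zero    = ℚₚ.≤-refl
    go (suc m) = ℚₚ.≤-trans (*-monoʳ (val (Pow.pow ½⁺ m)) (val-nonNeg (Pow.pow ½⁺ m)) (ℚₚ.≤ᵇ⇒≤ {ℚ.½} {1ℚ} tt))
                   (ℚₚ.≤-trans (ℚₚ.≤-reflexive (ℚₚ.*-identityˡ _)) (go m))

  T-antitone : ∀ {a b} → a ≤ b → val (T b) ℚ.≤ val (T a)
  T-antitone {a} {b} le = begin
    val (T b)                              ≡⟨ cong (val ∘ T) (lemma a b) ⟩
    val (T (a ℤ.+ (b ℤ.+ ℤ.- a)))          ≡⟨ cong val (T-+ a (b ℤ.+ ℤ.- a)) ⟩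
    val (T a) ℚ.* val (T (b ℤ.+ ℤ.- a))    ≤⟨ *-monoˡ (val (T a)) (val-nonNeg (T a)) (T-≤1 (ℤₚ.i≤j⇒0≤j-i le)) ⟩
    val (T a) ℚ.* 1ℚ                       ≡⟨ ℚₚ.*-identityʳ _ ⟩
    val (T a)                              ∎
    where
    open ℚₚ.≤-Reasoning
    lemma : ∀ a b → b ≡ a ℤ.+ (b ℤ.+ ℤ.- a)
    lemma = solve-∀

  T-≥2 : ∀ {a} → a ℤ.< 0ℤ → 2ℚ ℚ.≤ val (T a)
  T-≥2 {a} lt = T-antitone {a} { -[1+ 0 ]} (ℤₚ.i<j⇒i≤pred[j] lt)

-- Laurent polynomials as functions on positive points, and their decay along rays

module Laurent (n : ℕ) where

  open Pairing positiveRationals using (pairFin; pair; pair-def; pair-cong; pair-+; pair-∙; pair-ε)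

  Point : Set
  Point = Idx n → ℚ⁺

  Exponent : Set
  Exponent = Idx n → ℤ

  pair-powers : ∀ (m a : Exponent) h → pair m (λ l → a l Pow.· h) ≡ ⟨ m , a ⟩ Pow.· h
  pair-powers m a h = begin
    pair m (λ l → a l Pow.· h)                  ≡⟨ pair-def m _ ⟩
    pairFin (m ∘ inj₁) _ *⁺ pairFin (m ∘ inj₂) _ ≡⟨ cong₂ _*⁺_ (go (m ∘ inj₁) (a ∘ inj₁)) (go (m ∘ inj₂) (a ∘ inj₂)) ⟩
    (p₁ Pow.· h) *⁺ (p₂ Pow.· h)                ≡⟨ sym (Pow.·-+ p₁ p₂ h) ⟩
    (p₁ ℤ.+ p₂) Pow.· h                         ≡⟨ cong (Pow._· h) (sym (Trop.pair-def m a)) ⟩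
    ⟨ m , a ⟩ Pow.· h                           ∎
    where
    open ≡-Reasoning
    p₁ = Trop.pairFin (m ∘ inj₁) (a ∘ inj₁)
    p₂ = Trop.pairFin (m ∘ inj₂) (a ∘ inj₂)
    go : ∀ {k} (m a : Fin k → ℤ) → pairFin m (λ l → a l Pow.· h) ≡ Trop.pairFin m a Pow.· h
    go {zero}  m a = refl
    go {suc k} m a = trans (cong₂ _*⁺_ (sym (Pow.·-* (m zero) (a zero) h)) (go (m ∘ suc) (a ∘ suc)))
                           (sym (Pow.·-+ (m zero ℤ.* a zero) _ h))

  scale : ℕ → Exponent → Point → Point
  scale N w x l = T (+ N ℤ.* w l) *⁺ x l

  pair-scale : ∀ N w m x → pair m (scale N w x) ≡ Pow.pow (T ⟨ m , w ⟩) N *⁺ pair m x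
  pair-scale N w m x = trans (pair-∙ m _ x) (cong (_*⁺ pair m x)
    (begin
      pair m (λ l → T (+ N ℤ.* w l))              ≡⟨ pair-cong (λ _ → refl) (λ l → T-def (+ N ℤ.* w l)) ⟩
      pair m (λ l → (+ N ℤ.* w l) Pow.· ½⁺)       ≡⟨ pair-powers m (λ l → + N ℤ.* w l) ½⁺ ⟩
      ⟨ m , (λ l → + N ℤ.* w l) ⟩ Pow.· ½⁺        ≡⟨ sym (T-def _) ⟩
      T ⟨ m , (λ l → + N ℤ.* w l) ⟩               ≡⟨ cong T (Trop.pair-· (+ N) m w) ⟩
      T (+ N ℤ.* ⟨ m , w ⟩)                       ≡⟨ T-* N ⟨ m , w ⟩ ⟩
      Pow.pow (T ⟨ m , w ⟩) N                     ∎))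
    where open ≡-Reasoning

  eval : List (ℚ × Exponent) → Point → ℚ
  eval []            x = 0ℚ
  eval ((c , m) ∷ L) x = c ℚ.* val (pair m x) ℚ.+ eval L x

  -- A property of the function f: some expansion has all its exponents in P. Expansions are lists,
  -- in which exponents may repeat and terms may cancel.
  record Laurent (P : Exponent → Set) (f : Point → ℚ) : Set where
    constructor mkLaurent
    field
      terms     : List (ℚ × Exponent)
      support   : All (P ∘ proj₂) terms
      expansion : ∀ x → f x ≡ eval terms x

  eval-++ : ∀ L L′ x → eval (L ++ L′) x ≡ eval L x ℚ.+ eval L′ x
  eval-++ []            L′ x = sym (ℚₚ.+-identityˡ _)
  eval-++ ((c , m) ∷ L) L′ x = trans (cong (c ℚ.* val (pair m x) ℚ.+_) (eval-++ L L′ x)) (sym (ℚₚ.+-assoc (c ℚ.* val (pair m x)) (eval L x) (eval L′ x)))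

  mulTerm : ℚ × Exponent → List (ℚ × Exponent) → List (ℚ × Exponent)
  mulTerm (c , m) = map (λ s → c ℚ.* proj₁ s , λ l → m l ℤ.+ proj₂ s l)

  eval-mulTerm : ∀ c m L x → eval (mulTerm (c , m) L) x ≡ (c ℚ.* val (pair m x)) ℚ.* eval L x
  eval-mulTerm c m []              x = sym (ℚₚ.*-zeroʳ (c ℚ.* val (pair m x)))
  eval-mulTerm c m ((c′ , m′) ∷ L) x = begin
    (c ℚ.* c′) ℚ.* val (pair (λ l → m l ℤ.+ m′ l) x) ℚ.+ eval (mulTerm (c , m) L) x
      ≡⟨ cong₂ (λ p q → (c ℚ.* c′) ℚ.* val p ℚ.+ q) (pair-+ m m′ x) (eval-mulTerm c m L x) ⟩
    (c ℚ.* c′) ℚ.* (val (pair m x) ℚ.* val (pair m′ x)) ℚ.+ (c ℚ.* val (pair m x)) ℚ.* eval L x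
      ≡⟨ lemma c c′ (val (pair m x)) (val (pair m′ x)) (eval L x) ⟩
    (c ℚ.* val (pair m x)) ℚ.* (c′ ℚ.* val (pair m′ x) ℚ.+ eval L x) ∎
    where
    open ≡-Reasoning
    lemma : ∀ c c′ p q e → (c ℚ.* c′) ℚ.* (p ℚ.* q) ℚ.+ (c ℚ.* p) ℚ.* e ≡ (c ℚ.* p) ℚ.* (c′ ℚ.* q ℚ.+ e)
    lemma = solve-ring ℚ-ring

  mul : List (ℚ × Exponent) → List (ℚ × Exponent) → List (ℚ × Exponent)
  mul []      L′ = []
  mul (t ∷ L) L′ = mulTerm t L′ ++ mul L L′

  eval-mul : ∀ L L′ x → eval (mul L L′) x ≡ eval L x ℚ.* eval L′ x
  eval-mul []            L′ x = sym (ℚₚ.*-zeroˡ (eval L′ x))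
  eval-mul ((c , m) ∷ L) L′ x = trans (eval-++ (mulTerm (c , m) L′) (mul L L′) x)
    (trans (cong₂ ℚ._+_ (eval-mulTerm c m L′ x) (eval-mul L L′ x)) (sym (ℚₚ.*-distribʳ-+ (eval L′ x) (c ℚ.* val (pair m x)) (eval L x))))

  module _ {P : Exponent → Set} where

    laurent-resp : ∀ {f g} → (∀ x → f x ≡ g x) → Laurent P f → Laurent P g
    laurent-resp e (mkLaurent L s p) = mkLaurent L s (λ x → trans (sym (e x)) (p x))

    laurent-weaken : ∀ {Q : Exponent → Set} {f} → (∀ m → P m → Q m) → Laurent P f → Laurent Q f
    laurent-weaken h (mkLaurent L s p) = mkLaurent L (All.map (λ {t} → h (proj₂ t)) s) p

    laurent-monomial : ∀ {m} → P m → Laurent P (λ x → val (pair m x))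
    laurent-monomial {m} pm = mkLaurent ((1ℚ , m) ∷ []) (pm ∷ [])
      (λ x → sym (trans (ℚₚ.+-identityʳ _) (ℚₚ.*-identityˡ _)))

    laurent-const : ∀ c → P (λ _ → 0ℤ) → Laurent P (λ _ → c)
    laurent-const c p0 = mkLaurent ((c , λ _ → 0ℤ) ∷ []) (p0 ∷ [])
      (λ x → sym (trans (ℚₚ.+-identityʳ _) (trans (cong (λ v → c ℚ.* val v) (pair-ε _ x (λ _ → inj₁ refl))) (ℚₚ.*-identityʳ c))))

    laurent-0 : Laurent P (λ _ → 0ℚ)
    laurent-0 = mkLaurent [] [] (λ _ → refl)

    laurent-+ : ∀ {f g} → Laurent P f → Laurent P g → Laurent P (λ x → f x ℚ.+ g x)
    laurent-+ (mkLaurent L s p) (mkLaurent L′ s′ p′) = mkLaurent (L ++ L′) (Allₚ.++⁺ s s′)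
      (λ x → trans (cong₂ ℚ._+_ (p x) (p′ x)) (sym (eval-++ L L′ x)))

    laurent-* : ∀ {Q S : Exponent → Set} → (∀ m m′ → P m → Q m′ → S (λ l → m l ℤ.+ m′ l))
      → ∀ {f g} → Laurent P f → Laurent Q g → Laurent S (λ x → f x ℚ.* g x)
    laurent-* {Q} {S} h (mkLaurent L s p) (mkLaurent L′ s′ p′) = mkLaurent (mul L L′) (go L s)
      (λ x → trans (cong₂ ℚ._*_ (p x) (p′ x)) (sym (eval-mul L L′ x)))
      where
      go : ∀ L → All (P ∘ proj₂) L → All (S ∘ proj₂) (mul L L′)
      go []            []       = []
      go ((c , m) ∷ L) (pm ∷ s) = Allₚ.++⁺ (Allₚ.map⁺ (All.map (λ {t} → h m (proj₂ t) pm) s′)) (go L s)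

    laurent-scale : ∀ c {f} → Laurent P f → Laurent P (λ x → c ℚ.* f x)
    laurent-scale c (mkLaurent L s p) = mkLaurent (map (λ t → c ℚ.* proj₁ t , proj₂ t) L) (Allₚ.map⁺ s)
      (λ x → trans (cong (c ℚ.*_) (p x)) (go L x))
      where
      go : ∀ L x → c ℚ.* eval L x ≡ eval (map (λ t → c ℚ.* proj₁ t , proj₂ t) L) x
      go []             x = ℚₚ.*-zeroʳ c
      go ((c′ , m) ∷ L) x = trans (ℚₚ.*-distribˡ-+ c _ _) (cong₂ ℚ._+_ (sym (ℚₚ.*-assoc c c′ _)) (go L x))

    laurent-split : ∀ {f} (Q : Exponent → Set) → (∀ m → Dec (Q m)) → Laurent P f
      → ∃ λ g → ∃ λ h → Laurent Q g × Laurent (λ m → P m × ¬ Q m) h × (∀ x → f x ≡ g x ℚ.+ h x)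
    laurent-split Q dec (mkLaurent L s p) = let g , h , lg , lh , e = go L s in g , h , lg , lh , λ x → trans (p x) (e x)
      where
      go : ∀ L → All (P ∘ proj₂) L
        → ∃ λ g → ∃ λ h → Laurent Q g × Laurent (λ m → P m × ¬ Q m) h × (∀ x → eval L x ≡ g x ℚ.+ h x)
      go [] [] = (λ _ → 0ℚ) , (λ _ → 0ℚ) , mkLaurent [] [] (λ _ → refl) , mkLaurent [] [] (λ _ → refl) , λ _ → refl
      go ((c , m) ∷ L) (pm ∷ s) with go L s
      ... | g , h , mkLaurent G sG pG , mkLaurent H sH pH , e with dec m
      ... | yes q = _ , h , mkLaurent ((c , m) ∷ G) (q ∷ sG) (λ _ → refl) , mkLaurent H sH pH ,
          λ x → trans (cong (c ℚ.* val (pair m x) ℚ.+_) (trans (e x) (cong (ℚ._+ h x) (pG x)))) (sym (ℚₚ.+-assoc (c ℚ.* val (pair m x)) (eval G x) (h x)))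
      ... | no ¬q = g , _ , mkLaurent G sG pG , mkLaurent ((c , m) ∷ H) ((pm , ¬q) ∷ sH) (λ _ → refl) ,
          λ x → trans (cong (c ℚ.* val (pair m x) ℚ.+_) (trans (e x) (cong (g x ℚ.+_) (pH x))))
                      (lemma (c ℚ.* val (pair m x)) (g x) (eval H x))
          where
          lemma : ∀ p q r → p ℚ.+ (q ℚ.+ r) ≡ q ℚ.+ (p ℚ.+ r)
          lemma = solve-ring ℚ-ring

  Any : Exponent → Set
  Any _ = ⊤

  Low High : Exponent → ℤ → Exponent → Set
  Low  w E m = ⟨ m , w ⟩ ℤ.< E
  High w E m = E ≤ ⟨ m , w ⟩

  Deg0 : Exponent → Exponent → Set
  Deg0 w m = ⟨ m , w ⟩ ≡ 0ℤ

  -- f is O(2^(-NE)) along the ray x · 2^(-Nw).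
  Decays : (Point → ℚ) → Exponent → ℤ → Point → Set
  Decays f w E x = ∃ λ C → ∀ N → ℚ.∣ f (scale N w x) ∣ ℚ.≤ C ℚ.* val (Pow.pow (T E) N)

  decays-+ : ∀ {f g w E x} → Decays f w E x → Decays g w E x → Decays (λ x → f x ℚ.+ g x) w E x
  decays-+ {f} {g} {w} {E} {x} (C , p) (C′ , p′) = C ℚ.+ C′ , λ N → begin
    ℚ.∣ f (scale N w x) ℚ.+ g (scale N w x) ∣            ≤⟨ ℚₚ.∣p+q∣≤∣p∣+∣q∣ (f (scale N w x)) (g (scale N w x)) ⟩
    ℚ.∣ f (scale N w x) ∣ ℚ.+ ℚ.∣ g (scale N w x) ∣      ≤⟨ ℚₚ.+-mono-≤ (p N) (p′ N) ⟩
    C ℚ.* val (Pow.pow (T E) N) ℚ.+ C′ ℚ.* val (Pow.pow (T E) N) ≡⟨ sym (ℚₚ.*-distribʳ-+ (val (Pow.pow (T E) N)) C C′) ⟩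
    (C ℚ.+ C′) ℚ.* val (Pow.pow (T E) N)                 ∎
    where open ℚₚ.≤-Reasoning

  pow-antitone : ∀ {E a} N → E ≤ a → val (Pow.pow (T a) N) ℚ.≤ val (Pow.pow (T E) N)
  pow-antitone {E} {a} N le = subst₂ ℚ._≤_ (cong val (T-* N a)) (cong val (T-* N E)) (T-antitone (ℤₚ.*-monoˡ-≤-nonNeg (+ N) le))

  high-decays : ∀ {f w E} → Laurent (High w E) f → ∀ x → Decays f w E x
  high-decays {f} {w} {E} (mkLaurent L s p) x = proj₁ (go L s) , λ N →
    subst (λ v → ℚ.∣ v ∣ ℚ.≤ proj₁ (go L s) ℚ.* val (Pow.pow (T E) N)) (sym (p (scale N w x))) (proj₂ (go L s) N)
    where
    go : ∀ L → All (High w E ∘ proj₂) L → Decays (eval L) w E x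
    go []            []       = 0ℚ , λ N → ℚₚ.≤-reflexive (sym (ℚₚ.*-zeroˡ (val (Pow.pow (T E) N))))
    go ((c , m) ∷ L) (le ∷ s) = decays-+ {λ y → c ℚ.* val (pair m y)} {eval L} {w} {E} {x} (ℚ.∣ c ∣ ℚ.* val (pair m x) , bound) (go L s)
      where
      open ℚₚ.≤-Reasoning
      bound : ∀ N → ℚ.∣ c ℚ.* val (pair m (scale N w x)) ∣ ℚ.≤ (ℚ.∣ c ∣ ℚ.* val (pair m x)) ℚ.* val (Pow.pow (T E) N)
      bound N = begin
        ℚ.∣ c ℚ.* val (pair m (scale N w x)) ∣   ≡⟨ ∣*val∣ c (pair m (scale N w x)) ⟩
        ℚ.∣ c ∣ ℚ.* val (pair m (scale N w x))   ≡⟨ cong (ℚ.∣ c ∣ ℚ.*_) (trans (cong val (pair-scale N w m x)) (ℚₚ.*-comm (val (Pow.pow (T ⟨ m , w ⟩) N)) (val (pair m x)))) ⟩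
        ℚ.∣ c ∣ ℚ.* (val (pair m x) ℚ.* val (Pow.pow (T ⟨ m , w ⟩) N)) ≡⟨ sym (ℚₚ.*-assoc ℚ.∣ c ∣ _ _) ⟩
        (ℚ.∣ c ∣ ℚ.* val (pair m x)) ℚ.* val (Pow.pow (T ⟨ m , w ⟩) N)
          ≤⟨ *-monoˡ _ (*-nonNeg (ℚₚ.0≤∣p∣ c) (val-nonNeg (pair m x))) (pow-antitone N le) ⟩
        (ℚ.∣ c ∣ ℚ.* val (pair m x)) ℚ.* val (Pow.pow (T E) N) ∎

  -- After division by 2^(-NE) every term along the ray is geometric with ratio at least 2, because
  -- its degree is below E. The sum is thus annihilated by operators of that kind and bounded by
  -- assumption, so it vanishes, in particular at N = 0.
  low-decaying-zero : ∀ {f w E x} → Laurent (Low w E) f → Decays f w E x → f x ≡ 0ℚ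
  low-decaying-zero {f} {w} {E} {x} (mkLaurent L s p) (C , bound) = vanish
    where
    eval-cong : ∀ L {x y} → (∀ l → x l ≡ y l) → eval L x ≡ eval L y
    eval-cong []            e = refl
    eval-cong ((c , m) ∷ L) e = cong₂ (λ u v → c ℚ.* val u ℚ.+ v) (pair-cong (λ _ → refl) e) (eval-cong L e)
    bases : List (ℚ × Exponent) → List ℚ⁺
    bases = map (λ t → T (⟨ proj₂ t , w ⟩ ℤ.+ ℤ.- E))
    bases≥2 : ∀ L → All (Low w E ∘ proj₂) L → All (λ b → 2ℚ ℚ.≤ val b) (bases L)
    bases≥2 []      []       = []
    bases≥2 (t ∷ L) (lt ∷ s) = T-≥2 (subst (⟨ proj₂ t , w ⟩ ℤ.+ ℤ.- E ℤ.<_) (ℤₚ.+-inverseʳ E) (ℤₚ.+-monoˡ-< (ℤ.- E) lt)) ∷ bases≥2 L s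
    seq : List (ℚ × Exponent) → ℕ → ℚ
    seq L N = eval L (scale N w x) ℚ.* val (Pow.pow (T (ℤ.- E)) N)
    annihilated : ∀ L → Annihilated (bases L) (seq L)
    annihilated []            N = ℚₚ.*-zeroˡ (val (Pow.pow (T (ℤ.- E)) N))
    annihilated ((c , m) ∷ L) = annihilated-cong (b ∷ bases L) (λ N → sym (expand N))
      (annihilated-comb (b ∷ bases L) 1ℚ {λ N → (c ℚ.* val (pair m x)) ℚ.* val (Pow.pow b N)} {seq L} (annihilated-geometric b (bases L) (c ℚ.* val (pair m x)))
        (annihilated-∷ b (bases L) {seq L} (annihilated L)))
      where
      b = T (⟨ m , w ⟩ ℤ.+ ℤ.- E)
      lemma : ∀ c t q e s → (c ℚ.* (t ℚ.* q) ℚ.+ e) ℚ.* s ≡ (c ℚ.* q) ℚ.* (t ℚ.* s) ℚ.+ 1ℚ ℚ.* (e ℚ.* s)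
      lemma = solve-ring ℚ-ring
      expand : ∀ N → seq ((c , m) ∷ L) N ≡ (c ℚ.* val (pair m x)) ℚ.* val (Pow.pow b N) ℚ.+ 1ℚ ℚ.* seq L N
      expand N = trans (cong (λ v → (c ℚ.* val v ℚ.+ eval L (scale N w x)) ℚ.* val (Pow.pow (T (ℤ.- E)) N)) (pair-scale N w m x))
        (trans (lemma c (val (Pow.pow (T ⟨ m , w ⟩) N)) (val (pair m x)) (eval L (scale N w x)) (val (Pow.pow (T (ℤ.- E)) N)))
               (cong (λ v → (c ℚ.* val (pair m x)) ℚ.* val v ℚ.+ 1ℚ ℚ.* seq L N)
                 (trans (sym (Pow.pow-∙ (T ⟨ m , w ⟩) (T (ℤ.- E)) N)) (cong (λ v → Pow.pow v N) (sym (T-+ ⟨ m , w ⟩ (ℤ.- E)))))))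
    cancel : ∀ N → Pow.pow (T E) N *⁺ Pow.pow (T (ℤ.- E)) N ≡ 1⁺
    cancel N = trans (sym (Pow.pow-∙ (T E) (T (ℤ.- E)) N))
      (trans (cong (λ v → Pow.pow v N) (trans (sym (T-+ E (ℤ.- E))) (trans (cong T (ℤₚ.+-inverseʳ E)) T-0))) (pow-1 N))
      where
      pow-1 : ∀ N → Pow.pow 1⁺ N ≡ 1⁺
      pow-1 zero    = refl
      pow-1 (suc N) = trans (ℚ⁺-≡ (ℚₚ.*-identityˡ _)) (pow-1 N)
    bounded : ∀ N → ℚ.∣ seq L N ∣ ℚ.≤ C
    bounded N = begin
      ℚ.∣ seq L N ∣                                                     ≡⟨ ∣*val∣ (eval L (scale N w x)) (Pow.pow (T (ℤ.- E)) N) ⟩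
      ℚ.∣ eval L (scale N w x) ∣ ℚ.* val (Pow.pow (T (ℤ.- E)) N)        ≤⟨ *-monoʳ _ (val-nonNeg (Pow.pow (T (ℤ.- E)) N)) (subst (λ v → ℚ.∣ v ∣ ℚ.≤ C ℚ.* val (Pow.pow (T E) N)) (p (scale N w x)) (bound N)) ⟩
      (C ℚ.* val (Pow.pow (T E) N)) ℚ.* val (Pow.pow (T (ℤ.- E)) N)     ≡⟨ trans (ℚₚ.*-assoc C _ _) (trans (cong (λ v → C ℚ.* val v) (cancel N)) (ℚₚ.*-identityʳ C)) ⟩
      C                                                                 ∎
      where open ℚₚ.≤-Reasoning
    vanish : f x ≡ 0ℚ
    vanish = begin
      f x                                        ≡⟨ p x ⟩
      eval L x                                   ≡⟨ eval-cong L (λ l → sym (trans (cong (_*⁺ x l) T-0) (ℚ⁺-≡ (ℚₚ.*-identityˡ (val (x l)))))) ⟩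
      eval L (scale 0 w x)                       ≡⟨ sym (ℚₚ.*-identityʳ _) ⟩
      eval L (scale 0 w x) ℚ.* 1ℚ                ≡⟨ annihilated-bounded (bases L) (bases≥2 L s) (annihilated L) (C , bounded) 0 ⟩
      0ℚ                                         ∎
      where open ≡-Reasoning

  decaying-high : ∀ {P : Exponent → Set} {f w E} → Laurent P f → (∀ x → Decays f w E x)
    → Laurent (λ m → P m × High w E m) f
  decaying-high {P} {f} {w} {E} lf dec = laurent-resp (λ x → sym (f≡h x)) lh
    where
    split = laurent-split (Low w E) (λ m → ⟨ m , w ⟩ ℤₚ.<? E) lf
    g h : Point → ℚ
    g = proj₁ split
    h = proj₁ (proj₂ split)
    lh : Laurent (λ m → P m × High w E m) h
    lh = laurent-weaken (λ m pm → proj₁ pm , ℤₚ.≮⇒≥ (proj₂ pm)) (proj₁ (proj₂ (proj₂ (proj₂ split))))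
    f≡g+h : ∀ x → f x ≡ g x ℚ.+ h x
    f≡g+h = proj₂ (proj₂ (proj₂ (proj₂ split)))
    lemma : ∀ g h → g ≡ (g ℚ.+ h) ℚ.+ (ℚ.- 1ℚ) ℚ.* h
    lemma = solve-ring ℚ-ring
    g≡f-h : ∀ x → g x ≡ f x ℚ.+ (ℚ.- 1ℚ) ℚ.* h x
    g≡f-h x = trans (lemma (g x) (h x)) (cong (ℚ._+ (ℚ.- 1ℚ) ℚ.* h x) (sym (f≡g+h x)))
    -h-high : Laurent (High w E) (λ x → (ℚ.- 1ℚ) ℚ.* h x)
    -h-high = laurent-scale (ℚ.- 1ℚ) (laurent-weaken (λ m → proj₂) lh)
    g≡0 : ∀ x → g x ≡ 0ℚ
    g≡0 x = trans (g≡f-h x) (low-decaying-zero (laurent-resp g≡f-h (proj₁ (proj₂ (proj₂ split))))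
      (decays-+ {f} {λ x → (ℚ.- 1ℚ) ℚ.* h x} {w} {E} {x} (dec x) (high-decays -h-high x)))
    f≡h : ∀ x → f x ≡ h x
    f≡h x = trans (f≡g+h x) (trans (cong (ℚ._+ h x) (g≡0 x)) (ℚₚ.+-identityˡ (h x)))

-- Removing denominators with a grading

module Hartogs {n : ℕ} (w : Idx n → ℤ) where
  open Laurent n
  open Laurent.Laurent

  deg-+ : ∀ (m m′ : Exponent) → ⟨ (λ l → m l ℤ.+ m′ l) , w ⟩ ≡ ⟨ m , w ⟩ ℤ.+ ⟨ m′ , w ⟩
  deg-+ m m′ = Trop.pair-+ m m′ w

  deg-0 : ⟨ (λ _ → 0ℤ) , w ⟩ ≡ 0ℤ
  deg-0 = Trop.pair-ε (λ _ → 0ℤ) w (λ _ → inj₁ refl)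

  high-+ : ∀ {E E′} m m′ → High w E m → High w E′ m′ → High w (E ℤ.+ E′) (λ l → m l ℤ.+ m′ l)
  high-+ m m′ h h′ = ℤₚ.≤-trans (ℤₚ.+-mono-≤ h h′) (ℤₚ.≤-reflexive (sym (deg-+ m m′)))

  deg0-high : ∀ m → Deg0 w m → High w 0ℤ m
  deg0-high m e = ℤₚ.≤-reflexive (sym e)

  deg0-low : ∀ {E} m m′ → Deg0 w m → Low w E m′ → Low w E (λ l → m l ℤ.+ m′ l)
  deg0-low {E} m m′ e lt = subst (ℤ._< E) (sym (trans (deg-+ m m′) (trans (cong (ℤ._+ ⟨ m′ , w ⟩) e) (ℤₚ.+-identityˡ _)))) lt

  deg0-+ : ∀ m m′ → Deg0 w m → Deg0 w m′ → Deg0 w (λ l → m l ℤ.+ m′ l)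
  deg0-+ m m′ e e′ = trans (deg-+ m m′) (cong₂ ℤ._+_ e e′)

  degree-range : ∀ (L : List (ℚ × Exponent)) → ∃ λ a → ∃ λ b → All (High w a ∘ proj₂) L × All (Low w b ∘ proj₂) L
  degree-range []            = 0ℤ , 0ℤ , [] , []
  degree-range ((c , m) ∷ L) with degree-range L
  ... | a , b , ha , hb = a ℤ.⊓ ⟨ m , w ⟩ , b ℤ.⊔ ℤ.suc ⟨ m , w ⟩ ,
      ℤₚ.i⊓j≤j a _ ∷ All.map (ℤₚ.≤-trans (ℤₚ.i⊓j≤i a _)) ha ,
      ℤₚ.<-≤-trans (ℤₚ.suc[i]≤j⇒i<j ℤₚ.≤-refl) (ℤₚ.i≤j⊔i b _) ∷ All.map (λ lt → ℤₚ.<-≤-trans lt (ℤₚ.i≤i⊔j b _)) hb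

  module _ {F : Point → ℚ} {P : Point → ℚ⁺} {ω : Point → ℚ}
    (P-deg0 : Laurent (Deg0 w) (val ∘ P)) (ω-high : Laurent (High w 1ℤ) ω)
    (FP : Laurent Any (λ x → F x ℚ.* val (P x))) (FQ : Laurent Any (λ x → F x ℚ.* (1ℚ ℚ.+ ω x))) where

    private
      G : Point → ℚ
      G x = F x ℚ.* val (P x)

      range = degree-range (terms FP)
      a = proj₁ range
      b = proj₁ (proj₂ range)

      G-high : Laurent (High w a) G
      G-high = mkLaurent (terms FP) (proj₁ (proj₂ (proj₂ range))) (expansion FP)

      G-low : Laurent (Low w b) G
      G-low = mkLaurent (terms FP) (proj₂ (proj₂ (proj₂ range))) (expansion FP)

      -ω^ : ℕ → Point → ℚ
      -ω^ zero    x = 1ℚ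
      -ω^ (suc N) x = (ℚ.- 1ℚ ℚ.* ω x) ℚ.* -ω^ N x

      geometric : ℕ → Point → ℚ
      geometric zero    x = 0ℚ
      geometric (suc N) x = 1ℚ ℚ.+ (ℚ.- 1ℚ ℚ.* ω x) ℚ.* geometric N x

      -ω^-high : ∀ N → Laurent (High w (+ N)) (-ω^ N)
      -ω^-high zero    = laurent-const 1ℚ (ℤₚ.≤-reflexive (sym deg-0))
      -ω^-high (suc N) = laurent-* (high-+ {1ℤ} {+ N}) (laurent-scale (ℚ.- 1ℚ) ω-high) (-ω^-high N)

      geometric-laurent : ∀ N → Laurent Any (geometric N)
      geometric-laurent zero    = laurent-0
      geometric-laurent (suc N) = laurent-+ (laurent-const 1ℚ tt)
        (laurent-* (λ _ _ _ _ → tt) (laurent-scale (ℚ.- 1ℚ) ω-high) (geometric-laurent N))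

      telescope : ∀ N x → F x ≡ (F x ℚ.* (1ℚ ℚ.+ ω x)) ℚ.* geometric N x ℚ.+ F x ℚ.* -ω^ N x
      telescope zero    x = lemma (F x) (ω x)
        where
        lemma : ∀ f o → f ≡ (f ℚ.* (1ℚ ℚ.+ o)) ℚ.* 0ℚ ℚ.+ f ℚ.* 1ℚ
        lemma = solve-ring ℚ-ring
      telescope (suc N) x = trans (telescope N x) (lemma (F x) (ω x) (geometric N x) (-ω^ N x) (telescope N x))
        where
        expand : ∀ f o g → (f ℚ.* (1ℚ ℚ.+ o)) ℚ.* (1ℚ ℚ.+ (ℚ.- 1ℚ ℚ.* o) ℚ.* g) ≡
          f ℚ.+ (f ℚ.* o) ℚ.+ (ℚ.- 1ℚ ℚ.* o) ℚ.* ((f ℚ.* (1ℚ ℚ.+ o)) ℚ.* g)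
        expand = solve-ring ℚ-ring
        collect : ∀ f o h p → f ℚ.+ (f ℚ.* o) ℚ.+ (ℚ.- 1ℚ ℚ.* o) ℚ.* h ℚ.+ f ℚ.* ((ℚ.- 1ℚ ℚ.* o) ℚ.* p)
          ≡ f ℚ.+ (f ℚ.* o) ℚ.+ (ℚ.- 1ℚ ℚ.* o) ℚ.* (h ℚ.+ f ℚ.* p)
        collect = solve-ring ℚ-ring
        finish : ∀ f o → f ℚ.+ (f ℚ.* o) ℚ.+ (ℚ.- 1ℚ ℚ.* o) ℚ.* f ≡ f
        finish = solve-ring ℚ-ring
        lemma : ∀ f o g p → f ≡ (f ℚ.* (1ℚ ℚ.+ o)) ℚ.* g ℚ.+ f ℚ.* p
          → (f ℚ.* (1ℚ ℚ.+ o)) ℚ.* g ℚ.+ f ℚ.* p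
          ≡ (f ℚ.* (1ℚ ℚ.+ o)) ℚ.* (1ℚ ℚ.+ (ℚ.- 1ℚ ℚ.* o) ℚ.* g) ℚ.+ f ℚ.* ((ℚ.- 1ℚ ℚ.* o) ℚ.* p)
        lemma f o g p e = trans (sym e) (sym (trans (cong (ℚ._+ f ℚ.* ((ℚ.- 1ℚ ℚ.* o) ℚ.* p)) (expand f o g))
          (trans (collect f o ((f ℚ.* (1ℚ ℚ.+ o)) ℚ.* g) p)
                 (trans (cong (λ v → f ℚ.+ (f ℚ.* o) ℚ.+ (ℚ.- 1ℚ ℚ.* o) ℚ.* v) (sym e)) (finish f o)))))

      -- Long enough that the remainder F P (-ω)^N of the geometric series has only degrees a + N ≥
      -- b.
      N : ℕ
      N = suc ℤ.∣ b ℤ.+ ℤ.- a ∣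

      b≤a+N : b ≤ a ℤ.+ + N
      b≤a+N = ℤₚ.≤-trans (ℤₚ.≤-reflexive (lemma a b))
        (ℤₚ.+-monoʳ-≤ a (ℤₚ.≤-trans (i≤∣i∣ (b ℤ.+ ℤ.- a)) (ℤ.+≤+ (ℕₚ.n≤1+n _))))
        where
        lemma : ∀ a b → b ≡ a ℤ.+ (b ℤ.+ ℤ.- a)
        lemma = solve-∀

      split = laurent-split (Low w b) (λ m → ⟨ m , w ⟩ ℤₚ.<? b)
                (laurent-* {S = Any} (λ _ _ _ _ → tt) FQ (geometric-laurent N))
      lo hi : Point → ℚ
      lo = proj₁ split
      hi = proj₁ (proj₂ split)
      lo-low : Laurent (Low w b) lo
      lo-low = proj₁ (proj₂ (proj₂ split))
      hi-high : Laurent (High w b) hi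
      hi-high = laurent-weaken (λ m pm → ℤₚ.≮⇒≥ (proj₂ pm)) (proj₁ (proj₂ (proj₂ (proj₂ split))))

      -- As F P - P lo it has degrees below b, and as P hi + F P (-ω)^N degrees at least b. Hence it
      -- vanishes, which says F P = P lo.
      f : Point → ℚ
      f x = G x ℚ.+ (ℚ.- 1ℚ) ℚ.* (val (P x) ℚ.* lo x)

      f-low : Laurent (Low w b) f
      f-low = laurent-+ G-low (laurent-scale (ℚ.- 1ℚ) (laurent-* deg0-low P-deg0 lo-low))

      f-high : Laurent (High w b) f
      f-high = laurent-resp (λ x → sym (eq x)) (laurent-+
        (laurent-weaken (λ m → ℤₚ.≤-trans (ℤₚ.≤-reflexive (sym (ℤₚ.+-identityˡ b))))
          (laurent-* {S = High w (0ℤ ℤ.+ b)} (λ m m′ d0 → high-+ m m′ (deg0-high m d0)) P-deg0 hi-high))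
        (laurent-weaken (λ m → ℤₚ.≤-trans b≤a+N) (laurent-* (high-+ {a} {+ N}) G-high (-ω^-high N))))
        where
        lemma : ∀ F P h l r → F ≡ (l ℚ.+ h) ℚ.+ F ℚ.* r
          → F ℚ.* P ℚ.+ (ℚ.- 1ℚ) ℚ.* (P ℚ.* l) ≡ P ℚ.* h ℚ.+ (F ℚ.* P) ℚ.* r
        lemma F P h l r e = trans (cong (λ v → v ℚ.* P ℚ.+ (ℚ.- 1ℚ) ℚ.* (P ℚ.* l)) e) (identity F P h l r)
          where
          identity : ∀ F P h l r → ((l ℚ.+ h) ℚ.+ F ℚ.* r) ℚ.* P ℚ.+ (ℚ.- 1ℚ) ℚ.* (P ℚ.* l) ≡ P ℚ.* h ℚ.+ (F ℚ.* P) ℚ.* r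
          identity = solve-ring ℚ-ring
        eq : ∀ x → f x ≡ val (P x) ℚ.* hi x ℚ.+ G x ℚ.* -ω^ N x
        eq x = lemma (F x) (val (P x)) (hi x) (lo x) (-ω^ N x)
          (trans (telescope N x) (cong (ℚ._+ F x ℚ.* -ω^ N x) (proj₂ (proj₂ (proj₂ (proj₂ split))) x)))

    -- Expand F = F (1 + ω) / (1 + ω) as a geometric series and truncate it at the
    -- top degree of F P; since P has degree 0 the truncation commutes with F ↦ F P.
    hartogs : Laurent Any F
    hartogs = laurent-resp (λ x → val-cancelʳ (P x) (eq x)) (laurent-weaken (λ _ _ → tt) lo-low)
      where
      lemma : ∀ g p l → g ℚ.+ (ℚ.- 1ℚ) ℚ.* (p ℚ.* l) ≡ 0ℚ → l ℚ.* p ≡ g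
      lemma g p l e = trans (identity g p l) (trans (cong (λ v → g ℚ.+ ℚ.- v) e) (ℚₚ.+-identityʳ g))
        where
        identity : ∀ g p l → l ℚ.* p ≡ g ℚ.+ ℚ.- (g ℚ.+ (ℚ.- 1ℚ) ℚ.* (p ℚ.* l))
        identity = solve-ring ℚ-ring
      eq : ∀ x → lo x ℚ.* val (P x) ≡ F x ℚ.* val (P x)
      eq x = lemma (G x) (val (P x)) (lo x) (low-decaying-zero f-low (high-decays f-high x))

-- Monomials, and fractions whose denominator is a power of one polynomial

module Denominators {n : ℕ} (D : GenFixedData n) where
  open Mutation D
  open GoodMatrices D
  open Good
  open Laurent n
  open Laurent.Laurent
  open Semifield positiveRationals using (_∙_; _·_; ·-1; identityˡ; assoc)
  open Pairing positiveRationals using (pairFin; pair; pair-def; pair-+; pair-*; pairFin-single; pairFin-ε)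
  open Seeds D positiveRationals

  qpow : ℚ → ℕ → ℚ
  qpow p zero    = 1ℚ
  qpow p (suc N) = p ℚ.* qpow p N

  qpow-+ : ∀ p N N′ → qpow p (N ℕ.+ N′) ≡ qpow p N ℚ.* qpow p N′
  qpow-+ p zero    N′ = sym (ℚₚ.*-identityˡ (qpow p N′))
  qpow-+ p (suc N) N′ = trans (cong (p ℚ.*_) (qpow-+ p N N′)) (sym (ℚₚ.*-assoc p (qpow p N) (qpow p N′)))

  val-pow : ∀ x N → val (Pow.pow x N) ≡ qpow (val x) N
  val-pow x zero    = refl
  val-pow x (suc N) = cong (val x ℚ.*_) (val-pow x N)

  any-* : ∀ {f g} → Laurent Any f → Laurent Any g → Laurent Any (λ x → f x ℚ.* g x)
  any-* = laurent-* (λ _ _ _ _ → tt)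

  laurent-qpow : ∀ {P : Exponent → Set} → P (λ _ → 0ℤ) → (∀ m m′ → P m → P m′ → P (λ l → m l ℤ.+ m′ l))
    → ∀ {f} → Laurent P f → ∀ N → Laurent P (λ x → qpow (f x) N)
  laurent-qpow p0 p+ lf zero    = laurent-const 1ℚ p0
  laurent-qpow p0 p+ lf (suc N) = laurent-* p+ lf (laurent-qpow p0 p+ lf N)

  Monomial : (Point → ℚ⁺) → Set
  Monomial u = ∃ λ m → ∀ x → u x ≡ pair m x

  monomial-∙ : ∀ {u v} → Monomial u → Monomial v → Monomial (λ x → u x ∙ v x)
  monomial-∙ (m , e) (m′ , e′) = (λ l → m l ℤ.+ m′ l) , λ x → trans (cong₂ _∙_ (e x) (e′ x)) (sym (pair-+ m m′ x))

  monomial-· : ∀ a {u} → Monomial u → Monomial (λ x → a · u x)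
  monomial-· a (m , e) = (λ l → a ℤ.* m l) , λ x → trans (cong (a ·_) (e x)) (sym (pair-* a m x))

  monomial-inv : ∀ {u} → Monomial u → Monomial (inv⁺ ∘ u)
  monomial-inv {u} mu = proj₁ m , λ x → trans (sym (Pow.identityʳ (inv⁺ (u x)))) (proj₂ m x)
    where m = monomial-· ℤ.-1ℤ mu

  monomial-pair : ∀ m → Monomial (pair m)
  monomial-pair m = m , λ _ → refl

  monomial-coordinate : ∀ l → Monomial (λ x → x l)
  monomial-coordinate (inj₁ l) = δ l , λ x → sym (pair-δ l x)
  monomial-coordinate (inj₂ l) = e , λ x → sym (begin
    pair e x                                                        ≡⟨ pair-def e x ⟩
    pairFin (λ _ → 0ℤ) (x ∘ inj₁) ∙ pairFin (e ∘ inj₂) (x ∘ inj₂)   ≡⟨ cong₂ _∙_ (pairFin-ε (λ _ → 0ℤ) (x ∘ inj₁) (λ _ → inj₁ refl)) (pairFin-single l (e ∘ inj₂) (x ∘ inj₂) (λ l′ ne → inj₁ (off l′ ne))) ⟩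
    1⁺ ∙ δ l (inj₁ l) · x (inj₂ l)                                  ≡⟨ identityˡ _ ⟩
    δ l (inj₁ l) · x (inj₂ l)                                       ≡⟨ cong (_· x (inj₂ l)) (δ-same l) ⟩
    1ℤ · x (inj₂ l)                                                 ≡⟨ ·-1 _ ⟩
    x (inj₂ l)                                                      ∎)
    where
    open ≡-Reasoning
    e : Exponent
    e (inj₁ _)  = 0ℤ
    e (inj₂ l′) = δ l (inj₁ l′)
    off : ∀ l′ → l′ ≢ l → δ l (inj₁ l′) ≡ 0ℤ
    off l′ ne = δ-other l (inj₁ l′) (λ { refl → ne refl })

  monomial-laurent : ∀ {u} → Monomial u → Laurent Any (val ∘ u)
  monomial-laurent (m , e) = laurent-resp (λ x → cong val (sym (e x))) (laurent-monomial {m = m} tt)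

  record Fraction (Δ f : Point → ℚ) : Set where
    constructor _,_
    field
      exponent  : ℕ
      numerator : Laurent Any (λ x → f x ℚ.* qpow (Δ x) exponent)

  module Fractions {Δ : Point → ℚ} (Δ-laurent : Laurent Any Δ) where

    private
      Δ^ : ∀ N → Laurent Any (λ x → qpow (Δ x) N)
      Δ^ = laurent-qpow {Any} tt (λ _ _ _ _ → tt) Δ-laurent

    fraction-resp : ∀ {f g} → (∀ x → f x ≡ g x) → Fraction Δ f → Fraction Δ g
    fraction-resp e (N , lf) = N , laurent-resp (λ x → cong (ℚ._* qpow (Δ x) N) (e x)) lf

    fraction-laurent : ∀ {f} → Laurent Any f → Fraction Δ f
    fraction-laurent lf = 0 , laurent-resp (λ x → sym (ℚₚ.*-identityʳ _)) lf

    fraction-* : ∀ {f g} → Fraction Δ f → Fraction Δ g → Fraction Δ (λ x → f x ℚ.* g x)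
    fraction-* {f} {g} (N , lf) (N′ , lg) = N ℕ.+ N′ , laurent-resp
      (λ x → trans (lemma (f x) (g x) (qpow (Δ x) N) (qpow (Δ x) N′)) (cong ((f x ℚ.* g x) ℚ.*_) (sym (qpow-+ (Δ x) N N′))))
      (any-* lf lg)
      where
      lemma : ∀ f g p q → (f ℚ.* p) ℚ.* (g ℚ.* q) ≡ (f ℚ.* g) ℚ.* (p ℚ.* q)
      lemma = solve-ring ℚ-ring

    fraction-+ : ∀ {f g} → Fraction Δ f → Fraction Δ g → Fraction Δ (λ x → f x ℚ.+ g x)
    fraction-+ {f} {g} (N , lf) (N′ , lg) = N ℕ.+ N′ , laurent-resp
      (λ x → trans (lemma (f x) (g x) (qpow (Δ x) N) (qpow (Δ x) N′)) (cong ((f x ℚ.+ g x) ℚ.*_) (sym (qpow-+ (Δ x) N N′))))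
      (laurent-+ (any-* lf (Δ^ N′)) (any-* lg (Δ^ N)))
      where
      lemma : ∀ f g p q → (f ℚ.* p) ℚ.* q ℚ.+ (g ℚ.* q) ℚ.* p ≡ (f ℚ.+ g) ℚ.* (p ℚ.* q)
      lemma = solve-ring ℚ-ring

    module _ (y : Point → Point) (y-frac : ∀ l → Fraction Δ (λ x → val (y x l)))
             (y⁻¹-frac : ∀ l → Fraction Δ (λ x → val (inv⁺ (y x l)))) where

      fraction-pow : ∀ {u : Point → ℚ⁺} → Fraction Δ (val ∘ u) → ∀ N → Fraction Δ (λ x → val (Pow.pow (u x) N))
      fraction-pow fu zero    = fraction-laurent (laurent-const 1ℚ tt)
      fraction-pow {u} fu (suc N) = fraction-* fu (fraction-pow {u} fu N)

      fraction-· : ∀ a l → Fraction Δ (λ x → val (a · y x l))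
      fraction-· (+ N)    l = fraction-pow {λ x → y x l} (y-frac l) N
      fraction-· -[1+ N ] l = fraction-pow {λ x → inv⁺ (y x l)} (y⁻¹-frac l) (suc N)

      fraction-pairFin : ∀ {k} (a : Fin k → ℤ) (h : Fin k → Idx n) → Fraction Δ (λ x → val (pairFin a (λ l → y x (h l))))
      fraction-pairFin {zero}  a h = fraction-laurent (laurent-const 1ℚ tt)
      fraction-pairFin {suc k} a h = fraction-* (fraction-· (a zero) (h zero)) (fraction-pairFin (a ∘ suc) (h ∘ suc))

      fraction-pair : ∀ m → Fraction Δ (λ x → val (pair m (y x)))
      fraction-pair m = fraction-resp (λ x → cong val (sym (pair-def m (y x))))
        (fraction-* (fraction-pairFin (m ∘ inj₁) inj₁) (fraction-pairFin (m ∘ inj₂) inj₂))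

      fraction-eval : ∀ L → Fraction Δ (λ x → eval L (y x))
      fraction-eval []            = fraction-laurent laurent-0
      fraction-eval ((c , m) ∷ L) = fraction-+ (fraction-* (fraction-laurent (laurent-const c tt)) (fraction-pair m)) (fraction-eval L)

      fraction-subst : ∀ {f} → Laurent Any f → Fraction Δ (λ x → f (y x))
      fraction-subst (mkLaurent L s p) = fraction-resp (λ x → sym (p (y x))) (fraction-eval L)

  1+⁺-laurent : ∀ {u} → Laurent Any (val ∘ u) → Laurent Any (λ x → val (1+⁺ (u x)))
  1+⁺-laurent lu = laurent-+ (laurent-const 1ℚ tt) lu

  Ŷ-monomial : ∀ k B → Monomial (Ŷ k B)
  Ŷ-monomial k B = monomial-· (R k) (monomial-pair (B k))

  exchange-monomial : ∀ k B → Monomial (λ x → ℤ.-1ℤ · x (inj₁ k) ∙ M⁻ k B x)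
  exchange-monomial k B = monomial-∙ (monomial-· ℤ.-1ℤ (monomial-coordinate (inj₁ k))) (monomial-pair _)

  module _ {Δ : Point → ℚ} (Δ-laurent : Laurent Any Δ) where
    open Fractions Δ-laurent

    -- Here u divides Δ with quotient v, so 1 / y = m⁻¹ v / Δ needs just one power of Δ.
    monomial-times : ∀ {y m u v} → Monomial m → (∀ x → y x ≡ m x ∙ u x) → Laurent Any (val ∘ u)
      → Laurent Any v → (∀ x → Δ x ≡ v x ℚ.* val (u x)) → Fraction Δ (val ∘ y) × Fraction Δ (val ∘ inv⁺ ∘ y)
    monomial-times {y} {m} {u} {v} mm e lu lv dv =
      fraction-laurent (laurent-resp (λ x → cong val (sym (e x))) (any-* (monomial-laurent mm) lu)) ,
      (1 , laurent-resp eq (any-* (monomial-laurent (monomial-inv mm)) lv))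
      where
      lemma : ∀ m u′ u v → (m ℚ.* u′) ℚ.* ((v ℚ.* u) ℚ.* 1ℚ) ≡ (m ℚ.* v) ℚ.* (u ℚ.* u′)
      lemma = solve-ring ℚ-ring
      open ≡-Reasoning
      eq : ∀ x → val (inv⁺ (m x)) ℚ.* v x ≡ val (inv⁺ (y x)) ℚ.* (Δ x ℚ.* 1ℚ)
      eq x = sym (begin
        val (inv⁺ (y x)) ℚ.* (Δ x ℚ.* 1ℚ)
          ≡⟨ cong₂ (λ p q → val p ℚ.* (q ℚ.* 1ℚ)) (trans (cong inv⁺ (e x)) (Pow.inv-∙ (m x) (u x))) (dv x) ⟩
        (val (inv⁺ (m x)) ℚ.* val (inv⁺ (u x))) ℚ.* ((v x ℚ.* val (u x)) ℚ.* 1ℚ)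
          ≡⟨ lemma (val (inv⁺ (m x))) (val (inv⁺ (u x))) (val (u x)) (v x) ⟩
        (val (inv⁺ (m x)) ℚ.* v x) ℚ.* (val (u x) ℚ.* val (inv⁺ (u x)))
          ≡⟨ cong ((val (inv⁺ (m x)) ℚ.* v x) ℚ.*_) (val-inv (u x)) ⟩
        (val (inv⁺ (m x)) ℚ.* v x) ℚ.* 1ℚ
          ≡⟨ ℚₚ.*-identityʳ _ ⟩
        val (inv⁺ (m x)) ℚ.* v x ∎)

    monomial-fractions : ∀ {y} → Monomial y → Fraction Δ (val ∘ y) × Fraction Δ (val ∘ inv⁺ ∘ y)
    monomial-fractions my = fraction-laurent (monomial-laurent my) , fraction-laurent (monomial-laurent (monomial-inv my))

  step-laurent : ∀ k B l → Laurent Any (λ x → val (step k B x l))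
  step-laurent k B (inj₂ l) = monomial-laurent (monomial-coordinate (inj₂ l))
  step-laurent k B (inj₁ l) with l ≟ k
  ... | no _  = monomial-laurent (monomial-coordinate (inj₁ l))
  ... | yes _ = laurent-resp (λ x → cong val (assoc (ℤ.-1ℤ · x (inj₁ k)) (M⁻ k B x) (1+⁺ (Ŷ k B x))))
    (any-* (monomial-laurent {λ x → ℤ.-1ℤ · x (inj₁ k) ∙ M⁻ k B x} (exchange-monomial k B))
           (1+⁺-laurent {Ŷ k B} (monomial-laurent {Ŷ k B} (Ŷ-monomial k B))))

-- Coordinates of the seeds reached by i and by i, k, i

module RankTwo {n : ℕ} (D : GenFixedData n) {B : ExtMat n} (gB : GoodMatrices.Good D B)
  {i k : Fin n} (i≢k : i ≢ k) (c≥0 : 0ℤ ≤ B i (inj₁ k)) where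
  open GenFixedData D using (r; r-pos)
  open Mutation D
  open GoodMatrices D
  open Good
  open Laurent n
  open Laurent.Laurent
  open Denominators D
  open Semifield positiveRationals using (_∙_; _·_; ·-∙; ·-*; ·-1; identityˡ; assoc)
  open Pairing positiveRationals using (pair; pair-*)
  open Seeds D positiveRationals
  open CM using (_⊕_; _⊜_)

  B₁ B₂ : ExtMat n
  B₁ = μ i B
  B₂ = μ k B₁

  x₁ x₂ x₃ : Point → Point
  x₁ x = step i B x
  x₂ x = step k B₁ (x₁ x)
  x₃ x = step i B₂ (x₂ x)

  private
    b≤0 : B k (inj₁ i) ≤ 0ℤ
    b≤0 = skew-nonpos (isSkew gB) i k c≥0

    β γ p q : ℕ
    β = ℤ.∣ B k (inj₁ i) ∣
    γ = ℤ.∣ B i (inj₁ k) ∣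
    p = r k ℕ.* β
    q = r i ℕ.* γ

    +β : + β ≡ ℤ.- B k (inj₁ i)
    +β = trans (cong +_ (sym (ℤₚ.∣-i∣≡∣i∣ (B k (inj₁ i))))) (ℤₚ.0≤i⇒+∣i∣≡i (neg-nonpos b≤0))

    +γ : + γ ≡ B i (inj₁ k)
    +γ = ℤₚ.0≤i⇒+∣i∣≡i c≥0

    -- `A`, `K` and 1 + `Y₂` are the factors φ Ŷ of the three exchanges along i, k, i. The sign of B
    -- i k is chosen so that `κ` and `Y₂` carry no additional monomial factors. `Ξ` = (Yᵢ + K^q) / A
    -- is what x₃ i contains besides a monomial.
    Yᵢ Yₖ A κ K Y₂ Ξ : Point → ℚ⁺
    Yᵢ = Ŷ i B
    Yₖ = Ŷ k B
    A x = 1+⁺ (Yᵢ x)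
    κ x = Yₖ x ∙ Pow.pow (A x) p
    K x = 1+⁺ (κ x)
    Y₂ x = inv⁺ (Yᵢ x) ∙ Pow.pow (K x) q
    Ξ x = inv⁺ (A x) ∙ (Yᵢ x ∙ 1+⁺ (Y₂ x))

    B₁-ki : B₁ k (inj₁ i) ≡ + β
    B₁-ki = trans (μ-col i B (diag gB i) k) (sym +β)

    B₁-ik : B₁ i (inj₁ k) ≡ ℤ.- + γ
    B₁-ik = trans (μ-same i B (inj₁ k)) (cong ℤ.-_ (sym +γ))

    gB₁ = good-μ i gB
    gB₂ = good-μ k gB₁

    B₂-ik : B₂ i (inj₁ k) ≡ + γ
    B₂-ik = trans (μ-col k B₁ (diag gB₁ k) i) (trans (cong ℤ.-_ B₁-ik) (ℤₚ.neg-involutive (+ γ)))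

    Ŷ-κ : ∀ x → Ŷ k B₁ (x₁ x) ≡ κ x
    Ŷ-κ x = begin
      R k · pair (B₁ k) (step i B x)
        ≡⟨ cong (R k ·_) (ŷ-step-other i x (diag gB i) (i≢k ∘ sym)) ⟩
      R k · (pair (B k) x ∙ ((R i ℤ.* B k (inj₁ i) ⁺) · pair (B i) x ∙ (ℤ.- B k (inj₁ i)) · A x))
        ≡⟨ cong₂ (λ u v → R k · (pair (B k) x ∙ (u · pair (B i) x ∙ v · A x)))
             (trans (cong (R i ℤ.*_) (⁺-of-nonpos b≤0)) (ℤₚ.*-zeroʳ (R i))) (sym +β) ⟩
      R k · (pair (B k) x ∙ (0ℤ · pair (B i) x ∙ + β · A x))
        ≡⟨ cong (λ v → R k · (pair (B k) x ∙ v)) (identityˡ (+ β · A x)) ⟩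
      R k · (pair (B k) x ∙ + β · A x)
        ≡⟨ ·-∙ (R k) (pair (B k) x) (+ β · A x) ⟩
      Yₖ x ∙ R k · + β · A x
        ≡⟨ cong (Yₖ x ∙_) (trans (sym (·-* (R k) (+ β) (A x))) (cong (_· A x) (sym (ℤₚ.pos-* (r k) β)))) ⟩
      κ x ∎
      where open ≡-Reasoning

    Ŷ-Y₂ : ∀ x → Ŷ i B₂ (x₂ x) ≡ Y₂ x
    Ŷ-Y₂ x = begin
      R i · pair (B₂ i) (step k B₁ (x₁ x))
        ≡⟨ cong (R i ·_) (ŷ-step-other k (x₁ x) (diag gB₁ k) i≢k) ⟩
      R i · (pair (B₁ i) (x₁ x) ∙ ((R k ℤ.* B₁ i (inj₁ k) ⁺) · pair (B₁ k) (x₁ x) ∙ (ℤ.- B₁ i (inj₁ k)) · 1+⁺ (Ŷ k B₁ (x₁ x))))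
        ≡⟨ cong₂ (λ u v → R i · (u ∙ ((R k ℤ.* v ⁺) · pair (B₁ k) (x₁ x) ∙ (ℤ.- v) · 1+⁺ (Ŷ k B₁ (x₁ x)))))
             (ŷ-step-same i x (diag gB i)) B₁-ik ⟩
      R i · (ℤ.-1ℤ · pair (B i) x ∙ ((R k ℤ.* (ℤ.- + γ) ⁺) · pair (B₁ k) (x₁ x) ∙ (ℤ.- (ℤ.- + γ)) · 1+⁺ (Ŷ k B₁ (x₁ x))))
        ≡⟨ cong₂ (λ u v → R i · (ℤ.-1ℤ · pair (B i) x ∙ (u · pair (B₁ k) (x₁ x) ∙ v)))
             (trans (cong (R k ℤ.*_) (⁺-of-nonpos (neg-nonneg (ℤ.+≤+ (ℕ.z≤n {γ}))))) (ℤₚ.*-zeroʳ (R k)))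
             (cong₂ (λ a y → a · 1+⁺ y) (ℤₚ.neg-involutive (+ γ)) (Ŷ-κ x)) ⟩
      R i · (ℤ.-1ℤ · pair (B i) x ∙ (0ℤ · pair (B₁ k) (x₁ x) ∙ + γ · K x))
        ≡⟨ cong (λ v → R i · (ℤ.-1ℤ · pair (B i) x ∙ v)) (identityˡ (+ γ · K x)) ⟩
      R i · (ℤ.-1ℤ · pair (B i) x ∙ + γ · K x)
        ≡⟨ ·-∙ (R i) (ℤ.-1ℤ · pair (B i) x) (+ γ · K x) ⟩
      R i · ℤ.-1ℤ · pair (B i) x ∙ R i · + γ · K x
        ≡⟨ cong₂ _∙_ (trans (·-swap (R i) ℤ.-1ℤ (pair (B i) x)) (Pow.identityʳ (inv⁺ (Yᵢ x))))
             (trans (sym (·-* (R i) (+ γ) (K x))) (cong (_· K x) (sym (ℤₚ.pos-* (r i) γ)))) ⟩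
      Y₂ x ∎
      where open ≡-Reasoning

    mᵢ mₖ : Point → ℚ⁺
    mᵢ x = (x (inj₁ i) ∙ inv⁺ (M⁻ i B x)) ∙ (M⁻ i B₂ x ∙ inv⁺ (Yᵢ x))
    mₖ x = ℤ.-1ℤ · x (inj₁ k) ∙ M⁻ k B₁ x

    i≢ : ∀ {a b : Fin n} → a ≢ b → _≢_ {A = Idx n} (inj₁ a) (inj₁ b)
    i≢ ne refl = ne refl

    M⁻-avoid : ∀ {B′ : ExtMat n} (c l : Fin n) → 0ℤ ≤ B′ c (inj₁ l) → R c ℤ.* (ℤ.- B′ c (inj₁ l)) ⁺ ≡ 0ℤ
    M⁻-avoid {B′} c l h = trans (cong (R c ℤ.*_) (⁺-of-nonpos (neg-nonneg h))) (ℤₚ.*-zeroʳ (R c))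

    x₃-k : ∀ x → x₃ x (inj₁ k) ≡ mₖ x ∙ K x
    x₃-k x = begin
      step i B₂ (x₂ x) (inj₁ k)   ≡⟨ step-other i B₂ (x₂ x) (inj₁ k) (i≢ (i≢k ∘ sym)) ⟩
      step k B₁ (x₁ x) (inj₁ k)   ≡⟨ step-same k B₁ (x₁ x) ⟩
      ℤ.-1ℤ · x₁ x (inj₁ k) ∙ (M⁻ k B₁ (x₁ x) ∙ 1+⁺ (Ŷ k B₁ (x₁ x)))
        ≡⟨ cong₂ (λ u v → ℤ.-1ℤ · u ∙ v) (step-other i B x (inj₁ k) (i≢ (i≢k ∘ sym)))
             (cong₂ (λ u v → u ∙ 1+⁺ v)
               (pair-step-avoid i B x (λ l → R k ℤ.* (ℤ.- B₁ k l) ⁺) (M⁻-avoid {B₁} k i (subst (0ℤ ≤_) (sym B₁-ki) (ℤ.+≤+ ℕ.z≤n)))) (Ŷ-κ x)) ⟩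
      ℤ.-1ℤ · x (inj₁ k) ∙ (M⁻ k B₁ x ∙ K x)
        ≡⟨ sym (assoc (ℤ.-1ℤ · x (inj₁ k)) (M⁻ k B₁ x) (K x)) ⟩
      mₖ x ∙ K x ∎
      where open ≡-Reasoning

    x₃-i : ∀ x → x₃ x (inj₁ i) ≡ mᵢ x ∙ Ξ x
    x₃-i x = begin
      step i B₂ (x₂ x) (inj₁ i)   ≡⟨ step-same i B₂ (x₂ x) ⟩
      ℤ.-1ℤ · x₂ x (inj₁ i) ∙ (M⁻ i B₂ (x₂ x) ∙ 1+⁺ (Ŷ i B₂ (x₂ x)))
        ≡⟨ cong₂ (λ u v → ℤ.-1ℤ · u ∙ v)
             (trans (step-other k B₁ (x₁ x) (inj₁ i) (i≢ i≢k)) (step-same i B x))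
             (cong₂ (λ u v → u ∙ 1+⁺ v)
               (trans (pair-step-avoid k B₁ (x₁ x) (λ l → R i ℤ.* (ℤ.- B₂ i l) ⁺) (M⁻-avoid {B₂} i k (subst (0ℤ ≤_) (sym B₂-ik) (ℤ.+≤+ ℕ.z≤n))))
                      (pair-step-avoid i B x (λ l → R i ℤ.* (ℤ.- B₂ i l) ⁺) (M⁻-avoid {B₂} i i (ℤₚ.≤-reflexive (sym (diag gB₂ i))))))
               (Ŷ-Y₂ x)) ⟩
      ℤ.-1ℤ · (ℤ.-1ℤ · xᵢ ∙ (M ∙ A x)) ∙ (M⁻ i B₂ x ∙ 1+⁺ (Y₂ x))
        ≡⟨ cong (_∙ (M⁻ i B₂ x ∙ 1+⁺ (Y₂ x))) (trans (·-∙ ℤ.-1ℤ (ℤ.-1ℤ · xᵢ) (M ∙ A x))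
             (cong₂ _∙_ (trans (sym (·-* ℤ.-1ℤ ℤ.-1ℤ xᵢ)) (·-1 xᵢ)) (trans (Pow.identityʳ (inv⁺ (M ∙ A x))) (Pow.inv-∙ M (A x))))) ⟩
      (xᵢ ∙ (inv⁺ M ∙ inv⁺ (A x))) ∙ (M⁻ i B₂ x ∙ 1+⁺ (Y₂ x))
        ≡⟨ sym (identityˡ _) ⟩
      1⁺ ∙ ((xᵢ ∙ (inv⁺ M ∙ inv⁺ (A x))) ∙ (M⁻ i B₂ x ∙ 1+⁺ (Y₂ x)))
        ≡⟨ cong (_∙ ((xᵢ ∙ (inv⁺ M ∙ inv⁺ (A x))) ∙ (M⁻ i B₂ x ∙ 1+⁺ (Y₂ x)))) (sym (inv⁺-inverse (Yᵢ x))) ⟩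
      (Yᵢ x ∙ inv⁺ (Yᵢ x)) ∙ ((xᵢ ∙ (inv⁺ M ∙ inv⁺ (A x))) ∙ (M⁻ i B₂ x ∙ 1+⁺ (Y₂ x)))
        ≡⟨ CM.solve 7 (λ y y′ a m′ a′ m₂ f → (y ⊕ y′) ⊕ ((a ⊕ (m′ ⊕ a′)) ⊕ (m₂ ⊕ f))
              ⊜ ((a ⊕ m′) ⊕ (m₂ ⊕ y′)) ⊕ (a′ ⊕ (y ⊕ f))) refl
              (Yᵢ x) (inv⁺ (Yᵢ x)) xᵢ (inv⁺ M) (inv⁺ (A x)) (M⁻ i B₂ x) (1+⁺ (Y₂ x)) ⟩
      mᵢ x ∙ Ξ x ∎
      where
      open ≡-Reasoning
      xᵢ = x (inj₁ i)
      M  = M⁻ i B x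

    geom : ℕ → ℚ → ℚ
    geom zero    K = 0ℚ
    geom (suc N) K = 1ℚ ℚ.+ K ℚ.* geom N K

    geom-eq : ∀ N κ → qpow (1ℚ ℚ.+ κ) N ≡ 1ℚ ℚ.+ κ ℚ.* geom N (1ℚ ℚ.+ κ)
    geom-eq zero    κ = sym (trans (cong (1ℚ ℚ.+_) (ℚₚ.*-zeroʳ κ)) refl)
    geom-eq (suc N) κ = trans (cong ((1ℚ ℚ.+ κ) ℚ.*_) (geom-eq N κ)) (lemma κ (geom N (1ℚ ℚ.+ κ)))
      where
      lemma : ∀ κ g → (1ℚ ℚ.+ κ) ℚ.* (1ℚ ℚ.+ κ ℚ.* g) ≡ 1ℚ ℚ.+ κ ℚ.* (1ℚ ℚ.+ (1ℚ ℚ.+ κ) ℚ.* g)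
      lemma = solve-ring ℚ-ring

    -- The quotient (K^q - 1) / A in expanded form: K^q - 1 is κ times a geometric sum, and one
    -- factor of A^p in κ is cancelled.
    Θ : Point → ℚ
    Θ x = (val (Yₖ x) ℚ.* qpow (val (A x)) (ℕ.pred p)) ℚ.* geom q (val (K x))

    zero-or-suc : ∀ p → p ≡ 0 ⊎ p ≡ suc (ℕ.pred p)
    zero-or-suc zero    = inj₁ refl
    zero-or-suc (suc p) = inj₂ refl

    -- If p = 0 then skew-symmetry forces q = 0, so that Θ vanishes.
    Θ-identity : ∀ x → val (κ x) ℚ.* geom q (val (K x)) ≡ val (A x) ℚ.* Θ x
    Θ-identity x = cases (zero-or-suc p)
      where
      open ≡-Reasoning
      lemma : ∀ y a t g → (y ℚ.* (a ℚ.* t)) ℚ.* g ≡ a ℚ.* ((y ℚ.* t) ℚ.* g)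
      lemma = solve-ring ℚ-ring
      b≡0 : p ≡ 0 → B k (inj₁ i) ≡ 0ℤ
      b≡0 e with ℕₚ.m*n≡0⇒m≡0∨n≡0 (r k) e
      ... | inj₁ r≡0 = ⊥-elim (ℕₚ.<⇒≢ (r-pos k) (sym r≡0))
      ... | inj₂ β≡0 = ℤₚ.∣i∣≡0⇒i≡0 β≡0
      q≡0 : p ≡ 0 → q ≡ 0
      q≡0 e = trans (cong (λ v → r i ℕ.* ℤ.∣ v ∣) (skew-zero (isSkew gB) k i (b≡0 e))) (ℕₚ.*-zeroʳ (r i))
      cases : p ≡ 0 ⊎ p ≡ suc (ℕ.pred p) → val (κ x) ℚ.* geom q (val (K x)) ≡ val (A x) ℚ.* Θ x
      cases (inj₂ e) = begin
        (val (Yₖ x) ℚ.* val (Pow.pow (A x) p)) ℚ.* geom q (val (K x))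
          ≡⟨ cong (λ v → (val (Yₖ x) ℚ.* v) ℚ.* geom q (val (K x))) (trans (val-pow (A x) p) (cong (qpow (val (A x))) e)) ⟩
        (val (Yₖ x) ℚ.* (val (A x) ℚ.* qpow (val (A x)) (ℕ.pred p))) ℚ.* geom q (val (K x))
          ≡⟨ lemma (val (Yₖ x)) (val (A x)) (qpow (val (A x)) (ℕ.pred p)) (geom q (val (K x))) ⟩
        val (A x) ℚ.* Θ x ∎
      cases (inj₁ e) = begin
        val (κ x) ℚ.* geom q (val (K x))   ≡⟨ cong (λ v → val (κ x) ℚ.* geom v (val (K x))) (q≡0 e) ⟩
        val (κ x) ℚ.* 0ℚ                   ≡⟨ ℚₚ.*-zeroʳ (val (κ x)) ⟩
        0ℚ                                 ≡⟨ sym (ℚₚ.*-zeroʳ (val (A x))) ⟩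
        val (A x) ℚ.* 0ℚ                   ≡⟨ cong (val (A x) ℚ.*_) (sym (ℚₚ.*-zeroʳ (val (Yₖ x) ℚ.* qpow (val (A x)) (ℕ.pred p)))) ⟩
        val (A x) ℚ.* ((val (Yₖ x) ℚ.* qpow (val (A x)) (ℕ.pred p)) ℚ.* 0ℚ)
          ≡⟨ cong (λ v → val (A x) ℚ.* ((val (Yₖ x) ℚ.* qpow (val (A x)) (ℕ.pred p)) ℚ.* geom v (val (K x)))) (sym (q≡0 e)) ⟩
        val (A x) ℚ.* Θ x ∎

    -- Since A = 1 + Yᵢ, the numerator Yᵢ + K^q equals A + (K^q - 1), and both summands are
    -- divisible by A. Thus `Ξ` is a polynomial of the form 1 + ω.
    Ξ-Θ : ∀ x → val (Ξ x) ≡ 1ℚ ℚ.+ Θ x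
    Ξ-Θ x = begin
      a′ ℚ.* (y ℚ.* (1ℚ ℚ.+ y′ ℚ.* val (Pow.pow (K x) q)))
        ≡⟨ cong (λ v → a′ ℚ.* (y ℚ.* (1ℚ ℚ.+ y′ ℚ.* v))) (trans (val-pow (K x) q) (geom-eq q (val (κ x)))) ⟩
      a′ ℚ.* (y ℚ.* (1ℚ ℚ.+ y′ ℚ.* (1ℚ ℚ.+ val (κ x) ℚ.* geom q (val (K x)))))
        ≡⟨ cong (λ v → a′ ℚ.* (y ℚ.* (1ℚ ℚ.+ y′ ℚ.* (1ℚ ℚ.+ v)))) (Θ-identity x) ⟩
      a′ ℚ.* (y ℚ.* (1ℚ ℚ.+ y′ ℚ.* (1ℚ ℚ.+ a ℚ.* Θ x)))
        ≡⟨ lemma₁ a′ y y′ a (Θ x) ⟩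
      a′ ℚ.* (y ℚ.+ (y ℚ.* y′) ℚ.* (1ℚ ℚ.+ a ℚ.* Θ x))
        ≡⟨ cong (λ v → a′ ℚ.* (y ℚ.+ v ℚ.* (1ℚ ℚ.+ a ℚ.* Θ x))) (val-inv (Yᵢ x)) ⟩
      a′ ℚ.* (y ℚ.+ 1ℚ ℚ.* (1ℚ ℚ.+ a ℚ.* Θ x))
        ≡⟨ lemma₂ a′ y (Θ x) ⟩
      (a ℚ.* a′) ℚ.* (1ℚ ℚ.+ Θ x)
        ≡⟨ trans (cong (ℚ._* (1ℚ ℚ.+ Θ x)) (val-inv (A x))) (ℚₚ.*-identityˡ (1ℚ ℚ.+ Θ x)) ⟩
      1ℚ ℚ.+ Θ x ∎
      where
      open ≡-Reasoning
      a  = val (A x)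
      a′ = val (inv⁺ (A x))
      y  = val (Yᵢ x)
      y′ = val (inv⁺ (Yᵢ x))
      lemma₁ : ∀ a′ y y′ a t → a′ ℚ.* (y ℚ.* (1ℚ ℚ.+ y′ ℚ.* (1ℚ ℚ.+ a ℚ.* t))) ≡ a′ ℚ.* (y ℚ.+ (y ℚ.* y′) ℚ.* (1ℚ ℚ.+ a ℚ.* t))
      lemma₁ = solve-ring ℚ-ring
      lemma₂ : ∀ a′ y t → a′ ℚ.* (y ℚ.+ 1ℚ ℚ.* (1ℚ ℚ.+ (1ℚ ℚ.+ y) ℚ.* t)) ≡ ((1ℚ ℚ.+ y) ℚ.* a′) ℚ.* (1ℚ ℚ.+ t)
      lemma₂ = solve-ring ℚ-ring

    η : Fin n → ℤ
    η c = δ k (inj₁ c)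

    -- In this grading `A` is homogeneous of degree 0, while Yₖ has degree r_k ≥ 1 and forces all
    -- terms of `κ` and `Θ` into positive degree.
    w : Exponent
    w = proj₁ (surjective gB η)

    open Hartogs w

    deg-B : ∀ c → ⟨ B c , w ⟩ ≡ η c
    deg-B = proj₂ (surjective gB η)

    Ŷ-deg : ∀ c → ⟨ (λ l → R c ℤ.* B c l) , w ⟩ ≡ R c ℤ.* η c
    Ŷ-deg c = trans (Trop.pair-* (R c) (B c) w) (cong (R c ℤ.*_) (deg-B c))

    Ŷ-laurent : ∀ {P : Exponent → Set} c → P (λ l → R c ℤ.* B c l) → Laurent P (val ∘ Ŷ c B)
    Ŷ-laurent c pc = laurent-resp (λ x → cong val (pair-* (R c) (B c) x)) (laurent-monomial pc)

    A-deg0 : Laurent (Deg0 w) (val ∘ A)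
    A-deg0 = laurent-+ (laurent-const 1ℚ deg-0)
      (Ŷ-laurent i (trans (Ŷ-deg i) (trans (cong (R i ℤ.*_) (δ-other k (inj₁ i) (i≢ i≢k))) (ℤₚ.*-zeroʳ (R i)))))

    A^-deg0 : ∀ N → Laurent (Deg0 w) (λ x → qpow (val (A x)) N)
    A^-deg0 = laurent-qpow deg-0 deg0-+ A-deg0

    Yₖ-high : Laurent (High w 1ℤ) (val ∘ Yₖ)
    Yₖ-high = Ŷ-laurent k (subst (1ℤ ≤_) (sym (trans (Ŷ-deg k) (trans (cong (R k ℤ.*_) (δ-same k)) (ℤₚ.*-identityʳ (R k))))) (ℤ.+≤+ (r-pos k)))

    high-A^ : ∀ N → Laurent (High w 1ℤ) (λ x → val (Yₖ x) ℚ.* qpow (val (A x)) N)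
    high-A^ N = laurent-* {S = High w 1ℤ} (λ m m′ h d0 → high-+ {1ℤ} {0ℤ} m m′ h (deg0-high m′ d0)) Yₖ-high (A^-deg0 N)

    κ-high : Laurent (High w 1ℤ) (val ∘ κ)
    κ-high = laurent-resp (λ x → cong (val (Yₖ x) ℚ.*_) (sym (val-pow (A x) p))) (high-A^ p)

    1-high : Laurent (High w 0ℤ) (λ _ → 1ℚ)
    1-high = laurent-const 1ℚ (ℤₚ.≤-reflexive (sym deg-0))

    0≤1 : ∀ m → High w 1ℤ m → High w 0ℤ m
    0≤1 m = ℤₚ.≤-trans (ℤ.+≤+ ℕ.z≤n)

    1≤2 : ∀ m → High w (1ℤ ℤ.+ 1ℤ) m → High w 1ℤ m
    1≤2 m = ℤₚ.≤-trans (ℤ.+≤+ (ℕ.s≤s ℕ.z≤n))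

    K-high : Laurent (High w 0ℤ) (val ∘ K)
    K-high = laurent-+ 1-high (laurent-weaken 0≤1 κ-high)

    geom-high : ∀ N → Laurent (High w 0ℤ) (λ x → geom N (val (K x)))
    geom-high zero    = laurent-0
    geom-high (suc N) = laurent-+ 1-high (laurent-* (high-+ {0ℤ} {0ℤ}) K-high (geom-high N))

    Θ-high : Laurent (High w 1ℤ) Θ
    Θ-high = laurent-* (high-+ {1ℤ} {0ℤ}) (high-A^ (ℕ.pred p)) (geom-high q)

    Unital : (Point → ℚ) → Set
    Unital f = ∃ λ ω → Laurent (High w 1ℤ) ω × (∀ x → f x ≡ 1ℚ ℚ.+ ω x)

    unital-* : ∀ {f g} → Unital f → Unital g → Unital (λ x → f x ℚ.* g x)
    unital-* {f} {g} (ω , lω , e) (ω′ , lω′ , e′) = (λ x → ω x ℚ.* ω′ x ℚ.+ (ω x ℚ.+ ω′ x)) ,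
      laurent-+ (laurent-weaken 1≤2 (laurent-* (high-+ {1ℤ} {1ℤ}) lω lω′)) (laurent-+ lω lω′) ,
      λ x → trans (cong₂ ℚ._*_ (e x) (e′ x)) (lemma (ω x) (ω′ x))
      where
      lemma : ∀ o o′ → (1ℚ ℚ.+ o) ℚ.* (1ℚ ℚ.+ o′) ≡ 1ℚ ℚ.+ (o ℚ.* o′ ℚ.+ (o ℚ.+ o′))
      lemma = solve-ring ℚ-ring

    unital-qpow : ∀ {f} → Unital f → ∀ N → Unital (λ x → qpow (f x) N)
    unital-qpow u zero    = (λ _ → 0ℚ) , laurent-0 , λ _ → refl
    unital-qpow u (suc N) = unital-* u (unital-qpow u N)

    -- The coordinates of x₃ are monomials except for the factor `K` at k and `Ξ` at i, so powers of
    -- this product clear all denominators of x₃ and of its inverse.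
    Δ₃ : Point → ℚ
    Δ₃ x = val (K x) ℚ.* val (Ξ x)

    Δ₃-unital : Unital Δ₃
    Δ₃-unital = unital-* ((val ∘ κ) , κ-high , λ _ → refl) (Θ , Θ-high , Ξ-Θ)

    any : ∀ {P : Exponent → Set} {f} → Laurent P f → Laurent Any f
    any = laurent-weaken (λ _ _ → tt)

    A-laurent : Laurent Any (val ∘ A)
    A-laurent = any A-deg0
    K-laurent : Laurent Any (val ∘ K)
    K-laurent = any K-high
    Ξ-laurent : Laurent Any (val ∘ Ξ)
    Ξ-laurent = laurent-resp (λ x → sym (Ξ-Θ x)) (laurent-+ (laurent-const 1ℚ tt) (any Θ-high))
    Δ₃-laurent : Laurent Any Δ₃
    Δ₃-laurent = any-* K-laurent Ξ-laurent

    module F₁ = Fractions A-laurent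
    module F₃ = Fractions Δ₃-laurent

    x₁-fractions : ∀ l → Fraction (val ∘ A) (λ x → val (x₁ x l)) × Fraction (val ∘ A) (λ x → val (inv⁺ (x₁ x l)))
    x₁-fractions (inj₂ l) = monomial-fractions A-laurent {λ x → x (inj₂ l)} (monomial-coordinate (inj₂ l))
    x₁-fractions (inj₁ l) with l ≟ i
    ... | no _  = monomial-fractions A-laurent {λ x → x (inj₁ l)} (monomial-coordinate (inj₁ l))
    ... | yes _ = monomial-times A-laurent {λ x → exchange i B x} {λ x → ℤ.-1ℤ · x (inj₁ i) ∙ M⁻ i B x} {A} {λ _ → 1ℚ}
      (exchange-monomial i B) (λ x → sym (assoc (ℤ.-1ℤ · x (inj₁ i)) (M⁻ i B x) (A x))) A-laurent
      (laurent-const 1ℚ tt) (λ x → sym (ℚₚ.*-identityˡ (val (A x))))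

    mᵢ-monomial : Monomial mᵢ
    mᵢ-monomial = monomial-∙ {λ x → x (inj₁ i) ∙ inv⁺ (M⁻ i B x)} {λ x → M⁻ i B₂ x ∙ inv⁺ (Yᵢ x)}
      (monomial-∙ {λ x → x (inj₁ i)} {λ x → inv⁺ (M⁻ i B x)} (monomial-coordinate (inj₁ i)) (monomial-inv {M⁻ i B} (monomial-pair _)))
      (monomial-∙ {M⁻ i B₂} {λ x → inv⁺ (Yᵢ x)} (monomial-pair _) (monomial-inv {Yᵢ} (Ŷ-monomial i B)))

    x₃-fractions : ∀ l → Fraction Δ₃ (λ x → val (x₃ x l)) × Fraction Δ₃ (λ x → val (inv⁺ (x₃ x l)))
    x₃-fractions (inj₂ l) = monomial-fractions Δ₃-laurent {λ x → x (inj₂ l)} (monomial-coordinate (inj₂ l))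
    x₃-fractions (inj₁ l) = cases (l ≟ i) (l ≟ k)
      where
      cases : Dec (l ≡ i) → Dec (l ≡ k) → Fraction Δ₃ (λ x → val (x₃ x (inj₁ l))) × Fraction Δ₃ (λ x → val (inv⁺ (x₃ x (inj₁ l))))
      cases (yes refl) _ = monomial-times Δ₃-laurent {λ x → x₃ x (inj₁ i)} {mᵢ} {Ξ} {val ∘ K} mᵢ-monomial x₃-i Ξ-laurent K-laurent (λ _ → refl)
      cases _ (yes refl) = monomial-times Δ₃-laurent {λ x → x₃ x (inj₁ k)} {mₖ} {K} {val ∘ Ξ} (exchange-monomial k B₁) x₃-k K-laurent Ξ-laurent
        (λ x → ℚₚ.*-comm (val (K x)) (val (Ξ x)))
      cases (no l≢i) (no l≢k) = monomial-fractions Δ₃-laurent {λ x → x₃ x (inj₁ l)}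
        (proj₁ coord , λ x → trans (step-other i B₂ (x₂ x) (inj₁ l) (i≢ l≢i)) (trans (step-other k B₁ (x₁ x) (inj₁ l) (i≢ l≢k))
          (trans (step-other i B x (inj₁ l) (i≢ l≢i)) (proj₂ coord x))))
        where coord = monomial-coordinate (inj₁ l)

  laurent-from-both : ∀ {f g h} → Laurent Any g → Laurent Any h
    → (∀ x → f x ≡ g (x₁ x)) → (∀ x → f x ≡ h (x₃ x)) → Laurent Any f
  laurent-from-both {f} {g} {h} lg lh eg eh = hartogs {f} {λ x → Pow.pow (A x) N₁} {proj₁ unital}
    (laurent-resp (λ x → sym (val-pow (A x) N₁)) (A^-deg0 N₁)) (proj₁ (proj₂ unital))
    (laurent-resp (λ x → cong₂ ℚ._*_ (sym (eg x)) (sym (val-pow (A x) N₁))) (Fraction.numerator frac₁))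
    (laurent-resp (λ x → cong₂ ℚ._*_ (sym (eh x)) (proj₂ (proj₂ unital) x)) (Fraction.numerator frac₃))
    where
    frac₁ = F₁.fraction-subst x₁ (proj₁ ∘ x₁-fractions) (proj₂ ∘ x₁-fractions) lg
    frac₃ = F₃.fraction-subst x₃ (proj₁ ∘ x₃-fractions) (proj₂ ∘ x₃-fractions) lh
    N₁ = Fraction.exponent frac₁
    unital = unital-qpow Δ₃-unital (Fraction.exponent frac₃)

-- The Laurent phenomenon for the binomial relations

module LaurentPhenomenon {n : ℕ} (D : GenFixedData n) where
  open Mutation D
  open GoodMatrices D
  open Good
  open Laurent n
  open Denominators D
  open Seeds D positiveRationals

  -- From the seed at i the rest of the path i, k, ks is k, ks; from the seed at i, k, i it is i,
  -- ks, because mutating at i goes back to i, k. Both are shorter by one, but the second is no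
  -- sublist, so the induction runs over a length bound.
  run-laurent : ∀ N ks → length ks ℕ.≤ N → ∀ {B} → Good B → ∀ l → Laurent Any (λ x → val (run ks B x l))
  run-laurent _ []       _ gB l = monomial-laurent (monomial-coordinate l)
  run-laurent _ (i ∷ []) _ {B} gB l = step-laurent i B l
  run-laurent (suc N) (i ∷ k ∷ ks) (ℕ.s≤s le) {B} gB l = cases (i ≟ k)
    where
    main : i ≢ k → ∀ {B} → Good B → 0ℤ ≤ B i (inj₁ k) → Laurent Any (λ x → val (run (i ∷ k ∷ ks) B x l))
    main i≢k {B} gB c≥0 = laurent-from-both
      (run-laurent N (k ∷ ks) le gB₁ l)
      (run-laurent N (i ∷ ks) le (good-μ i gB₂) l)
      (λ x → refl)
      (λ x → cong val (sym (run-cong ks (μ-involutive i B₂ (diag gB₂ i)) (step-involutive i (x₂ x) (diag gB₂ i)) l)))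
      where
      open RankTwo D gB i≢k c≥0
      gB₁ = good-μ i gB
      gB₂ = good-μ k gB₁
    cases : Dec (i ≡ k) → Laurent Any (λ x → val (run (i ∷ k ∷ ks) B x l))
    cases (yes refl) = laurent-resp
      (λ x → cong val (sym (run-cong ks (μ-involutive i B (diag gB i)) (step-involutive i x (diag gB i)) l)))
      (run-laurent N ks (ℕₚ.<⇒≤ le) gB l)
    cases (no i≢k) with ℤₚ.≤-total 0ℤ (B i (inj₁ k))
    ... | inj₁ c≥0 = main i≢k gB c≥0
    ... | inj₂ c≤0 = laurent-resp (λ x → cong val (run-neg (i ∷ k ∷ ks) B x l))
      (main i≢k (good-neg gB) (neg-nonpos c≤0))

  laurent-phenomenon : ∀ ks {B} → Good B → ∀ l → Laurent Any (λ x → val (run ks B x l))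
  laurent-phenomenon ks = run-laurent (length ks) ks ℕₚ.≤-refl

-- Exact rates of decay and superadditivity

Bounded⁺ : (ℕ → ℚ⁺) → Set
Bounded⁺ u = ∃ λ C → ∀ N → val (u N) ℚ.≤ C × val (inv⁺ (u N)) ℚ.≤ C

inv-antitone : ∀ y z → val y ℚ.≤ val z → val (inv⁺ z) ℚ.≤ val (inv⁺ y)
inv-antitone y z le = begin
  val (inv⁺ z)                                    ≡⟨ sym (ℚₚ.*-identityˡ (val (inv⁺ z))) ⟩
  1ℚ ℚ.* val (inv⁺ z)                             ≡⟨ cong (ℚ._* val (inv⁺ z)) (sym (val-inv y)) ⟩
  (val y ℚ.* val (inv⁺ y)) ℚ.* val (inv⁺ z)       ≡⟨ lemma (val y) (val (inv⁺ y)) (val (inv⁺ z)) ⟩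
  (val (inv⁺ y) ℚ.* val (inv⁺ z)) ℚ.* val y       ≤⟨ *-monoˡ _ (*-nonNeg (val-nonNeg (inv⁺ y)) (val-nonNeg (inv⁺ z))) le ⟩
  (val (inv⁺ y) ℚ.* val (inv⁺ z)) ℚ.* val z       ≡⟨ lemma′ (val (inv⁺ y)) (val (inv⁺ z)) (val z) ⟩
  val (inv⁺ y) ℚ.* (val z ℚ.* val (inv⁺ z))       ≡⟨ cong (val (inv⁺ y) ℚ.*_) (val-inv z) ⟩
  val (inv⁺ y) ℚ.* 1ℚ                             ≡⟨ ℚₚ.*-identityʳ (val (inv⁺ y)) ⟩
  val (inv⁺ y)                                    ∎
  where
  open ℚₚ.≤-Reasoning
  lemma : ∀ a b c → (a ℚ.* b) ℚ.* c ≡ (b ℚ.* c) ℚ.* a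
  lemma = solve-ring ℚ-ring
  lemma′ : ∀ a b c → (a ℚ.* b) ℚ.* c ≡ a ℚ.* (c ℚ.* b)
  lemma′ = solve-ring ℚ-ring

*-mono-val : ∀ {C C′} x y → val x ℚ.≤ C → val y ℚ.≤ C′ → val (x *⁺ y) ℚ.≤ C ℚ.* C′
*-mono-val {C} x y p q = ℚₚ.≤-trans (*-monoʳ (val y) (val-nonNeg y) p) (*-monoˡ C (ℚₚ.≤-trans (val-nonNeg x) p) q)

bounded⁺-∙ : ∀ {u v} → Bounded⁺ u → Bounded⁺ v → Bounded⁺ (λ N → u N *⁺ v N)
bounded⁺-∙ {u} {v} (C , p) (C′ , q) = C ℚ.* C′ , λ N → *-mono-val (u N) (v N) (proj₁ (p N)) (proj₁ (q N)) ,
  subst (λ z → val z ℚ.≤ C ℚ.* C′) (sym (Pow.inv-∙ (u N) (v N))) (*-mono-val (inv⁺ (u N)) (inv⁺ (v N)) (proj₂ (p N)) (proj₂ (q N)))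

bounded⁺-inv : ∀ {u} → Bounded⁺ u → Bounded⁺ (inv⁺ ∘ u)
bounded⁺-inv {u} (C , p) = C , λ N → proj₂ (p N) , subst (λ z → val z ℚ.≤ C) (sym (Pow.inv-inv (u N))) (proj₁ (p N))

bounded⁺-const : ∀ x → Bounded⁺ (λ _ → x)
bounded⁺-const x = val x ℚ.+ val (inv⁺ x) , λ _ → ≤-add-nonNeg (val-nonNeg (inv⁺ x)) ,
  subst (val (inv⁺ x) ℚ.≤_) (ℚₚ.+-comm (val (inv⁺ x)) (val x)) (≤-add-nonNeg (val-nonNeg x))

bounded⁺-pow : ∀ {u} → Bounded⁺ u → ∀ m → Bounded⁺ (λ N → Pow.pow (u N) m)
bounded⁺-pow bu zero    = bounded⁺-const 1⁺
bounded⁺-pow {u} bu (suc m) = bounded⁺-∙ {u} {λ N → Pow.pow (u N) m} bu (bounded⁺-pow {u} bu m)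

bounded⁺-· : ∀ a {u} → Bounded⁺ u → Bounded⁺ (λ N → a Pow.· u N)
bounded⁺-· (+ m)    {u} bu = bounded⁺-pow {u} bu m
bounded⁺-· -[1+ m ] {u} bu = bounded⁺-pow {inv⁺ ∘ u} (bounded⁺-inv {u} bu) (suc m)

-- X N = 2^(-Ne) up to bounded factors.
record _≍_ (X : ℕ → ℚ⁺) (e : ℤ) : Set where
  constructor mk≍
  field
    factor  : ℕ → ℚ⁺
    bounded : Bounded⁺ factor
    equals  : ∀ N → X N ≡ factor N *⁺ T (+ N ℤ.* e)

T-· : ∀ a N e → a Pow.· T (+ N ℤ.* e) ≡ T (+ N ℤ.* (a ℤ.* e))
T-· a N e = begin
  a Pow.· T (+ N ℤ.* e)                 ≡⟨ cong (a Pow.·_) (T-def (+ N ℤ.* e)) ⟩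
  a Pow.· (+ N ℤ.* e) Pow.· ½⁺          ≡⟨ sym (Pow.·-* a (+ N ℤ.* e) ½⁺) ⟩
  (a ℤ.* (+ N ℤ.* e)) Pow.· ½⁺          ≡⟨ cong (Pow._· ½⁺) (lemma a (+ N) e) ⟩
  (+ N ℤ.* (a ℤ.* e)) Pow.· ½⁺          ≡⟨ sym (T-def _) ⟩
  T (+ N ℤ.* (a ℤ.* e))                 ∎
  where
  open ≡-Reasoning
  lemma : ∀ a b c → a ℤ.* (b ℤ.* c) ≡ b ℤ.* (a ℤ.* c)
  lemma = solve-∀

≍-∙ : ∀ {X Y e e′} → X ≍ e → Y ≍ e′ → (λ N → X N *⁺ Y N) ≍ (e ℤ.+ e′)
≍-∙ {X} {Y} {e} {e′} (mk≍ u bu p) (mk≍ v bv q) = mk≍ (λ N → u N *⁺ v N) (bounded⁺-∙ {u} {v} bu bv)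
  (λ N → trans (cong₂ _*⁺_ (p N) (q N)) (trans (Pow.interchange (u N) (T (+ N ℤ.* e)) (v N) (T (+ N ℤ.* e′)))
    (cong ((u N *⁺ v N) *⁺_) (trans (sym (T-+ (+ N ℤ.* e) (+ N ℤ.* e′))) (cong T (sym (ℤₚ.*-distribˡ-+ (+ N) e e′)))))))

≍-· : ∀ a {X e} → X ≍ e → (λ N → a Pow.· X N) ≍ (a ℤ.* e)
≍-· a {X} {e} (mk≍ u bu p) = mk≍ (λ N → a Pow.· u N) (bounded⁺-· a {u} bu)
  (λ N → trans (cong (a Pow.·_) (p N)) (trans (Pow.·-∙ a (u N) (T (+ N ℤ.* e))) (cong ((a Pow.· u N) *⁺_) (T-· a N e))))

≍-const : ∀ x → (λ _ → x) ≍ 0ℤ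
≍-const x = mk≍ (λ _ → x) (bounded⁺-const x)
  (λ N → sym (trans (cong (x *⁺_) (trans (cong T (ℤₚ.*-zeroʳ (+ N))) T-0)) (Pow.identityʳ x)))

-- Two positive terms cannot cancel, so the slower decay wins. For e ≥ 0 the sum lies between 1 and
-- 1 + C; for e ≤ 0 its quotient by 2^(-Ne) lies between the bounded factor u and 1 + C.
≍-φ : ∀ {X e} → X ≍ e → (λ N → 1+⁺ (X N)) ≍ (0ℤ ℤ.⊓ e)
≍-φ {X} {e} (mk≍ u (C , bd) p) with ℤₚ.≤-total 0ℤ e
... | inj₁ e≥0 = subst ((λ N → 1+⁺ (X N)) ≍_) (sym (ℤₚ.i≤j⇒i⊓j≡i e≥0))
  (mk≍ (λ N → 1+⁺ (X N)) (1ℚ ℚ.+ C , bound) (λ N → sym (trans (cong (1+⁺ (X N) *⁺_) (trans (cong T (ℤₚ.*-zeroʳ (+ N))) T-0)) (Pow.identityʳ (1+⁺ (X N))))))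
  where
  X≤C : ∀ N → val (X N) ℚ.≤ C
  X≤C N = ℚₚ.≤-trans (ℚₚ.≤-reflexive (cong val (p N))) (ℚₚ.≤-trans
    (*-mono-val (u N) (T (+ N ℤ.* e)) (proj₁ (bd N)) (T-≤1 (subst (_≤ + N ℤ.* e) (ℤₚ.*-zeroʳ (+ N)) (ℤₚ.*-monoˡ-≤-nonNeg (+ N) e≥0))))
    (ℚₚ.≤-reflexive (ℚₚ.*-identityʳ C)))
  C≥0 : 0ℚ ℚ.≤ C
  C≥0 = ℚₚ.≤-trans (val-nonNeg (X 0)) (X≤C 0)
  bound : ∀ N → val (1+⁺ (X N)) ℚ.≤ 1ℚ ℚ.+ C × val (inv⁺ (1+⁺ (X N))) ℚ.≤ 1ℚ ℚ.+ C
  bound N = ℚₚ.+-monoʳ-≤ 1ℚ (X≤C N) , ℚₚ.≤-trans (inv-antitone 1⁺ (1+⁺ (X N)) (≤-add-nonNeg (val-nonNeg (X N)))) (≤-add-nonNeg C≥0)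
... | inj₂ e≤0 = subst ((λ N → 1+⁺ (X N)) ≍_) (sym (ℤₚ.i≥j⇒i⊓j≡j e≤0)) (mk≍ u′ (1ℚ ℚ.+ C , bound) eq)
  where
  T⁻ : ℕ → ℚ⁺
  T⁻ N = T (+ N ℤ.* (ℤ.- e))
  cancel : ∀ N → T (+ N ℤ.* e) *⁺ T⁻ N ≡ 1⁺
  cancel N = trans (sym (T-+ (+ N ℤ.* e) (+ N ℤ.* (ℤ.- e)))) (trans (cong T (lemma (+ N) e)) T-0)
    where
    lemma : ∀ N e → N ℤ.* e ℤ.+ N ℤ.* (ℤ.- e) ≡ 0ℤ
    lemma = solve-∀
  cancel′ : ∀ N → T⁻ N *⁺ T (+ N ℤ.* e) ≡ 1⁺
  cancel′ N = trans (ℚ⁺-≡ (ℚₚ.*-comm (val (T⁻ N)) (val (T (+ N ℤ.* e))))) (cancel N)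
  u′ : ℕ → ℚ⁺
  u′ N = 1+⁺ (X N) *⁺ T⁻ N
  eq : ∀ N → 1+⁺ (X N) ≡ u′ N *⁺ T (+ N ℤ.* e)
  eq N = sym (trans (ℚ⁺-≡ (ℚₚ.*-assoc (val (1+⁺ (X N))) (val (T⁻ N)) (val (T (+ N ℤ.* e)))))
    (trans (cong (1+⁺ (X N) *⁺_) (cancel′ N)) (Pow.identityʳ (1+⁺ (X N)))))
  val-u′ : ∀ N → val (u′ N) ≡ val (T⁻ N) ℚ.+ val (u N)
  val-u′ N = begin
    (1ℚ ℚ.+ val (X N)) ℚ.* val (T⁻ N)                              ≡⟨ cong (λ v → (1ℚ ℚ.+ val v) ℚ.* val (T⁻ N)) (p N) ⟩
    (1ℚ ℚ.+ val (u N) ℚ.* val (T (+ N ℤ.* e))) ℚ.* val (T⁻ N)      ≡⟨ lemma (val (u N)) (val (T (+ N ℤ.* e))) (val (T⁻ N)) ⟩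
    val (T⁻ N) ℚ.+ val (u N) ℚ.* (val (T (+ N ℤ.* e)) ℚ.* val (T⁻ N)) ≡⟨ cong (λ v → val (T⁻ N) ℚ.+ val (u N) ℚ.* val v) (cancel N) ⟩
    val (T⁻ N) ℚ.+ val (u N) ℚ.* 1ℚ                                ≡⟨ cong (val (T⁻ N) ℚ.+_) (ℚₚ.*-identityʳ (val (u N))) ⟩
    val (T⁻ N) ℚ.+ val (u N)                                       ∎
    where
    open ≡-Reasoning
    lemma : ∀ u t s → (1ℚ ℚ.+ u ℚ.* t) ℚ.* s ≡ s ℚ.+ u ℚ.* (t ℚ.* s)
    lemma = solve-ring ℚ-ring
  T⁻≤1 : ∀ N → val (T⁻ N) ℚ.≤ 1ℚ
  T⁻≤1 N = T-≤1 (subst (_≤ + N ℤ.* (ℤ.- e)) (ℤₚ.*-zeroʳ (+ N)) (ℤₚ.*-monoˡ-≤-nonNeg (+ N) (neg-nonpos e≤0)))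
  bound : ∀ N → val (u′ N) ℚ.≤ 1ℚ ℚ.+ C × val (inv⁺ (u′ N)) ℚ.≤ 1ℚ ℚ.+ C
  bound N = ℚₚ.≤-trans (ℚₚ.≤-reflexive (val-u′ N)) (ℚₚ.+-mono-≤ (T⁻≤1 N) (proj₁ (bd N))) ,
    ℚₚ.≤-trans (inv-antitone (u N) (u′ N) (ℚₚ.≤-trans
        (subst (val (u N) ℚ.≤_) (ℚₚ.+-comm (val (u N)) (val (T⁻ N))) (≤-add-nonNeg (val-nonNeg (T⁻ N))))
        (ℚₚ.≤-reflexive (sym (val-u′ N)))))
      (ℚₚ.≤-trans (proj₂ (bd N)) (subst (C ℚ.≤_) (ℚₚ.+-comm C 1ℚ) (≤-add-nonNeg {C} (ℚₚ.nonNegative⁻¹ 1ℚ))))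

module Superadditivity {n : ℕ} (D : GenFixedData n) where
  open Mutation D
  open GoodMatrices D
  open Laurent n
  open LaurentPhenomenon D
  module Q where
    open Pairing positiveRationals public
    open Seeds D positiveRationals public
  module E = Seeds D tropical

  ≍-pairFin : ∀ {k} (m : Fin k → ℤ) {X : ℕ → Fin k → ℚ⁺} {e} → (∀ l → (λ N → X N l) ≍ e l)
    → (λ N → Q.pairFin m (X N)) ≍ Trop.pairFin m e
  ≍-pairFin {zero}  m h = ≍-const 1⁺
  ≍-pairFin {suc k} m h = ≍-∙ (≍-· (m zero) (h zero)) (≍-pairFin (m ∘ suc) (h ∘ suc))

  ≍-resp : ∀ {X Y e e′} → (∀ N → X N ≡ Y N) → e ≡ e′ → X ≍ e → Y ≍ e′
  ≍-resp p refl (mk≍ u bu q) = mk≍ u bu (λ N → trans (sym (p N)) (q N))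

  module _ {X : ℕ → Idx n → ℚ⁺} {e : Idx n → ℤ} where
    ≍-pair : ∀ m → (∀ l → (λ N → X N l) ≍ e l) → (λ N → Q.pair m (X N)) ≍ ⟨ m , e ⟩
    ≍-pair m h = ≍-resp (λ N → sym (Q.pair-def m (X N))) (sym (Trop.pair-def m e))
      (≍-∙ (≍-pairFin (m ∘ inj₁) {λ N → X N ∘ inj₁} (h ∘ inj₁)) (≍-pairFin (m ∘ inj₂) {λ N → X N ∘ inj₂} (h ∘ inj₂)))

    ≍-step : ∀ k B → (∀ l → (λ N → X N l) ≍ e l) → ∀ l → (λ N → Q.step k B (X N) l) ≍ E.step k B e l
    ≍-step k B h (inj₂ l) = h (inj₂ l)
    ≍-step k B h (inj₁ l) with l ≟ k
    ... | no _  = h (inj₁ l)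
    ... | yes _ = ≍-∙ (≍-· ℤ.-1ℤ (h (inj₁ k))) (≍-∙ (≍-pair _ h) (≍-φ (≍-· (R k) (≍-pair (B k) h))))

  -- The bounds are two-sided: the upper one restricts exponents, and the lower one makes an
  -- excessive rate of decay contradictory.
  ≍-run : ∀ ks B {X : ℕ → Idx n → ℚ⁺} {e : Idx n → ℤ} → (∀ l → (λ N → X N l) ≍ e l) → ∀ l → (λ N → Q.run ks B (X N) l) ≍ E.run ks B e l
  ≍-run []       B h = h
  ≍-run (k ∷ ks) B {X} {e} h = ≍-run ks (μ k B) {λ N → Q.step k B (X N)} {E.step k B e} (≍-step {X} {e} k B h)

  ≍-scale : ∀ w x l → (λ N → scale N w x l) ≍ w l
  ≍-scale w x l = mk≍ (λ _ → x l) (bounded⁺-const (x l)) (λ N → ℚ⁺-≡ (ℚₚ.*-comm (val (T (+ N ℤ.* w l))) (val (x l))))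

  module _ (ks : List (Fin n)) {B : ExtMat n} (gB : Good B) (l : Idx n) where

    private
      f : Point → ℚ
      f x = val (Q.run ks B x l)

      exact : ∀ w x → (λ N → Q.run ks B (scale N w x) l) ≍ E.run ks B w l
      exact w x = ≍-run ks B {λ N → scale N w x} {w} (≍-scale w x) l

      f-decays : ∀ w x → Decays f w (E.run ks B w l) x
      f-decays w x = C , λ N → begin
        ℚ.∣ f (scale N w x) ∣                            ≡⟨ ℚₚ.0≤p⇒∣p∣≡p (val-nonNeg (Q.run ks B (scale N w x) l)) ⟩
        f (scale N w x)                                  ≡⟨ cong val (_≍_.equals (exact w x) N) ⟩
        val (u N) ℚ.* val (T (+ N ℤ.* e))                ≤⟨ *-monoʳ _ (val-nonNeg (T (+ N ℤ.* e))) (proj₁ (proj₂ (_≍_.bounded (exact w x)) N)) ⟩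
        C ℚ.* val (T (+ N ℤ.* e))                        ≡⟨ cong (λ v → C ℚ.* val v) (T-* N e) ⟩
        C ℚ.* val (Pow.pow (T e) N)                      ∎
        where
        open ℚₚ.≤-Reasoning
        e = E.run ks B w l
        u = _≍_.factor (exact w x)
        C = proj₁ (_≍_.bounded (exact w x))

      one : Point
      one _ = 1⁺

    -- The exponents of f satisfy m · w ≥ E(w) for both w₁ and w₂, hence f decays
    -- at least as fast as 2^(-N(E(w₁) + E(w₂))) along w₁ + w₂.
    superadditive : ∀ w₁ w₂ → E.run ks B w₁ l ℤ.+ E.run ks B w₂ l ≤ E.run ks B (λ j → w₁ j ℤ.+ w₂ j) l
    superadditive w₁ w₂ = ℤₚ.≮⇒≥ contradiction
      where
      w = λ j → w₁ j ℤ.+ w₂ j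
      e₁₂ = E.run ks B w₁ l ℤ.+ E.run ks B w₂ l
      e = E.run ks B w l
      high : Laurent (High w e₁₂) f
      high = laurent-weaken
        (λ m pm → subst (e₁₂ ≤_) (sym (Trop.pair-∙ m w₁ w₂)) (ℤₚ.+-mono-≤ (proj₂ (proj₁ pm)) (proj₂ pm)))
        (decaying-high {w = w₂} (decaying-high {w = w₁} (laurent-phenomenon ks gB l) (f-decays w₁)) (f-decays w₂))
      decay = high-decays high one
      u = _≍_.factor (exact w one)
      C′ = proj₁ (_≍_.bounded (exact w one))
      C = proj₁ decay
      -- 2^(-Na) compares the exact rate e with the upper bound of rate e₁₂, so it stays bounded. A
      -- negative `a` would make it grow geometrically.
      a = e ℤ.+ ℤ.- e₁₂
      seq : ℕ → ℚ
      seq N = val (Pow.pow (T a) N)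
      seq-eq : ∀ N → Pow.pow (T a) N ≡ (Q.run ks B (scale N w one) l *⁺ inv⁺ (u N)) *⁺ T (+ N ℤ.* (ℤ.- e₁₂))
      seq-eq N = begin
        Pow.pow (T a) N                                   ≡⟨ sym (T-* N a) ⟩
        T (+ N ℤ.* a)                                     ≡⟨ cong T (ℤₚ.*-distribˡ-+ (+ N) e (ℤ.- e₁₂)) ⟩
        T (+ N ℤ.* e ℤ.+ + N ℤ.* (ℤ.- e₁₂))               ≡⟨ T-+ (+ N ℤ.* e) (+ N ℤ.* (ℤ.- e₁₂)) ⟩
        T (+ N ℤ.* e) *⁺ T (+ N ℤ.* (ℤ.- e₁₂))            ≡⟨ cong (_*⁺ T (+ N ℤ.* (ℤ.- e₁₂))) (sym (begin
          Q.run ks B (scale N w one) l *⁺ inv⁺ (u N)        ≡⟨ cong (_*⁺ inv⁺ (u N)) (_≍_.equals (exact w one) N) ⟩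
          (u N *⁺ T (+ N ℤ.* e)) *⁺ inv⁺ (u N)              ≡⟨ ℚ⁺-≡ (lemma (val (u N)) (val (T (+ N ℤ.* e))) (val (inv⁺ (u N)))) ⟩
          T (+ N ℤ.* e) *⁺ (u N *⁺ inv⁺ (u N))              ≡⟨ cong (T (+ N ℤ.* e) *⁺_) (inv⁺-inverse (u N)) ⟩
          T (+ N ℤ.* e) *⁺ 1⁺                               ≡⟨ Pow.identityʳ (T (+ N ℤ.* e)) ⟩
          T (+ N ℤ.* e)                                     ∎)) ⟩
        (Q.run ks B (scale N w one) l *⁺ inv⁺ (u N)) *⁺ T (+ N ℤ.* (ℤ.- e₁₂)) ∎
        where
        open ≡-Reasoning
        lemma : ∀ a b c → (a ℚ.* b) ℚ.* c ≡ b ℚ.* (a ℚ.* c)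
        lemma = solve-ring ℚ-ring
      f≤ : ∀ N → f (scale N w one) ℚ.≤ C ℚ.* val (T (+ N ℤ.* e₁₂))
      f≤ N = subst₂ ℚ._≤_ (ℚₚ.0≤p⇒∣p∣≡p (val-nonNeg (Q.run ks B (scale N w one) l)))
        (cong (λ v → C ℚ.* val v) (sym (T-* N e₁₂))) (proj₂ decay N)
      cancel : ∀ N → T (+ N ℤ.* e₁₂) *⁺ T (+ N ℤ.* (ℤ.- e₁₂)) ≡ 1⁺
      cancel N = trans (sym (T-+ (+ N ℤ.* e₁₂) (+ N ℤ.* (ℤ.- e₁₂)))) (trans (cong T (lemma (+ N) e₁₂)) T-0)
        where
        lemma : ∀ N e → N ℤ.* e ℤ.+ N ℤ.* (ℤ.- e) ≡ 0ℤ
        lemma = solve-∀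
      bound : ∀ N → ℚ.∣ seq N ∣ ℚ.≤ C ℚ.* C′
      bound N = begin
        ℚ.∣ seq N ∣                                      ≡⟨ ℚₚ.0≤p⇒∣p∣≡p (val-nonNeg (Pow.pow (T a) N)) ⟩
        seq N                                            ≡⟨ cong val (seq-eq N) ⟩
        (F ℚ.* v) ℚ.* t                                  ≡⟨ lemma F v t ⟩
        F ℚ.* (v ℚ.* t)                                  ≤⟨ *-monoʳ (v ℚ.* t) (*-nonNeg (val-nonNeg (inv⁺ (u N))) (val-nonNeg (T (+ N ℤ.* (ℤ.- e₁₂))))) (f≤ N) ⟩
        (C ℚ.* s) ℚ.* (v ℚ.* t)                          ≡⟨ lemma′ C s v t ⟩
        (C ℚ.* v) ℚ.* (s ℚ.* t)                          ≡⟨ trans (cong (λ z → (C ℚ.* v) ℚ.* val z) (cancel N)) (ℚₚ.*-identityʳ (C ℚ.* v)) ⟩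
        C ℚ.* v                                          ≤⟨ *-monoˡ C C≥0 (proj₂ (proj₂ (_≍_.bounded (exact w one)) N)) ⟩
        C ℚ.* C′                                         ∎
        where
        open ℚₚ.≤-Reasoning
        F = f (scale N w one)
        v = val (inv⁺ (u N))
        t = val (T (+ N ℤ.* (ℤ.- e₁₂)))
        s = val (T (+ N ℤ.* e₁₂))
        lemma : ∀ a b c → (a ℚ.* b) ℚ.* c ≡ a ℚ.* (b ℚ.* c)
        lemma = solve-ring ℚ-ring
        lemma′ : ∀ C s v t → (C ℚ.* s) ℚ.* (v ℚ.* t) ≡ (C ℚ.* v) ℚ.* (s ℚ.* t)
        lemma′ = solve-ring ℚ-ring
        C≥0 : 0ℚ ℚ.≤ C
        C≥0 = ℚₚ.≤-trans (ℚₚ.0≤∣p∣ _) (ℚₚ.≤-trans (proj₂ decay 0) (ℚₚ.≤-reflexive (ℚₚ.*-identityʳ C)))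
      contradiction : ¬ (e ℤ.< e₁₂)
      contradiction lt = ℚₚ.1≢0 (geometric-bounded seq (T a)
        (T-≥2 (subst (a ℤ.<_) (ℤₚ.+-inverseʳ e₁₂) (ℤₚ.+-monoˡ-< (ℤ.- e₁₂) lt))) (λ _ → refl) (C ℚ.* C′ , bound) 0)

-- Weights invisible to the ŷ-variables, and the bend across a wall

module Kernel {n : ℕ} (D : GenFixedData n) where
  open Mutation D
  open GoodMatrices D
  open Good
  open Seeds D tropical

  Weight : Set
  Weight = Idx n → ℤ

  infixl 6 _⊞_
  infixr 7 _⊙_

  _⊞_ : Weight → Weight → Weight
  (v ⊞ w) l = v l ℤ.+ w l

  _⊙_ : ℤ → Weight → Weight
  (a ⊙ v) l = a ℤ.* v l

  frozen : (Fin n → ℤ) → Weight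
  frozen y (inj₁ _) = 0ℤ
  frozen y (inj₂ a) = y a

  dot : (Fin n → ℤ) → (Fin n → ℤ) → ℤ
  dot = Trop.pairFin

  unit : Fin n → Fin n → ℤ
  unit a b = δ a (inj₁ b)

  unit-other : ∀ {a b} → b ≢ a → unit a b ≡ 0ℤ
  unit-other {a} {b} ne = δ-other a (inj₁ b) (λ { refl → ne refl })

  dot-unitʳ : ∀ c a → dot c (unit a) ≡ c a
  dot-unitʳ c a = trans (Trop.pairFin-single a c (unit a) (λ b ne → inj₂ (unit-other ne)))
    (trans (cong (c a ℤ.*_) (δ-same a)) (ℤₚ.*-identityʳ (c a)))

  dot-unitˡ : ∀ a y → dot (unit a) y ≡ y a
  dot-unitˡ a y = trans (Trop.pairFin-single a (unit a) y (λ b ne → inj₁ (unit-other ne)))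
    (trans (cong (ℤ._* y a) (δ-same a)) (ℤₚ.*-identityˡ (y a)))

  pair-frozen : ∀ m y → ⟨ m , frozen y ⟩ ≡ dot (m ∘ inj₂) y
  pair-frozen m y = trans (Trop.pair-def m (frozen y))
    (trans (cong (ℤ._+ dot (m ∘ inj₂) y) (Trop.pairFin-ε (m ∘ inj₁) (λ _ → 0ℤ) (λ _ → inj₂ refl))) (ℤₚ.+-identityˡ _))

  -- The one-parameter subgroups of the seed torus that fix every ŷ-variable. The torus of N° acts
  -- through such weights, by `κ-ker`.
  Ker : ExtMat n → Weight → Set
  Ker B v = ∀ c → ⟨ B c , v ⟩ ≡ 0ℤ

  ker-step : ∀ k {B v} → Good B → Ker B v → Ker (μ k B) (step k B v)
  ker-step k {B} {v} gB kv c with c ≟ k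
  ... | yes refl = trans (Trop.pair-cong (λ l → sym (μ-same k B l)) (λ _ → refl)) (trans (ŷ-step-same k v (diag gB k)) (cong (ℤ.-1ℤ ℤ.*_) (kv k)))
  ... | no ne = trans (Trop.pair-cong (λ l → sym (μ-other k B ne l)) (λ _ → refl)) (trans (ŷ-step-other k v (diag gB k) ne)
    (trans (cong₂ (λ p q → p ℤ.+ ((R k ℤ.* B c (inj₁ k) ⁺) ℤ.* q ℤ.+ (ℤ.- B c (inj₁ k)) ℤ.* (0ℤ ℤ.⊓ (R k ℤ.* q)))) (kv c) (kv k))
           (trans (cong (λ q → 0ℤ ℤ.+ ((R k ℤ.* B c (inj₁ k) ⁺) ℤ.* 0ℤ ℤ.+ (ℤ.- B c (inj₁ k)) ℤ.* (0ℤ ℤ.⊓ q))) (ℤₚ.*-zeroʳ (R k)))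
                  (lemma (R k ℤ.* B c (inj₁ k) ⁺) (ℤ.- B c (inj₁ k))))))
    where
    lemma : ∀ a b → 0ℤ ℤ.+ (a ℤ.* 0ℤ ℤ.+ b ℤ.* 0ℤ) ≡ 0ℤ
    lemma = solve-∀

  pair-comb : ∀ m a w v → ⟨ m , w ⊞ a ⊙ v ⟩ ≡ ⟨ m , w ⟩ ℤ.+ a ℤ.* ⟨ m , v ⟩
  pair-comb m a w v = trans (Trop.pair-∙ m w (a ⊙ v)) (cong (λ q → ⟨ m , w ⟩ ℤ.+ q) (Trop.pair-· a m v))

  -- On a kernel vector the two monomials of every exchange relation agree.
  exchange-ker : ∀ k {B v} → Ker B v → exchange k B v ≡ ℤ.-1ℤ ℤ.* v (inj₁ k) ℤ.+ M⁻ k B v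
  exchange-ker k {B} {v} kv = cong (λ q → ℤ.-1ℤ ℤ.* v (inj₁ k) ℤ.+ q)
    (trans (cong (λ q → M⁻ k B v ℤ.+ (0ℤ ℤ.⊓ q)) (trans (cong (R k ℤ.*_) (kv k)) (ℤₚ.*-zeroʳ (R k)))) (ℤₚ.+-identityʳ _))

  -- Adding a kernel vector leaves `Ŷ`, and with it the piecewise linear term min(0 , Ŷ), unchanged;
  -- all other terms are linear.
  step-linear : ∀ k {B v} → Ker B v → ∀ a w → step k B (w ⊞ a ⊙ v) ≗ step k B w ⊞ a ⊙ step k B v
  step-linear k {B} {v} kv a w (inj₂ l) = refl
  step-linear k {B} {v} kv a w (inj₁ l) with l ≟ k
  ... | no _  = refl
  ... | yes _ = begin
    ℤ.-1ℤ ℤ.* (w (inj₁ k) ℤ.+ a ℤ.* v (inj₁ k)) ℤ.+ (M⁻ k B (w ⊞ a ⊙ v) ℤ.+ (0ℤ ℤ.⊓ (R k ℤ.* ⟨ B k , w ⊞ a ⊙ v ⟩)))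
      ≡⟨ cong₂ (λ p q → ℤ.-1ℤ ℤ.* (w (inj₁ k) ℤ.+ a ℤ.* v (inj₁ k)) ℤ.+ (p ℤ.+ (0ℤ ℤ.⊓ (R k ℤ.* q))))
           (pair-comb _ a w v)
           (trans (pair-comb (B k) a w v) (trans (cong (λ p → ⟨ B k , w ⟩ ℤ.+ a ℤ.* p) (kv k))
             (trans (cong (λ q → ⟨ B k , w ⟩ ℤ.+ q) (ℤₚ.*-zeroʳ a)) (ℤₚ.+-identityʳ _)))) ⟩
    ℤ.-1ℤ ℤ.* (w (inj₁ k) ℤ.+ a ℤ.* v (inj₁ k)) ℤ.+ ((M⁻ k B w ℤ.+ a ℤ.* M⁻ k B v) ℤ.+ (0ℤ ℤ.⊓ (R k ℤ.* ⟨ B k , w ⟩)))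
      ≡⟨ lemma (w (inj₁ k)) a (v (inj₁ k)) (M⁻ k B w) (M⁻ k B v) (0ℤ ℤ.⊓ (R k ℤ.* ⟨ B k , w ⟩)) ⟩
    exchange k B w ℤ.+ a ℤ.* (ℤ.-1ℤ ℤ.* v (inj₁ k) ℤ.+ M⁻ k B v)
      ≡⟨ cong (λ p → exchange k B w ℤ.+ a ℤ.* p) (sym (exchange-ker k {B} {v} kv)) ⟩
    exchange k B w ℤ.+ a ℤ.* exchange k B v ∎
    where
    open ≡-Reasoning
    lemma : ∀ x a v m m′ z → ℤ.-1ℤ ℤ.* (x ℤ.+ a ℤ.* v) ℤ.+ ((m ℤ.+ a ℤ.* m′) ℤ.+ z)
      ≡ (ℤ.-1ℤ ℤ.* x ℤ.+ (m ℤ.+ z)) ℤ.+ a ℤ.* (ℤ.-1ℤ ℤ.* v ℤ.+ m′)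
    lemma = solve-∀

  -- The two arguments lie on opposite sides of the wall of j, where min(0 , ·) contributes 0 and
  -- -r_j S, but their sum lies on it. Adding the images therefore corresponds, before the mutation,
  -- to the sum corrected by r_j S in coordinate j.
  step-bend : ∀ j {B} → Good B → ∀ y₁ y₂ S → 0ℤ ≤ S → dot (B j ∘ inj₂) y₁ ≡ S → dot (B j ∘ inj₂) y₂ ≡ ℤ.- S
    → step j B (frozen y₁) ⊞ step j B (frozen y₂) ≗ step j B (frozen (λ a → y₁ a ℤ.+ y₂ a) ⊞ (R j ℤ.* S) ⊙ δ j)
  step-bend j {B} gB y₁ y₂ S S≥0 e₁ e₂ (inj₂ a) = sym (trans (cong (λ q → y₁ a ℤ.+ y₂ a ℤ.+ q) (ℤₚ.*-zeroʳ (R j ℤ.* S))) (ℤₚ.+-identityʳ _))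
  step-bend j {B} gB y₁ y₂ S S≥0 e₁ e₂ (inj₁ l) = cases (l ≟ j)
    where
    open ≡-Reasoning
    t = R j ℤ.* S
    t≥0 : 0ℤ ≤ t
    t≥0 = subst (_≤ t) (ℤₚ.*-zeroʳ (R j)) (ℤₚ.*-monoˡ-≤-nonNeg (R j) S≥0)
    y = λ a → y₁ a ℤ.+ y₂ a
    m₁ = M⁻ j B (frozen y₁)
    m₂ = M⁻ j B (frozen y₂)
    u = frozen y ⊞ t ⊙ δ j
    frozen-+ : frozen y ≗ frozen y₁ ⊞ frozen y₂
    frozen-+ (inj₁ _) = refl
    frozen-+ (inj₂ _) = refl
    pair-u : ∀ m → m (inj₁ j) ≡ 0ℤ → ⟨ m , u ⟩ ≡ ⟨ m , frozen y₁ ⟩ ℤ.+ ⟨ m , frozen y₂ ⟩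
    pair-u m e = begin
      ⟨ m , u ⟩                                                   ≡⟨ pair-comb m t (frozen y) (δ j) ⟩
      ⟨ m , frozen y ⟩ ℤ.+ t ℤ.* ⟨ m , δ j ⟩                      ≡⟨ cong₂ (λ p q → p ℤ.+ t ℤ.* q)
        (trans (Trop.pair-cong (λ _ → refl) frozen-+) (Trop.pair-∙ m (frozen y₁) (frozen y₂)))
        (trans (Trop.pair-single j m (δ j) (λ l ne → inj₂ (δ-other j l ne))) (cong (ℤ._* δ j (inj₁ j)) e)) ⟩
      (⟨ m , frozen y₁ ⟩ ℤ.+ ⟨ m , frozen y₂ ⟩) ℤ.+ t ℤ.* (0ℤ ℤ.* δ j (inj₁ j))
        ≡⟨ lemma _ t (δ j (inj₁ j)) ⟩
      ⟨ m , frozen y₁ ⟩ ℤ.+ ⟨ m , frozen y₂ ⟩ ∎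
      where
      lemma : ∀ p t e → p ℤ.+ t ℤ.* (0ℤ ℤ.* e) ≡ p
      lemma = solve-∀
    at-j : step j B (frozen y₁) (inj₁ j) ℤ.+ step j B (frozen y₂) (inj₁ j) ≡ step j B u (inj₁ j)
    at-j = begin
      step j B (frozen y₁) (inj₁ j) ℤ.+ step j B (frozen y₂) (inj₁ j)
        ≡⟨ cong₂ ℤ._+_ (step-same j B (frozen y₁)) (step-same j B (frozen y₂)) ⟩
      (0ℤ ℤ.+ (m₁ ℤ.+ (0ℤ ℤ.⊓ (R j ℤ.* ⟨ B j , frozen y₁ ⟩)))) ℤ.+ (0ℤ ℤ.+ (m₂ ℤ.+ (0ℤ ℤ.⊓ (R j ℤ.* ⟨ B j , frozen y₂ ⟩))))
        ≡⟨ cong₂ (λ p q → (0ℤ ℤ.+ (m₁ ℤ.+ (0ℤ ℤ.⊓ (R j ℤ.* p)))) ℤ.+ (0ℤ ℤ.+ (m₂ ℤ.+ (0ℤ ℤ.⊓ (R j ℤ.* q)))))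
             (trans (pair-frozen (B j) y₁) e₁) (trans (pair-frozen (B j) y₂) e₂) ⟩
      (0ℤ ℤ.+ (m₁ ℤ.+ (0ℤ ℤ.⊓ t))) ℤ.+ (0ℤ ℤ.+ (m₂ ℤ.+ (0ℤ ℤ.⊓ (R j ℤ.* (ℤ.- S)))))
        ≡⟨ cong₂ (λ p q → (0ℤ ℤ.+ (m₁ ℤ.+ p)) ℤ.+ (0ℤ ℤ.+ (m₂ ℤ.+ q))) (ℤₚ.i≤j⇒i⊓j≡i t≥0)
             (trans (cong (0ℤ ℤ.⊓_) (sym (ℤₚ.neg-distribʳ-* (R j) S))) (ℤₚ.i≥j⇒i⊓j≡j (neg-nonneg t≥0))) ⟩
      (0ℤ ℤ.+ (m₁ ℤ.+ 0ℤ)) ℤ.+ (0ℤ ℤ.+ (m₂ ℤ.+ ℤ.- t))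
        ≡⟨ lemma m₁ m₂ t ⟩
      ℤ.-1ℤ ℤ.* (0ℤ ℤ.+ t ℤ.* 1ℤ) ℤ.+ ((m₁ ℤ.+ m₂) ℤ.+ 0ℤ)
        ≡⟨ cong₂ (λ p q → ℤ.-1ℤ ℤ.* (0ℤ ℤ.+ t ℤ.* p) ℤ.+ q) (sym (δ-same j)) (cong₂ ℤ._+_
             (sym (pair-u _ (trans (cong (λ b → R j ℤ.* (ℤ.- b) ⁺) (diag gB j)) (ℤₚ.*-zeroʳ (R j)))))
             (sym (trans (cong (λ q → 0ℤ ℤ.⊓ (R j ℤ.* q)) zero-ŷ) (cong (0ℤ ℤ.⊓_) (ℤₚ.*-zeroʳ (R j)))))) ⟩
      exchange j B u ≡⟨ sym (step-same j B u) ⟩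
      step j B u (inj₁ j) ∎
      where
      lemma : ∀ m₁ m₂ t → (0ℤ ℤ.+ (m₁ ℤ.+ 0ℤ)) ℤ.+ (0ℤ ℤ.+ (m₂ ℤ.+ ℤ.- t)) ≡ ℤ.-1ℤ ℤ.* (0ℤ ℤ.+ t ℤ.* 1ℤ) ℤ.+ ((m₁ ℤ.+ m₂) ℤ.+ 0ℤ)
      lemma = solve-∀
      zero-ŷ : ⟨ B j , u ⟩ ≡ 0ℤ
      zero-ŷ = trans (pair-u (B j) (diag gB j)) (trans (cong₂ ℤ._+_ (trans (pair-frozen (B j) y₁) e₁) (trans (pair-frozen (B j) y₂) e₂)) (ℤₚ.+-inverseʳ S))
    cases : Dec (l ≡ j) → step j B (frozen y₁) (inj₁ l) ℤ.+ step j B (frozen y₂) (inj₁ l) ≡ step j B u (inj₁ l)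
    cases (yes refl) = at-j
    cases (no ne) = begin
      step j B (frozen y₁) (inj₁ l) ℤ.+ step j B (frozen y₂) (inj₁ l)
        ≡⟨ cong₂ ℤ._+_ (step-other j B (frozen y₁) (inj₁ l) ne′) (step-other j B (frozen y₂) (inj₁ l) ne′) ⟩
      0ℤ                              ≡⟨ sym (trans (cong (λ q → 0ℤ ℤ.+ t ℤ.* q) (δ-other j (inj₁ l) ne′)) (trans (ℤₚ.+-identityˡ _) (ℤₚ.*-zeroʳ t))) ⟩
      u (inj₁ l)                      ≡⟨ sym (step-other j B u (inj₁ l) ne′) ⟩
      step j B u (inj₁ l)             ∎
      where
      ne′ : _≢_ {A = Idx n} (inj₁ l) (inj₁ j)
      ne′ refl = ne refl

-- Tropical frames, c-vectors and their dual weights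

module Frames {n : ℕ} (D : GenFixedData n) where
  open GenFixedData D using (d; ε; skew)
  open Mutation D
  open GoodMatrices D
  open Good
  open Seeds D tropical
  open Kernel D

  B₀ : ExtMat n
  B₀ i (inj₁ j) = ε i j
  B₀ i (inj₂ j) = unit i j

  good-B₀ : Good B₀
  good-B₀ .isSkew = mkSkew skew
  good-B₀ .surjective η = frozen η , λ c → trans (pair-frozen (B₀ c) η) (dot-unitˡ c η)

  -- M rs and X rs are the matrix and the tropical cluster reached from the
  -- initial seed by the path rs read backwards, so that rs itself leads back.
  M : List (Fin n) → ExtMat n
  M []       = B₀
  M (k ∷ rs) = μ k (M rs)

  X : List (Fin n) → Weight → Weight
  X []       w = w
  X (k ∷ rs) w = step k (M rs) (X rs w)

  good-M : ∀ rs → Good (M rs)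
  good-M []       = good-B₀
  good-M (k ∷ rs) = good-μ k (good-M rs)

  X-frozen : ∀ rs w a → X rs w (inj₂ a) ≡ w (inj₂ a)
  X-frozen []       w a = refl
  X-frozen (k ∷ rs) w a = X-frozen rs w a

  X-cong : ∀ rs {v w} → v ≗ w → X rs v ≗ X rs w
  X-cong []       p = p
  X-cong (k ∷ rs) p = step-cong k {M rs} {M rs} (λ _ → refl) (X-cong rs p)

  X-ker : ∀ rs {v} → Ker B₀ v → Ker (M rs) (X rs v)
  X-ker []       kv = kv
  X-ker (k ∷ rs) kv = ker-step k (good-M rs) (X-ker rs kv)

  X-linear : ∀ rs {v} → Ker B₀ v → ∀ a w → X rs (w ⊞ a ⊙ v) ≗ X rs w ⊞ a ⊙ X rs v
  X-linear []       kv a w l = refl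
  X-linear (k ∷ rs) {v} kv a w l = trans (step-cong k {M rs} {M rs} (λ _ → refl) (X-linear rs kv a w) l)
    (step-linear k {M rs} {X rs v} (X-ker rs kv) a (X rs w) l)

  run-step : ∀ j {B} → Good B → ∀ ks w → run (j ∷ ks) (μ j B) (step j B w) ≗ run ks B w
  run-step j {B} gB ks w = run-cong ks (μ-involutive j B (diag gB j)) (step-involutive j w (diag gB j))

  run-back : ∀ rs w → run rs (M rs) (X rs w) ≗ w
  run-back []       w l = refl
  run-back (k ∷ rs) w l = trans (run-step k (good-M rs) rs (X rs w) l) (run-back rs w l)

  M-mutations : ∀ rs → M rs ≡ mutations (reverse rs) B₀
  M-mutations []       = refl
  M-mutations (k ∷ rs) = trans (cong (μ k) (M-mutations rs))
    (sym (trans (cong (λ p → mutations p B₀) (Listₚ.unfold-reverse k rs)) (mutations-∷ʳ (reverse rs) k B₀)))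

  X-run : ∀ rs w → X rs w ≡ run (reverse rs) B₀ w
  X-run []       w = refl
  X-run (k ∷ rs) w = trans (cong₂ (step k) (M-mutations rs) (X-run rs w))
    (sym (trans (cong (λ p → run p B₀ w) (Listₚ.unfold-reverse k rs)) (run-∷ʳ (reverse rs) k B₀ w)))

  zeroW : Weight
  zeroW _ = 0ℤ

  X-zeroW : ∀ rs l → X rs zeroW (inj₁ l) ≡ 0ℤ
  X-zeroW rs l = double _ (trans (cong (λ q → X rs zeroW (inj₁ l) ℤ.+ q) (sym (ℤₚ.*-identityˡ _)))
    (trans (sym (X-linear rs {zeroW} (λ c → Trop.pair-ε (B₀ c) zeroW (λ _ → inj₂ refl)) 1ℤ zeroW (inj₁ l)))
           (X-cong rs (λ _ → refl) (inj₁ l))))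
    where
    double : ∀ x → x ℤ.+ x ≡ x → x ≡ 0ℤ
    double x e = trans (lemma x) (trans (cong (ℤ._+ ℤ.- x) e) (ℤₚ.+-inverseʳ x))
      where
      lemma : ∀ x → x ≡ (x ℤ.+ x) ℤ.+ ℤ.- x
      lemma = solve-∀

  NonNeg NonPos : (Fin n → ℤ) → Set
  NonNeg c = ∀ a → 0ℤ ≤ c a
  NonPos c = ∀ a → c a ≤ 0ℤ

  Coherent : (Fin n → ℤ) → Set
  Coherent c = NonNeg c ⊎ NonPos c

  ⊓-nonneg : ∀ k {x} → 0ℤ ≤ x → 0ℤ ℤ.⊓ (R k ℤ.* x) ≡ 0ℤ
  ⊓-nonneg k {x} h = ℤₚ.i≤j⇒i⊓j≡i (subst (_≤ R k ℤ.* x) (ℤₚ.*-zeroʳ (R k)) (ℤₚ.*-monoˡ-≤-nonNeg (R k) h))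

  -- B or - B, with the sign chosen such that the c-vector of row k is nonnegative.
  record Signed (B : ExtMat n) (k : Fin n) : Set where
    field
      Bσ       : ExtMat n
      good-Bσ  : Good Bσ
      sgn      : ℤ
      Bσ-eq    : ∀ c l → Bσ c l ≡ sgn ℤ.* B c l
      B-eq     : ∀ c l → B c l ≡ sgn ℤ.* Bσ c l
      nonneg   : NonNeg (Bσ k ∘ inj₂)
      step-eq  : ∀ w → step k B w ≗ step k Bσ w
      c-rule   : ∀ {l} → l ≢ k → ∀ a → μ k B l (inj₂ a) ≡ B l (inj₂ a) ℤ.+ (R k ℤ.* Bσ l (inj₁ k) ⁺) ℤ.* B k (inj₂ a)

    M⁻-frozen : ∀ a → R k ℤ.* (ℤ.- Bσ k (inj₂ a)) ⁺ ≡ 0ℤ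
    M⁻-frozen a = trans (cong (R k ℤ.*_) (⁺-of-nonpos (neg-nonneg (nonneg a)))) (ℤₚ.*-zeroʳ (R k))

    ker-Bσ : ∀ {v} → Ker B v → Ker Bσ v
    ker-Bσ {v} kv c = trans (Trop.pair-cong (Bσ-eq c) (λ _ → refl))
      (trans (Trop.pair-* sgn (B c) v) (trans (cong (sgn ℤ.*_) (kv c)) (ℤₚ.*-zeroʳ sgn)))

    step-frozen-same : ∀ y → step k B (frozen y) (inj₁ k) ≡ 0ℤ ℤ.⊓ (R k ℤ.* dot (Bσ k ∘ inj₂) y)
    step-frozen-same y = begin
      step k B (frozen y) (inj₁ k)    ≡⟨ step-eq (frozen y) (inj₁ k) ⟩
      step k Bσ (frozen y) (inj₁ k)   ≡⟨ step-same k Bσ (frozen y) ⟩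
      0ℤ ℤ.+ (M⁻ k Bσ (frozen y) ℤ.+ (0ℤ ℤ.⊓ (R k ℤ.* ⟨ Bσ k , frozen y ⟩)))
        ≡⟨ cong₂ (λ p q → 0ℤ ℤ.+ (p ℤ.+ (0ℤ ℤ.⊓ (R k ℤ.* q))))
             (trans (pair-frozen _ y) (Trop.pairFin-ε _ y (λ a → inj₁ (M⁻-frozen a)))) (pair-frozen (Bσ k) y) ⟩
      0ℤ ℤ.+ (0ℤ ℤ.+ (0ℤ ℤ.⊓ (R k ℤ.* dot (Bσ k ∘ inj₂) y)))
        ≡⟨ trans (ℤₚ.+-identityˡ _) (ℤₚ.+-identityˡ _) ⟩
      0ℤ ℤ.⊓ (R k ℤ.* dot (Bσ k ∘ inj₂) y) ∎
      where open ≡-Reasoning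

    -- With the c-vector of row k nonnegative, M⁻ contains no frozen variable, so only the unfrozen
    -- coordinate m contributes. This is the mutation rule of g-vectors.
    step-dual : ∀ m {v} → Ker B v → (∀ l → v (inj₁ l) ≡ δ m (inj₁ l))
      → step k B v (inj₁ k) ≡ ℤ.-1ℤ ℤ.* δ m (inj₁ k) ℤ.+ R k ℤ.* (ℤ.- Bσ k (inj₁ m)) ⁺
    step-dual m {v} kv e = begin
      step k B v (inj₁ k)                              ≡⟨ trans (step-eq v (inj₁ k)) (step-same k Bσ v) ⟩
      exchange k Bσ v                                  ≡⟨ exchange-ker k {Bσ} {v} (ker-Bσ kv) ⟩
      ℤ.-1ℤ ℤ.* v (inj₁ k) ℤ.+ M⁻ k Bσ v               ≡⟨ cong₂ (λ p q → ℤ.-1ℤ ℤ.* p ℤ.+ q) (e k) monomial ⟩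
      ℤ.-1ℤ ℤ.* δ m (inj₁ k) ℤ.+ R k ℤ.* (ℤ.- Bσ k (inj₁ m)) ⁺ ∎
      where
      open ≡-Reasoning
      off : ∀ l → l ≢ inj₁ m → R k ℤ.* (ℤ.- Bσ k l) ⁺ ≡ 0ℤ ⊎ v l ≡ 0ℤ
      off (inj₁ l) ne = inj₂ (trans (e l) (δ-other m (inj₁ l) ne))
      off (inj₂ a) ne = inj₁ (M⁻-frozen a)
      monomial : M⁻ k Bσ v ≡ R k ℤ.* (ℤ.- Bσ k (inj₁ m)) ⁺
      monomial = trans (Trop.pair-single m (λ l → R k ℤ.* (ℤ.- Bσ k l) ⁺) v off)
        (trans (cong ((R k ℤ.* (ℤ.- Bσ k (inj₁ m)) ⁺) ℤ.*_) (trans (e m) (δ-same m))) (ℤₚ.*-identityʳ _))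

  c-rule-nonneg : ∀ k B → NonNeg (B k ∘ inj₂) → ∀ {l} → l ≢ k → ∀ a
    → μ k B l (inj₂ a) ≡ B l (inj₂ a) ℤ.+ (R k ℤ.* B l (inj₁ k) ⁺) ℤ.* B k (inj₂ a)
  c-rule-nonneg k B h {l} ne a = trans (μ-other k B ne (inj₂ a))
    (trans (cong (λ p → (B l (inj₂ a) ℤ.+ ((R k ℤ.* B l (inj₁ k) ⁺) ℤ.* B k (inj₂ a) ℤ.+ B l (inj₁ k) ℤ.* (R k ℤ.* p))) ℤ.+ (ℤ.- + 2 ℤ.* B l (inj₁ k)) ℤ.* 0ℤ)
             (⁺-of-nonpos (neg-nonneg (h a))))
           (lemma (B l (inj₂ a)) ((R k ℤ.* B l (inj₁ k) ⁺) ℤ.* B k (inj₂ a)) (B l (inj₁ k)) (R k)))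
    where
    lemma : ∀ x y b R → (x ℤ.+ (y ℤ.+ b ℤ.* (R ℤ.* 0ℤ))) ℤ.+ (ℤ.- + 2 ℤ.* b) ℤ.* 0ℤ ≡ x ℤ.+ y
    lemma = solve-∀

  signed : ∀ {B} → Good B → ∀ k → Coherent (B k ∘ inj₂) → Signed B k
  signed {B} gB k (inj₁ h) = record
    { Bσ = B ; good-Bσ = gB ; sgn = 1ℤ ; Bσ-eq = λ c l → sym (ℤₚ.*-identityˡ _) ; B-eq = λ c l → sym (ℤₚ.*-identityˡ _)
    ; nonneg = h ; step-eq = λ w l → refl ; c-rule = c-rule-nonneg k B h }
  signed {B} gB k (inj₂ h) = record
    { Bσ = neg B ; good-Bσ = good-neg gB ; sgn = ℤ.-1ℤ ; Bσ-eq = λ c l → sym (ℤₚ.-1*i≡-i _)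
    ; B-eq = λ c l → sym (trans (ℤₚ.-1*i≡-i _) (ℤₚ.neg-involutive _))
    ; nonneg = λ a → neg-nonpos (h a) ; step-eq = λ w l → sym (step-neg k B w l)
    ; c-rule = λ {l} ne a → ℤₚ.neg-injective (trans (sym (μ-neg k B l (inj₂ a))) (trans (c-rule-nonneg k (neg B) (λ a → neg-nonpos (h a)) ne a)
        (lemma (B l (inj₂ a)) (R k ℤ.* (ℤ.- B l (inj₁ k)) ⁺) (B k (inj₂ a))))) }
    where
    lemma : ∀ x p y → ℤ.- x ℤ.+ p ℤ.* (ℤ.- y) ≡ ℤ.- (x ℤ.+ p ℤ.* y)
    lemma = solve-∀

  -- W j is the kernel vector whose image in the frame rs is the j-th unit vector;
  -- duality identifies it with the j-th c-vector.
  record Invariant (rs : List (Fin n)) : Set where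
    field
      W       : Fin n → Weight
      W-ker   : ∀ j → Ker B₀ (W j)
      W-unit  : ∀ j l → X rs (W j) (inj₁ l) ≡ δ j (inj₁ l)
      duality : ∀ j a → + d a ℤ.* W j (inj₁ a) ≡ + d j ℤ.* M rs j (inj₂ a)
      X-zero  : ∀ y → NonNeg y → ∀ l → X rs (frozen y) (inj₁ l) ≡ 0ℤ

  X-on-nonneg : ∀ {rs} → Invariant rs → ∀ y → NonNeg y → X rs (frozen y) ≗ frozen y
  X-on-nonneg inv y h (inj₁ l) = Invariant.X-zero inv y h l
  X-on-nonneg {rs} inv y h (inj₂ a) = X-frozen rs (frozen y) a

  dot-nonneg : ∀ {m} (c y : Fin m → ℤ) → (∀ a → 0ℤ ≤ c a) → (∀ a → 0ℤ ≤ y a) → 0ℤ ≤ Trop.pairFin c y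
  dot-nonneg {zero}  c y hc hy = ℤₚ.≤-refl
  dot-nonneg {suc m} c y hc hy = ℤₚ.+-mono-≤
    (subst (_≤ c zero ℤ.* y zero) (ℤₚ.*-zeroʳ (c zero)) (ℤₚ.*-monoˡ-≤-nonNeg (c zero) {{ℤ.nonNegative (hc zero)}} (hy zero)))
    (dot-nonneg (c ∘ suc) (y ∘ suc) (hc ∘ suc) (hy ∘ suc))

  -- The weights of the initial extended cluster under the i-th one-parameter
  -- subgroup of the torus of N°.
  κ : Fin n → Weight
  κ i (inj₁ l) = unit i l
  κ i (inj₂ a) = ℤ.- ε a i

  κ-ker : ∀ i → Ker B₀ (κ i)
  κ-ker i c = trans (Trop.pair-def (B₀ c) (κ i))
    (trans (cong₂ ℤ._+_ (dot-unitʳ (ε c) i) (dot-unitˡ c (λ a → ℤ.- ε a i))) (ℤₚ.+-inverseʳ (ε c i)))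

  initial-invariant : Invariant []
  initial-invariant = record
    { W = κ ; W-ker = κ-ker ; W-unit = λ j l → refl
    ; duality = dual ; X-zero = λ _ _ _ → refl }
    where
    dual : ∀ j a → + d a ℤ.* unit j a ≡ + d j ℤ.* unit j a
    dual j a with a ≟ j
    ... | yes refl = refl
    ... | no _     = trans (ℤₚ.*-zeroʳ (+ d a)) (sym (ℤₚ.*-zeroʳ (+ d j)))

  module _ {rs : List (Fin n)} (inv : Invariant rs) (k : Fin n) (sg : Signed (M rs) k) where
    open Invariant inv
    open Signed sg

    private
      B = M rs
      gB = good-M rs

    next-X-same : ∀ m → X (k ∷ rs) (W m) (inj₁ k) ≡ ℤ.-1ℤ ℤ.* δ m (inj₁ k) ℤ.+ R k ℤ.* (ℤ.- Bσ k (inj₁ m)) ⁺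
    next-X-same m = step-dual m (X-ker rs (W-ker m)) (W-unit m)

    next-X-Wₖ : ∀ l → X (k ∷ rs) (W k) (inj₁ l) ≡ ℤ.- δ k (inj₁ l)
    next-X-Wₖ l = cases (l ≟ k)
      where
      cases : Dec (l ≡ k) → X (k ∷ rs) (W k) (inj₁ l) ≡ ℤ.- δ k (inj₁ l)
      cases (yes refl) = trans (next-X-same k) (trans (cong (λ p → ℤ.-1ℤ ℤ.* δ k (inj₁ k) ℤ.+ R k ℤ.* (ℤ.- p) ⁺) (diag good-Bσ k))
        (trans (cong (λ q → ℤ.-1ℤ ℤ.* δ k (inj₁ k) ℤ.+ q) (ℤₚ.*-zeroʳ (R k))) (trans (ℤₚ.+-identityʳ _) (ℤₚ.-1*i≡-i _))))
      cases (no ne) = trans (step-other k B (X rs (W k)) (inj₁ l) ne′)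
        (trans (W-unit k l) (trans (δ-other k (inj₁ l) ne′) (cong ℤ.-_ (sym (δ-other k (inj₁ l) ne′)))))
        where
        ne′ : _≢_ {A = Idx n} (inj₁ l) (inj₁ k)
        ne′ refl = ne refl

    -- W′ inverts the linear change of frame given by `next-X-same`: W k is negated and p j copies
    -- of it are added to the other W j. By `skew-⁺` the same combination is the mutation rule of
    -- c-vectors, so duality survives. The orthant stays mapped to zero because a nonnegative
    -- c-vector is nonnegative on it.
    next-invariant : Invariant (k ∷ rs)
    next-invariant = record { W = W′ ; W-ker = ker ; W-unit = units ; duality = dual ; X-zero = zeros }
      where
      p : Fin n → ℤ
      p j = R k ℤ.* (ℤ.- Bσ k (inj₁ j)) ⁺
      coef : ∀ j → Dec (j ≡ k) → Weight × ℤ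
      coef j (yes _) = zeroW , ℤ.-1ℤ
      coef j (no _)  = W j , p j
      W″ : ∀ j → Dec (j ≡ k) → Weight
      W″ j dec = proj₁ (coef j dec) ⊞ proj₂ (coef j dec) ⊙ W k
      W′ : Fin n → Weight
      W′ j = W″ j (j ≟ k)
      ker : ∀ j → Ker B₀ (W′ j)
      ker j c = trans (pair-comb (B₀ c) (proj₂ (coef j (j ≟ k))) (proj₁ (coef j (j ≟ k))) (W k))
        (trans (cong₂ (λ x y → x ℤ.+ proj₂ (coef j (j ≟ k)) ℤ.* y) (base (j ≟ k)) (W-ker k c))
               (trans (ℤₚ.+-identityˡ _) (ℤₚ.*-zeroʳ (proj₂ (coef j (j ≟ k))))))
        where
        base : ∀ dec → ⟨ B₀ c , proj₁ (coef j dec) ⟩ ≡ 0ℤ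
        base (yes _) = Trop.pair-ε (B₀ c) zeroW (λ _ → inj₂ refl)
        base (no _)  = W-ker j c
      units : ∀ j l → X (k ∷ rs) (W′ j) (inj₁ l) ≡ δ j (inj₁ l)
      units j l = trans (X-linear (k ∷ rs) (W-ker k) (proj₂ (coef j (j ≟ k))) (proj₁ (coef j (j ≟ k))) (inj₁ l))
        (trans (cong (λ q → X (k ∷ rs) (proj₁ (coef j (j ≟ k))) (inj₁ l) ℤ.+ proj₂ (coef j (j ≟ k)) ℤ.* q) (next-X-Wₖ l)) (cases (j ≟ k) (l ≟ k)))
        where
        cases : ∀ dec → Dec (l ≡ k) → X (k ∷ rs) (proj₁ (coef j dec)) (inj₁ l) ℤ.+ proj₂ (coef j dec) ℤ.* (ℤ.- δ k (inj₁ l)) ≡ δ j (inj₁ l)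
        cases (yes refl) _ = trans (cong (ℤ._+ ℤ.-1ℤ ℤ.* (ℤ.- δ k (inj₁ l))) (X-zeroW (k ∷ rs) l))
          (trans (ℤₚ.+-identityˡ _) (trans (ℤₚ.-1*i≡-i _) (ℤₚ.neg-involutive _)))
        cases (no ne) (yes refl) = trans (cong₂ (λ x y → x ℤ.+ p j ℤ.* (ℤ.- y)) (next-X-same j) (δ-same k))
          (trans (cong (λ q → (ℤ.-1ℤ ℤ.* q ℤ.+ p j) ℤ.+ p j ℤ.* ℤ.-1ℤ) k≠j) (trans (lemma (p j)) (sym k≠j)))
          where
          k≠j : δ j (inj₁ k) ≡ 0ℤ
          k≠j = δ-other j (inj₁ k) (λ { refl → ne refl })
          lemma : ∀ p → (ℤ.-1ℤ ℤ.* 0ℤ ℤ.+ p) ℤ.+ p ℤ.* ℤ.-1ℤ ≡ 0ℤ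
          lemma = solve-∀
        cases (no _) (no ne) = trans (cong₂ (λ x y → x ℤ.+ p j ℤ.* (ℤ.- y)) (trans (step-other k B (X rs (W j)) (inj₁ l) ne′) (W-unit j l)) (δ-other k (inj₁ l) ne′))
          (trans (cong (λ q → δ j (inj₁ l) ℤ.+ q) (ℤₚ.*-zeroʳ (p j))) (ℤₚ.+-identityʳ _))
          where
          ne′ : _≢_ {A = Idx n} (inj₁ l) (inj₁ k)
          ne′ refl = ne refl
      dual : ∀ j a → + d a ℤ.* W′ j (inj₁ a) ≡ + d j ℤ.* M (k ∷ rs) j (inj₂ a)
      dual j a = cases (j ≟ k)
        where
        open ≡-Reasoning
        cases : ∀ dec → + d a ℤ.* W″ j dec (inj₁ a) ≡ + d j ℤ.* μ k B j (inj₂ a)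
        cases (yes refl) = begin
          + d a ℤ.* (0ℤ ℤ.+ ℤ.-1ℤ ℤ.* W k (inj₁ a))   ≡⟨ lemma (+ d a) (W k (inj₁ a)) ⟩
          ℤ.- (+ d a ℤ.* W k (inj₁ a))                ≡⟨ cong ℤ.-_ (duality k a) ⟩
          ℤ.- (+ d k ℤ.* B k (inj₂ a))                ≡⟨ ℤₚ.neg-distribʳ-* (+ d k) _ ⟩
          + d k ℤ.* ℤ.- B k (inj₂ a)                  ≡⟨ cong (+ d k ℤ.*_) (sym (μ-same k B (inj₂ a))) ⟩
          + d k ℤ.* μ k B k (inj₂ a)                  ∎
          where
          lemma : ∀ d w → d ℤ.* (0ℤ ℤ.+ ℤ.-1ℤ ℤ.* w) ≡ ℤ.- (d ℤ.* w)
          lemma = solve-∀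
        cases (no ne) = begin
          + d a ℤ.* (W j (inj₁ a) ℤ.+ p j ℤ.* W k (inj₁ a))                    ≡⟨ lemma (+ d a) (W j (inj₁ a)) (p j) (W k (inj₁ a)) ⟩
          + d a ℤ.* W j (inj₁ a) ℤ.+ p j ℤ.* (+ d a ℤ.* W k (inj₁ a))          ≡⟨ cong₂ (λ x y → x ℤ.+ p j ℤ.* y) (duality j a) (duality k a) ⟩
          + d j ℤ.* B j (inj₂ a) ℤ.+ p j ℤ.* (+ d k ℤ.* B k (inj₂ a))          ≡⟨ lemma₁ (+ d j ℤ.* B j (inj₂ a)) (R k) ((ℤ.- Bσ k (inj₁ j)) ⁺) (+ d k) (B k (inj₂ a)) ⟩
          + d j ℤ.* B j (inj₂ a) ℤ.+ R k ℤ.* (+ d k ℤ.* (ℤ.- Bσ k (inj₁ j)) ⁺) ℤ.* B k (inj₂ a)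
            ≡⟨ cong (λ q → + d j ℤ.* B j (inj₂ a) ℤ.+ R k ℤ.* q ℤ.* B k (inj₂ a)) (sym (skew-⁺ (isSkew good-Bσ) j k)) ⟩
          + d j ℤ.* B j (inj₂ a) ℤ.+ R k ℤ.* (+ d j ℤ.* Bσ j (inj₁ k) ⁺) ℤ.* B k (inj₂ a)
            ≡⟨ lemma₂ (+ d j) (B j (inj₂ a)) (R k) (Bσ j (inj₁ k) ⁺) (B k (inj₂ a)) ⟩
          + d j ℤ.* (B j (inj₂ a) ℤ.+ (R k ℤ.* Bσ j (inj₁ k) ⁺) ℤ.* B k (inj₂ a)) ≡⟨ cong (+ d j ℤ.*_) (sym (c-rule ne a)) ⟩
          + d j ℤ.* μ k B j (inj₂ a) ∎
          where
          lemma : ∀ d w p v → d ℤ.* (w ℤ.+ p ℤ.* v) ≡ d ℤ.* w ℤ.+ p ℤ.* (d ℤ.* v)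
          lemma = solve-∀
          lemma₁ : ∀ x r b d c → x ℤ.+ (r ℤ.* b) ℤ.* (d ℤ.* c) ≡ x ℤ.+ r ℤ.* (d ℤ.* b) ℤ.* c
          lemma₁ = solve-∀
          lemma₂ : ∀ d x r b c → d ℤ.* x ℤ.+ r ℤ.* (d ℤ.* b) ℤ.* c ≡ d ℤ.* (x ℤ.+ (r ℤ.* b) ℤ.* c)
          lemma₂ = solve-∀
      zeros : ∀ y → NonNeg y → ∀ l → X (k ∷ rs) (frozen y) (inj₁ l) ≡ 0ℤ
      zeros y h l = trans (step-cong k {B} {B} (λ _ → refl) (X-on-nonneg inv y h) (inj₁ l)) (cases (l ≟ k))
        where
        cases : Dec (l ≡ k) → step k B (frozen y) (inj₁ l) ≡ 0ℤ
        cases (yes refl) = trans (step-frozen-same y) (⊓-nonneg k (dot-nonneg (Bσ k ∘ inj₂) y nonneg h))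
        cases (no ne)    = step-other k B (frozen y) (inj₁ l) (λ { refl → ne refl })

  bounded-above : ∀ {m} (f : Fin m → ℤ) → ∃ λ N → ∀ a → f a ≤ + N
  bounded-above {zero}  f = 0 , λ ()
  bounded-above {suc m} f with bounded-above (f ∘ suc)
  ... | N , h = ℤ.∣ f zero ∣ ℕ.+ N , λ
    { zero    → ℤₚ.≤-trans (i≤∣i∣ (f zero)) (ℤ.+≤+ (ℕₚ.m≤m+n _ N))
    ; (suc a) → ℤₚ.≤-trans (h a) (ℤ.+≤+ (ℕₚ.m≤n+m N _)) }

  dot-comb : ∀ c a y z → dot c (λ b → y b ℤ.+ a ℤ.* z b) ≡ dot c y ℤ.+ a ℤ.* dot c z
  dot-comb c a y z = trans (Trop.pairFin-∙ c y (λ b → a ℤ.* z b)) (cong (λ q → dot c y ℤ.+ q) (Trop.pairFin-· a c z))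

-- Sign-coherence of c-vectors

module Coherence {n : ℕ} (D : GenFixedData n) where
  open GenFixedData D using (d; d-pos; ε; r; r-pos)
  open Mutation D
  open GoodMatrices D
  open Good
  open Seeds D tropical
  open Kernel D
  open Frames D
  open Superadditivity D using (superadditive)

  *-nonneg : ∀ {x y} → 0ℤ ≤ x → 0ℤ ≤ y → 0ℤ ≤ x ℤ.* y
  *-nonneg {x} {y} hx hy = subst (_≤ x ℤ.* y) (ℤₚ.*-zeroʳ x) (ℤₚ.*-monoˡ-≤-nonNeg x {{ℤ.nonNegative hx}} hy)

  *-pos : ∀ {x y} → 0ℤ ℤ.< x → 0ℤ ℤ.< y → 0ℤ ℤ.< x ℤ.* y
  *-pos {x} {y} hx hy = subst (ℤ._< x ℤ.* y) (ℤₚ.*-zeroʳ x) (ℤₚ.*-monoˡ-<-pos x {{ℤ.positive hx}} hy)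

  *-cancel-nonneg : ∀ {x y} → 0ℤ ℤ.< x → 0ℤ ≤ x ℤ.* y → 0ℤ ≤ y
  *-cancel-nonneg {x} {y} hx h = ℤₚ.*-cancelˡ-≤-pos 0ℤ y x {{ℤ.positive hx}} (subst (_≤ x ℤ.* y) (sym (ℤₚ.*-zeroʳ x)) h)

  R-pos : ∀ k → 0ℤ ℤ.< R k
  R-pos k = ℤ.+<+ (r-pos k)

  d-pos′ : ∀ k → 0ℤ ℤ.< + d k
  d-pos′ k = ℤ.+<+ (d-pos k)

  unit-nonneg : ∀ a b → 0ℤ ≤ unit a b
  unit-nonneg a b with b ≟ a
  ... | yes _ = ℤ.+≤+ ℕ.z≤n
  ... | no  _ = ℤ.+≤+ ℕ.z≤n

  dot-0 : ∀ c → dot c (λ _ → 0ℤ) ≡ 0ℤ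
  dot-0 c = Trop.pairFin-ε c (λ _ → 0ℤ) (λ _ → inj₂ refl)

  -- A c-vector with entries of both signs takes the values S and - S on two
  -- large frozen vectors; superadditivity on the other side of the wall then
  -- makes W j, hence the c-vector, nonnegative.
  module Mixed {rs : List (Fin n)} (inv : Invariant rs) (j : Fin n) {a₁ a₂ : Fin n}
    (pos : 0ℤ ℤ.< M rs j (inj₂ a₁)) (neg′ : M rs j (inj₂ a₂) ℤ.< 0ℤ) where
    open Invariant inv

    private
      B = M rs
      gB = good-M rs
      c : Fin n → ℤ
      c = B j ∘ inj₂
      p q S t tot : ℤ
      p = c a₁
      q = ℤ.- c a₂
      S = p ℤ.* q
      t = R j ℤ.* S
      tot = dot c (λ _ → 1ℤ)

      q>0 : 0ℤ ℤ.< q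
      q>0 = ℤₚ.neg-mono-< neg′
      S>0 : 0ℤ ℤ.< S
      S>0 = *-pos pos q>0
      t>0 : 0ℤ ℤ.< t
      t>0 = *-pos (R-pos j) S>0

      z y₁ y₂ y″ : Fin n → ℤ
      -- A vector on the wall of `c` with all entries at least 1: the constant vector S has value S
      -- · tot, which is compensated at a₁ if tot is negative and at a₂ if it is positive.
      z b = ((0ℤ ℤ.+ S ℤ.* 1ℤ) ℤ.+ (q ℤ.* (ℤ.- tot) ⁺) ℤ.* unit a₁ b) ℤ.+ (p ℤ.* tot ⁺) ℤ.* unit a₂ b

      bound = bounded-above (λ b → t ℤ.* W j (inj₂ b))
      K : ℤ
      K = + proj₁ bound

      -- As z has value 0 under `c`, the values are q · c a₁ = S for y₁ and p · c a₂ = -S for y₂.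
      y₁ b = (0ℤ ℤ.+ K ℤ.* z b) ℤ.+ q ℤ.* unit a₁ b
      y₂ b = (0ℤ ℤ.+ K ℤ.* z b) ℤ.+ p ℤ.* unit a₂ b
      y″ b = (y₁ b ℤ.+ y₂ b) ℤ.+ ℤ.- (t ℤ.* W j (inj₂ b))

      dot-z : dot c z ≡ 0ℤ
      dot-z = begin
        dot c z
          ≡⟨ trans (dot-comb c (p ℤ.* tot ⁺) _ (unit a₂)) (cong₂ ℤ._+_
               (trans (dot-comb c (q ℤ.* (ℤ.- tot) ⁺) _ (unit a₁)) (cong₂ ℤ._+_ (trans (dot-comb c S (λ _ → 0ℤ) (λ _ → 1ℤ)) (cong (ℤ._+ S ℤ.* tot) (dot-0 c)))
                 (cong ((q ℤ.* (ℤ.- tot) ⁺) ℤ.*_) (dot-unitʳ c a₁))))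
               (cong ((p ℤ.* tot ⁺) ℤ.*_) (dot-unitʳ c a₂))) ⟩
        ((0ℤ ℤ.+ S ℤ.* tot) ℤ.+ (q ℤ.* (ℤ.- tot) ⁺) ℤ.* p) ℤ.+ (p ℤ.* tot ⁺) ℤ.* c a₂
          ≡⟨ cong (λ v → ((0ℤ ℤ.+ S ℤ.* tot) ℤ.+ (q ℤ.* (ℤ.- tot) ⁺) ℤ.* p) ℤ.+ (p ℤ.* v) ℤ.* c a₂) (⁺-split tot) ⟩
        ((0ℤ ℤ.+ S ℤ.* tot) ℤ.+ (q ℤ.* (ℤ.- tot) ⁺) ℤ.* p) ℤ.+ (p ℤ.* (tot ℤ.+ (ℤ.- tot) ⁺)) ℤ.* c a₂
          ≡⟨ lemma p (c a₂) tot ((ℤ.- tot) ⁺) ⟩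
        0ℤ ∎
        where
        open ≡-Reasoning
        lemma : ∀ p c s m → ((0ℤ ℤ.+ (p ℤ.* ℤ.- c) ℤ.* s) ℤ.+ ((ℤ.- c) ℤ.* m) ℤ.* p) ℤ.+ (p ℤ.* (s ℤ.+ m)) ℤ.* c ≡ 0ℤ
        lemma = solve-∀

      dot-Kz : ∀ e a → dot c (λ b → (0ℤ ℤ.+ K ℤ.* z b) ℤ.+ e ℤ.* unit a b) ≡ e ℤ.* c a
      dot-Kz e a = trans (dot-comb c e _ (unit a))
        (trans (cong₂ (λ x y → x ℤ.+ e ℤ.* y)
                 (trans (dot-comb c K (λ _ → 0ℤ) z) (trans (cong₂ (λ x y → x ℤ.+ K ℤ.* y) (dot-0 c) dot-z) (cong (λ v → 0ℤ ℤ.+ v) (ℤₚ.*-zeroʳ K))))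
                 (dot-unitʳ c a)) (ℤₚ.+-identityˡ _))

      1≤z : ∀ b → 1ℤ ≤ z b
      1≤z b = ℤₚ.≤-trans (ℤₚ.≤-trans (ℤₚ.i<j⇒suc[i]≤j S>0) (ℤₚ.≤-reflexive (lemma S)))
        (ℤₚ.≤-trans (ℤₚ.≤-reflexive (lemma′ (0ℤ ℤ.+ S ℤ.* 1ℤ)))
          (ℤₚ.+-mono-≤ (ℤₚ.+-monoʳ-≤ (0ℤ ℤ.+ S ℤ.* 1ℤ) (*-nonneg (*-nonneg (ℤₚ.<⇒≤ q>0) (⁺-nonneg (ℤ.- tot))) (unit-nonneg a₁ b)))
                       (*-nonneg (*-nonneg (ℤₚ.<⇒≤ pos) (⁺-nonneg tot)) (unit-nonneg a₂ b))))
        where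
        lemma : ∀ s → s ≡ 0ℤ ℤ.+ s ℤ.* 1ℤ
        lemma = solve-∀
        lemma′ : ∀ s → s ≡ (s ℤ.+ 0ℤ) ℤ.+ 0ℤ
        lemma′ = solve-∀

      K≤ : ∀ {e} a b → 0ℤ ≤ e → K ≤ (0ℤ ℤ.+ K ℤ.* z b) ℤ.+ e ℤ.* unit a b
      K≤ {e} a b h = ℤₚ.≤-trans (ℤₚ.≤-reflexive (sym (ℤₚ.*-identityʳ K))) (ℤₚ.≤-trans (ℤₚ.*-monoˡ-≤-nonNeg K (1≤z b))
        (ℤₚ.≤-trans (ℤₚ.≤-reflexive (lemma (K ℤ.* z b))) (ℤₚ.+-monoʳ-≤ (0ℤ ℤ.+ K ℤ.* z b) (*-nonneg h (unit-nonneg a b)))))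
        where
        lemma : ∀ s → s ≡ (0ℤ ℤ.+ s) ℤ.+ 0ℤ
        lemma = solve-∀

      K≤y₁ : ∀ b → K ≤ y₁ b
      K≤y₁ b = K≤ a₁ b (ℤₚ.<⇒≤ q>0)
      0≤y₁ : NonNeg y₁
      0≤y₁ b = ℤₚ.≤-trans (ℤ.+≤+ ℕ.z≤n) (K≤y₁ b)
      0≤y₂ : NonNeg y₂
      0≤y₂ b = ℤₚ.≤-trans (ℤ.+≤+ ℕ.z≤n) (K≤ a₂ b (ℤₚ.<⇒≤ pos))
      0≤y″ : NonNeg y″
      0≤y″ b = ℤₚ.i≤j⇒0≤j-i (ℤₚ.≤-trans (proj₂ bound b) (ℤₚ.≤-trans (K≤y₁ b)
        (ℤₚ.≤-trans (ℤₚ.≤-reflexive (sym (ℤₚ.+-identityʳ (y₁ b)))) (ℤₚ.+-monoʳ-≤ (y₁ b) (0≤y₂ b)))))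

      dot-y₁ : dot c y₁ ≡ S
      dot-y₁ = trans (dot-Kz q a₁) (ℤₚ.*-comm q p)
      dot-y₂ : dot c y₂ ≡ ℤ.- S
      dot-y₂ = trans (dot-Kz p a₂) (lemma p (c a₂))
        where
        lemma : ∀ p c → p ℤ.* c ≡ ℤ.- (p ℤ.* ℤ.- c)
        lemma = solve-∀

      u w* : Weight
      u = frozen (λ a → y₁ a ℤ.+ y₂ a) ⊞ t ⊙ δ j
      -- The preimage of u under X rs: X is linear along W j, whose unfrozen image is δ j, and y″
      -- makes up for its frozen part.
      w* = frozen y″ ⊞ t ⊙ W j

      X-w* : X rs w* ≗ u
      X-w* l = trans (X-linear rs (W-ker j) t (frozen y″) l) (eq l)
        where
        eq : X rs (frozen y″) ⊞ t ⊙ X rs (W j) ≗ u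
        eq (inj₁ l) = cong₂ (λ x y → x ℤ.+ t ℤ.* y) (X-zero y″ 0≤y″ l) (W-unit j l)
        eq (inj₂ a) = trans (cong₂ (λ x y → x ℤ.+ t ℤ.* y) (X-frozen rs (frozen y″) a) (X-frozen rs (W j) a))
          (lemma (y₁ a ℤ.+ y₂ a) t (W j (inj₂ a)))
          where
          lemma : ∀ y t w → (y ℤ.+ ℤ.- (t ℤ.* w)) ℤ.+ t ℤ.* w ≡ y ℤ.+ t ℤ.* 0ℤ
          lemma = solve-∀

      back : ∀ {v} w → X rs w ≗ v → run (j ∷ rs) (μ j B) (step j B v) ≗ w
      back {v} w e l = trans (run-step j gB rs v l) (trans (run-cong rs {B} {B} (λ _ _ → refl) (λ l → sym (e l)) l) (run-back rs w l))

    -- Run back to the initial seed, the two frozen vectors have unfrozen coordinate 0 and their sum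
    -- has t W j, by `step-bend`. Superadditivity along j, rs then reads 0 ≤ t W j a.
    W-nonneg : ∀ a → 0ℤ ≤ W j (inj₁ a)
    W-nonneg a = *-cancel-nonneg t>0 (subst₂ _≤_ left right
      (superadditive (j ∷ rs) (good-μ j gB) (inj₁ a) (step j B (frozen y₁)) (step j B (frozen y₂))))
      where
      left : run (j ∷ rs) (μ j B) (step j B (frozen y₁)) (inj₁ a) ℤ.+ run (j ∷ rs) (μ j B) (step j B (frozen y₂)) (inj₁ a) ≡ 0ℤ
      left = cong₂ ℤ._+_ (back (frozen y₁) (X-on-nonneg inv y₁ 0≤y₁) (inj₁ a)) (back (frozen y₂) (X-on-nonneg inv y₂ 0≤y₂) (inj₁ a))
      right : run (j ∷ rs) (μ j B) (step j B (frozen y₁) ⊞ step j B (frozen y₂)) (inj₁ a) ≡ t ℤ.* W j (inj₁ a)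
      right = trans (run-cong (j ∷ rs) {μ j B} {μ j B} (λ _ _ → refl) (step-bend j gB y₁ y₂ S (ℤₚ.<⇒≤ S>0) dot-y₁ dot-y₂) (inj₁ a))
        (trans (back w* X-w* (inj₁ a)) (ℤₚ.+-identityˡ _))

    absurd : ⊥
    absurd = ℤₚ.<-irrefl refl (ℤₚ.<-≤-trans neg′ (*-cancel-nonneg (d-pos′ j)
      (subst (0ℤ ≤_) (duality j a₂) (*-nonneg (ℤₚ.<⇒≤ (d-pos′ a₂)) (W-nonneg a₂)))))

  c-coherent : ∀ {rs} → Invariant rs → ∀ j → Coherent (M rs j ∘ inj₂)
  c-coherent {rs} inv j with any? (λ a → M rs j (inj₂ a) ℤₚ.<? 0ℤ)
  ... | no none = inj₁ (λ a → ℤₚ.≮⇒≥ (λ lt → none (a , lt)))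
  ... | yes (a₂ , neg′) with any? (λ a → 0ℤ ℤₚ.<? M rs j (inj₂ a))
  ...   | no none = inj₂ (λ a → ℤₚ.≮⇒≥ (λ lt → none (a , lt)))
  ...   | yes (a₁ , pos) = ⊥-elim (Mixed.absurd inv j pos neg′)

  -- Joint induction along the path: the invariant at rs makes its c-vectors coherent, and their
  -- sign is what the next mutation needs to carry the invariant on.
  invariant : ∀ rs → Invariant rs
  signed-M : ∀ rs k → Signed (M rs) k

  invariant []       = initial-invariant
  invariant (k ∷ rs) = next-invariant (invariant rs) k (signed-M rs k)

  signed-M rs k = signed (good-M rs) k (c-coherent (invariant rs) k)

  -- The bend across one facet of the positive orthant, and rows of g-vectors

  module _ (i : Fin n) where

    g : List (Fin n) → Fin n → ℤ
    g rs l = X rs (κ i) (inj₁ l)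

    ρ : (Fin n → ℤ) → ℤ
    ρ y = 0ℤ ℤ.⊓ y i

    ρ≤0 : ∀ y → ρ y ≤ 0ℤ
    ρ≤0 y = ℤₚ.i⊓j≤i 0ℤ (y i)

    -- The cone around the facet y i = 0 of the positive orthant.
    Near : ℕ → (Fin n → ℤ) → Set
    Near K y = ∀ a → a ≢ i → 0ℤ ≤ y a ℤ.+ + K ℤ.* ρ y

    -- `K` narrows the cone so far that, of all walls met along the path, only those equal to the
    -- facet y i = 0 affect it. The single scalar s for all l is what lets one sign govern the whole
    -- row.
    record Bend (rs : List (Fin n)) : Set where
      field
        s    : ℤ
        K    : ℕ
        bend : ∀ y → Near K y → ∀ l → X rs (frozen y) (inj₁ l) ≡ (s ℤ.* ρ y) ℤ.* g rs l

    near-mono : ∀ {K K′} y → K ℕ.≤ K′ → Near K′ y → Near K y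
    near-mono y le h a ne = ℤₚ.≤-trans (h a ne) (ℤₚ.+-monoʳ-≤ (y a) (ℤₚ.*-monoʳ-≤-nonPos (ρ y) {{ℤ.nonPositive (ρ≤0 y)}} (ℤ.+≤+ le)))

    ε-diag : ε i i ≡ 0ℤ
    ε-diag = diag good-B₀ i

    module NextBend {rs : List (Fin n)} (k : Fin n) (bnd : Bend rs) where
      open Bend bnd
      open Signed (signed-M rs k)
      open Invariant (invariant rs) using (W; W-ker; duality)

      private
        B = M rs
        c : Fin n → ℤ
        c = Bσ k ∘ inj₂
        P : ℤ
        P = dot c (λ a → ε a i)

        -- The image of frozen y is split as frozen y′ plus s ρ times the image of κ i. The latter
        -- is a kernel vector, along which the step is linear, so only y′ has to be compared with
        -- the wall of k.
        y′ : (Fin n → ℤ) → Fin n → ℤ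
        y′ y a = y a ℤ.+ (s ℤ.* ρ y) ℤ.* ε a i

        z : (Fin n → ℤ) → ℤ
        z y = 0ℤ ℤ.⊓ (R k ℤ.* dot c (y′ y))

        expand : ∀ y → Near K y → ∀ l → X (k ∷ rs) (frozen y) (inj₁ l) ≡ z y ℤ.* δ k (inj₁ l) ℤ.+ (s ℤ.* ρ y) ℤ.* g (k ∷ rs) l
        expand y h l = trans (step-cong k {B} {B} (λ _ → refl) decompose (inj₁ l))
          (trans (step-linear k {B} {X rs (κ i)} (X-ker rs (κ-ker i)) (s ℤ.* ρ y) (frozen (y′ y)) (inj₁ l))
                 (cong (ℤ._+ (s ℤ.* ρ y) ℤ.* g (k ∷ rs) l) (cases (l ≟ k))))
          where
          decompose : X rs (frozen y) ≗ frozen (y′ y) ⊞ (s ℤ.* ρ y) ⊙ X rs (κ i)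
          decompose (inj₁ l) = trans (bend y h l) (sym (ℤₚ.+-identityˡ _))
          decompose (inj₂ a) = trans (X-frozen rs (frozen y) a) (trans (lemma (y a) (s ℤ.* ρ y) (ε a i))
            (cong (λ v → y′ y a ℤ.+ (s ℤ.* ρ y) ℤ.* v) (sym (X-frozen rs (κ i) a))))
            where
            lemma : ∀ y s e → y ≡ (y ℤ.+ s ℤ.* e) ℤ.+ s ℤ.* (ℤ.- e)
            lemma = solve-∀
          cases : Dec (l ≡ k) → step k B (frozen (y′ y)) (inj₁ l) ≡ z y ℤ.* δ k (inj₁ l)
          cases (yes refl) = trans (step-frozen-same (y′ y)) (sym (trans (cong (z y ℤ.*_) (δ-same k)) (ℤₚ.*-identityʳ (z y))))
          cases (no ne) = trans (step-other k B (frozen (y′ y)) (inj₁ l) ne′) (sym (trans (cong (z y ℤ.*_) (δ-other k (inj₁ l) ne′)) (ℤₚ.*-zeroʳ (z y))))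
            where
            ne′ : _≢_ {A = Idx n} (inj₁ l) (inj₁ k)
            ne′ refl = ne refl

      -- A c-vector with a positive entry off i takes nonnegative values on y′ throughout a narrow
      -- enough cone: K′ times that entry outweighs c i and s P. The wall is then not crossed and s
      -- persists.
      off-axis : ∀ {a₀} → a₀ ≢ i → c a₀ ≢ 0ℤ → Bend (k ∷ rs)
      off-axis {a₀} a₀≢i c≢0 = record { s = s ; K = K′ ; bend = λ y h l → trans (expand y (near-mono y (ℕₚ.m≤m+n K _) h) l)
          (trans (cong (λ v → v ℤ.* δ k (inj₁ l) ℤ.+ (s ℤ.* ρ y) ℤ.* g (k ∷ rs) l) (⊓-nonneg k (positive y h)))
                 (trans (cong (ℤ._+ (s ℤ.* ρ y) ℤ.* g (k ∷ rs) l) (ℤₚ.*-zeroˡ (δ k (inj₁ l)))) (ℤₚ.+-identityˡ _))) }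
        where
        K′ : ℕ
        K′ = K ℕ.+ (ℤ.∣ c i ∣ ℕ.+ ℤ.∣ s ℤ.* P ∣)
        1≤c : 1ℤ ≤ c a₀
        1≤c = ℤₚ.i<j⇒suc[i]≤j (ℤₚ.≤∧≢⇒< (nonneg a₀) (c≢0 ∘ sym))
        slack : 0ℤ ≤ + K′ ℤ.* c a₀ ℤ.+ ℤ.- (c i ℤ.+ s ℤ.* P)
        slack = ℤₚ.i≤j⇒0≤j-i (ℤₚ.≤-trans (ℤₚ.+-mono-≤ (i≤∣i∣ (c i)) (i≤∣i∣ (s ℤ.* P)))
          (ℤₚ.≤-trans (ℤ.+≤+ (ℕₚ.m≤n+m _ K)) (ℤₚ.≤-trans (ℤₚ.≤-reflexive (sym (ℤₚ.*-identityʳ (+ K′)))) (ℤₚ.*-monoˡ-≤-nonNeg (+ K′) 1≤c))))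
        module _ (y : Fin n → ℤ) (h : Near K′ y) where
          -- y moved into the orthant: coordinate i is raised to max(0 , y i), and coordinate a₀ is
          -- lowered by exactly the margin that `Near` grants.
          e : Fin n → ℤ
          e b = (y b ℤ.+ (+ K′ ℤ.* ρ y) ℤ.* unit a₀ b) ℤ.+ (ℤ.- ρ y) ℤ.* unit i b
          -ρ≥0 : 0ℤ ≤ ℤ.- ρ y
          -ρ≥0 = neg-nonpos (ρ≤0 y)
          e≥0 : NonNeg e
          e≥0 b = cases (b ≟ i) (b ≟ a₀)
            where
            cases : Dec (b ≡ i) → Dec (b ≡ a₀) → 0ℤ ≤ e b
            cases (yes refl) _ = subst (0ℤ ≤_)
              (sym (trans (cong₂ (λ u v → (y i ℤ.+ (+ K′ ℤ.* ρ y) ℤ.* u) ℤ.+ (ℤ.- ρ y) ℤ.* v) (unit-other (a₀≢i ∘ sym)) (δ-same i)) (lemma (y i) (+ K′ ℤ.* ρ y) (ρ y))))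
              (ℤₚ.i≤j⇒0≤j-i (ℤₚ.i⊓j≤j 0ℤ (y i)))
              where
              lemma : ∀ y k r → (y ℤ.+ k ℤ.* 0ℤ) ℤ.+ (ℤ.- r) ℤ.* 1ℤ ≡ y ℤ.+ ℤ.- r
              lemma = solve-∀
            cases (no b≢i) (yes refl) = subst (0ℤ ≤_)
              (sym (trans (cong₂ (λ u v → (y a₀ ℤ.+ (+ K′ ℤ.* ρ y) ℤ.* u) ℤ.+ (ℤ.- ρ y) ℤ.* v) (δ-same a₀) (unit-other b≢i)) (lemma (y a₀) (+ K′ ℤ.* ρ y) (ρ y))))
              (h a₀ b≢i)
              where
              lemma : ∀ y k r → (y ℤ.+ k ℤ.* 1ℤ) ℤ.+ (ℤ.- r) ℤ.* 0ℤ ≡ y ℤ.+ k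
              lemma = solve-∀
            cases (no b≢i) (no b≢a₀) = subst (0ℤ ≤_)
              (sym (trans (cong₂ (λ u v → (y b ℤ.+ (+ K′ ℤ.* ρ y) ℤ.* u) ℤ.+ (ℤ.- ρ y) ℤ.* v) (unit-other b≢a₀) (unit-other b≢i)) (lemma (y b) (+ K′ ℤ.* ρ y) (ρ y))))
              (subst (0ℤ ≤_) (ℤₚ.+-identityʳ (y b)) (near-mono {0} {K′} y ℕ.z≤n h b b≢i))
              where
              lemma : ∀ y k r → (y ℤ.+ k ℤ.* 0ℤ) ℤ.+ (ℤ.- r) ℤ.* 0ℤ ≡ y
              lemma = solve-∀
          positive : 0ℤ ≤ dot c (y′ y)
          positive = subst (0ℤ ≤_) (sym total) (ℤₚ.+-mono-≤ (dot-nonneg c e nonneg e≥0) (*-nonneg -ρ≥0 slack))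
            where
            open ≡-Reasoning
            dot-e : dot c e ≡ (dot c y ℤ.+ (+ K′ ℤ.* ρ y) ℤ.* c a₀) ℤ.+ (ℤ.- ρ y) ℤ.* c i
            dot-e = trans (dot-comb c (ℤ.- ρ y) _ (unit i)) (cong₂ (λ u v → u ℤ.+ (ℤ.- ρ y) ℤ.* v)
              (trans (dot-comb c (+ K′ ℤ.* ρ y) y (unit a₀)) (cong (λ v → dot c y ℤ.+ (+ K′ ℤ.* ρ y) ℤ.* v) (dot-unitʳ c a₀))) (dot-unitʳ c i))
            lemma : ∀ y k r c₀ cᵢ s P → y ℤ.+ (s ℤ.* r) ℤ.* P
              ≡ ((y ℤ.+ (k ℤ.* r) ℤ.* c₀) ℤ.+ (ℤ.- r) ℤ.* cᵢ) ℤ.+ (ℤ.- r) ℤ.* (k ℤ.* c₀ ℤ.+ ℤ.- (cᵢ ℤ.+ s ℤ.* P))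
            lemma = solve-∀
            total : dot c (y′ y) ≡ dot c e ℤ.+ (ℤ.- ρ y) ℤ.* (+ K′ ℤ.* c a₀ ℤ.+ ℤ.- (c i ℤ.+ s ℤ.* P))
            total = begin
              dot c (y′ y)                     ≡⟨ dot-comb c (s ℤ.* ρ y) y (λ a → ε a i) ⟩
              dot c y ℤ.+ (s ℤ.* ρ y) ℤ.* P    ≡⟨ lemma (dot c y) (+ K′) (ρ y) (c a₀) (c i) s P ⟩
              _                                ≡⟨ cong (ℤ._+ (ℤ.- ρ y) ℤ.* (+ K′ ℤ.* c a₀ ℤ.+ ℤ.- (c i ℤ.+ s ℤ.* P))) (sym dot-e) ⟩
              dot c e ℤ.+ (ℤ.- ρ y) ℤ.* (+ K′ ℤ.* c a₀ ℤ.+ ℤ.- (c i ℤ.+ s ℤ.* P)) ∎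

      -- Here W k is a multiple of κ i, so that g (k ∷ rs) is supported at k.
      on-axis : (∀ a → a ≢ i → c a ≡ 0ℤ) → Bend (k ∷ rs)
      on-axis axis = record { s = s ℤ.+ ℤ.- (R k ℤ.* m ℤ.* u) ; K = K ; bend = λ y h l → trans (expand y h l)
          (trans (cong (λ v → v ℤ.* δ k (inj₁ l) ℤ.+ (s ℤ.* ρ y) ℤ.* g (k ∷ rs) l) (z-eq y))
                 (combine y l)) }
        where
        m u : ℤ
        m = c i
        u = W k (inj₁ i)
        z-eq : ∀ y → z y ≡ R k ℤ.* (m ℤ.* ρ y)
        z-eq y = begin
          0ℤ ℤ.⊓ (R k ℤ.* dot c (y′ y))            ≡⟨ cong (λ v → 0ℤ ℤ.⊓ (R k ℤ.* v)) (trans (Trop.pairFin-single i c (y′ y) (λ a ne → inj₁ (axis a ne)))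
                                                        (cong (m ℤ.*_) (trans (cong (λ v → y i ℤ.+ (s ℤ.* ρ y) ℤ.* v) ε-diag) (trans (cong (λ v → y i ℤ.+ v) (ℤₚ.*-zeroʳ (s ℤ.* ρ y))) (ℤₚ.+-identityʳ (y i)))))) ⟩
          0ℤ ℤ.⊓ (R k ℤ.* (m ℤ.* y i))             ≡⟨ sym (⊓-scale (R k) (ℤ.+≤+ ℕ.z≤n) (m ℤ.* y i)) ⟩
          R k ℤ.* (0ℤ ℤ.⊓ (m ℤ.* y i))             ≡⟨ cong (R k ℤ.*_) (sym (⊓-scale m (nonneg i) (y i))) ⟩
          R k ℤ.* (m ℤ.* ρ y)                      ∎
          where
          open ≡-Reasoning
          ⊓-scale : ∀ x → 0ℤ ≤ x → ∀ y → x ℤ.* (0ℤ ℤ.⊓ y) ≡ 0ℤ ℤ.⊓ (x ℤ.* y)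
          ⊓-scale x hx y = trans (ℤₚ.*-distribˡ-⊓-nonNeg x 0ℤ y {{ℤ.nonNegative hx}}) (cong (ℤ._⊓ (x ℤ.* y)) (ℤₚ.*-zeroʳ x))
        W-off : ∀ a → a ≢ i → W k (inj₁ a) ≡ 0ℤ
        W-off a ne = ℤₚ.*-cancelˡ-≡ (+ d a) (W k (inj₁ a)) 0ℤ (trans (duality k a)
          (trans (cong (+ d k ℤ.*_) (trans (B-eq k (inj₂ a)) (trans (cong (sgn ℤ.*_) (axis a ne)) (ℤₚ.*-zeroʳ sgn))))
                 (trans (ℤₚ.*-zeroʳ (+ d k)) (sym (ℤₚ.*-zeroʳ (+ d a))))))
        W-eq : W k ≗ zeroW ⊞ u ⊙ κ i
        W-eq (inj₁ a) = trans (cases (a ≟ i)) (sym (ℤₚ.+-identityˡ _))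
          where
          cases : Dec (a ≡ i) → W k (inj₁ a) ≡ u ℤ.* unit i a
          cases (yes refl) = sym (trans (cong (u ℤ.*_) (δ-same i)) (ℤₚ.*-identityʳ u))
          cases (no ne) = trans (W-off a ne) (sym (trans (cong (u ℤ.*_) (unit-other ne)) (ℤₚ.*-zeroʳ u)))
        W-eq (inj₂ a) = trans (lemma (ε a i ℤ.* u) (W k (inj₂ a))) (trans (cong (ℤ._+ ℤ.- (ε a i ℤ.* u)) kernel) (lemma′ (ε a i) u))
          where
          kernel : ε a i ℤ.* u ℤ.+ W k (inj₂ a) ≡ 0ℤ
          kernel = trans (sym (trans (Trop.pair-def (B₀ a) (W k)) (cong₂ ℤ._+_
            (Trop.pairFin-single i (ε a) (W k ∘ inj₁) (λ b ne → inj₂ (W-off b ne))) (dot-unitˡ a (W k ∘ inj₂))))) (W-ker k a)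
          lemma : ∀ x w → w ≡ (x ℤ.+ w) ℤ.+ ℤ.- x
          lemma = solve-∀
          lemma′ : ∀ e u → 0ℤ ℤ.+ ℤ.- (e ℤ.* u) ≡ 0ℤ ℤ.+ u ℤ.* (ℤ.- e)
          lemma′ = solve-∀
        -- W k is u κ i, and its image after the mutation is -δ k. This turns the kink in coordinate
        -- k into a multiple of g and explains the new value of s.
        g-supported : ∀ l → u ℤ.* g (k ∷ rs) l ≡ ℤ.- δ k (inj₁ l)
        g-supported l = begin
          u ℤ.* g (k ∷ rs) l                                             ≡⟨ sym (ℤₚ.+-identityˡ _) ⟩
          0ℤ ℤ.+ u ℤ.* g (k ∷ rs) l                                      ≡⟨ cong (ℤ._+ u ℤ.* g (k ∷ rs) l) (sym (X-zeroW (k ∷ rs) l)) ⟩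
          X (k ∷ rs) zeroW (inj₁ l) ℤ.+ u ℤ.* g (k ∷ rs) l               ≡⟨ sym (X-linear (k ∷ rs) (κ-ker i) u zeroW (inj₁ l)) ⟩
          X (k ∷ rs) (zeroW ⊞ u ⊙ κ i) (inj₁ l)                          ≡⟨ sym (X-cong (k ∷ rs) W-eq (inj₁ l)) ⟩
          X (k ∷ rs) (W k) (inj₁ l)                                      ≡⟨ next-X-Wₖ (invariant rs) k (signed-M rs k) l ⟩
          ℤ.- δ k (inj₁ l)                                               ∎
          where open ≡-Reasoning
        combine : ∀ y l → (R k ℤ.* (m ℤ.* ρ y)) ℤ.* δ k (inj₁ l) ℤ.+ (s ℤ.* ρ y) ℤ.* g (k ∷ rs) l
          ≡ ((s ℤ.+ ℤ.- (R k ℤ.* m ℤ.* u)) ℤ.* ρ y) ℤ.* g (k ∷ rs) l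
        combine y l = sym (trans (lemma s (R k) m u (ρ y) (g (k ∷ rs) l))
          (trans (cong (λ v → (s ℤ.* ρ y) ℤ.* g (k ∷ rs) l ℤ.+ ℤ.- ((R k ℤ.* m ℤ.* ρ y) ℤ.* v)) (g-supported l))
                 (lemma′ (R k) m (ρ y) (δ k (inj₁ l)) ((s ℤ.* ρ y) ℤ.* g (k ∷ rs) l))))
          where
          lemma : ∀ s r m u ρ g → ((s ℤ.+ ℤ.- (r ℤ.* m ℤ.* u)) ℤ.* ρ) ℤ.* g ≡ (s ℤ.* ρ) ℤ.* g ℤ.+ ℤ.- ((r ℤ.* m ℤ.* ρ) ℤ.* (u ℤ.* g))
          lemma = solve-∀
          lemma′ : ∀ r m ρ e x → x ℤ.+ ℤ.- ((r ℤ.* m ℤ.* ρ) ℤ.* (ℤ.- e)) ≡ (r ℤ.* (m ℤ.* ρ)) ℤ.* e ℤ.+ x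
          lemma′ = solve-∀

      next-bend : Bend (k ∷ rs)
      next-bend with any? (λ a → OffAxis? a)
        where
        OffAxis? : ∀ a → Dec (a ≢ i × c a ≢ 0ℤ)
        OffAxis? a with a ≟ i | c a ℤₚ.≟ 0ℤ
        ... | yes e | _     = no (λ h → proj₁ h e)
        ... | no _  | yes e = no (λ h → proj₂ h e)
        ... | no ne | no nz = yes (ne , nz)
      ... | yes (a₀ , ne , nz) = off-axis ne nz
      ... | no none = on-axis axis
        where
        axis : ∀ a → a ≢ i → c a ≡ 0ℤ
        axis a ne with c a ℤₚ.≟ 0ℤ
        ... | yes e = e
        ... | no nz = ⊥-elim (none (a , ne , nz))

    bends : ∀ rs → Bend rs
    bends []       = record { s = 0ℤ ; K = 0 ; bend = λ y h l → refl }
    bends (k ∷ rs) = NextBend.next-bend k (bends rs)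

    module _ (rs : List (Fin n)) where
      open Bend (bends rs)

      private
        -- K₁ serves two purposes: it places y₂ in the cone where `bend` holds, and it keeps sum +
        -- r_i ε nonnegative away from i.
        bound = bounded-above (λ a → ℤ.- (R i ℤ.* ε a i))
        K₁ : ℤ
        K₁ = + (K ℕ.+ proj₁ bound)

        y± : ℤ → Fin n → ℤ
        y± e a = (K₁ ℤ.+ (ℤ.- K₁) ℤ.* unit i a) ℤ.+ e ℤ.* unit i a

        y±-i : ∀ e → y± e i ≡ e
        y±-i e = trans (cong₂ (λ u v → (K₁ ℤ.+ (ℤ.- K₁) ℤ.* u) ℤ.+ e ℤ.* v) (δ-same i) (δ-same i)) (lemma K₁ e)
          where
          lemma : ∀ k e → (k ℤ.+ (ℤ.- k) ℤ.* 1ℤ) ℤ.+ e ℤ.* 1ℤ ≡ e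
          lemma = solve-∀

        y±-other : ∀ e {a} → a ≢ i → y± e a ≡ K₁
        y±-other e ne = trans (cong₂ (λ u v → (K₁ ℤ.+ (ℤ.- K₁) ℤ.* u) ℤ.+ e ℤ.* v) (unit-other ne) (unit-other ne)) (lemma K₁ e)
          where
          lemma : ∀ k e → (k ℤ.+ (ℤ.- k) ℤ.* 0ℤ) ℤ.+ e ℤ.* 0ℤ ≡ k
          lemma = solve-∀

        y₁ y₂ sum shifted : Fin n → ℤ
        y₁ = y± 1ℤ
        y₂ = y± ℤ.-1ℤ
        sum a = y₁ a ℤ.+ y₂ a
        shifted a = sum a ℤ.+ R i ℤ.* ε a i

        K₁≥0 : 0ℤ ≤ K₁
        K₁≥0 = ℤ.+≤+ ℕ.z≤n

        sum-i : sum i ≡ 0ℤ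
        sum-i = cong₂ ℤ._+_ (y±-i 1ℤ) (y±-i ℤ.-1ℤ)

        sum-other : ∀ {a} → a ≢ i → sum a ≡ K₁ ℤ.+ K₁
        sum-other ne = cong₂ ℤ._+_ (y±-other 1ℤ ne) (y±-other ℤ.-1ℤ ne)

        ρ-y₂ : ρ y₂ ≡ ℤ.-1ℤ
        ρ-y₂ = cong (0ℤ ℤ.⊓_) (y±-i ℤ.-1ℤ)

        nonneg-bend : ∀ y → 0ℤ ≤ y i → (∀ a → a ≢ i → 0ℤ ≤ y a) → ∀ l → X rs (frozen y) (inj₁ l) ≡ 0ℤ
        nonneg-bend y hᵢ h l = Invariant.X-zero (invariant rs) y all l
          where
          all : NonNeg y
          all a with a ≟ i
          ... | yes refl = hᵢ
          ... | no ne    = h a ne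

        y₁-zero : ∀ l → X rs (frozen y₁) (inj₁ l) ≡ 0ℤ
        y₁-zero = nonneg-bend y₁ (subst (0ℤ ≤_) (sym (y±-i 1ℤ)) (ℤ.+≤+ ℕ.z≤n)) (λ a ne → subst (0ℤ ≤_) (sym (y±-other 1ℤ ne)) K₁≥0)

        y₂-value : ∀ l → X rs (frozen y₂) (inj₁ l) ≡ ℤ.- (s ℤ.* g rs l)
        y₂-value l = trans (bend y₂ near l) (trans (cong (λ v → (s ℤ.* v) ℤ.* g rs l) ρ-y₂) (lemma s (g rs l)))
          where
          lemma : ∀ s g → (s ℤ.* ℤ.-1ℤ) ℤ.* g ≡ ℤ.- (s ℤ.* g)
          lemma = solve-∀
          near : Near K y₂
          near a ne = subst (0ℤ ≤_) (sym (trans (cong₂ (λ u v → u ℤ.+ + K ℤ.* v) (y±-other ℤ.-1ℤ ne) ρ-y₂) (cong (λ v → K₁ ℤ.+ v) (trans (ℤₚ.*-comm (+ K) ℤ.-1ℤ) (ℤₚ.-1*i≡-i (+ K))))))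
            (ℤₚ.i≤j⇒0≤j-i (ℤ.+≤+ (ℕₚ.m≤m+n K _)))

        sum-zero : ∀ l → X rs (frozen sum) (inj₁ l) ≡ 0ℤ
        sum-zero = nonneg-bend sum (ℤₚ.≤-reflexive (sym sum-i)) (λ a ne → subst (0ℤ ≤_) (sym (sum-other ne)) (ℤ.+≤+ ℕ.z≤n))

        shifted-zero : ∀ l → X rs (frozen shifted) (inj₁ l) ≡ 0ℤ
        shifted-zero = nonneg-bend shifted (ℤₚ.≤-reflexive (sym (trans (cong₂ (λ u v → u ℤ.+ R i ℤ.* v) sum-i ε-diag) (trans (ℤₚ.+-identityˡ _) (ℤₚ.*-zeroʳ (R i))))))
          (λ a ne → subst (0ℤ ≤_) (cong₂ ℤ._+_ (sym (sum-other ne)) (ℤₚ.neg-involutive (R i ℤ.* ε a i)))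
            (ℤₚ.i≤j⇒0≤j-i (ℤₚ.≤-trans (proj₂ bound a) (ℤ.+≤+ (ℕₚ.≤-trans (ℕₚ.m≤n+m _ K) (ℕₚ.m≤m+n _ (K ℕ.+ proj₁ bound)))))))

        frozen-sum : frozen y₁ ⊞ frozen y₂ ≗ frozen sum
        frozen-sum (inj₁ _) = refl
        frozen-sum (inj₂ _) = refl

      -- y₁ and y₂ lie one step on either side of the facet and their sum on it, with values 0, -s g
      -- and 0; superadditivity in the initial seed compares them.
      bend-nonneg : ∀ l → 0ℤ ≤ s ℤ.* g rs l
      bend-nonneg l = subst (0ℤ ≤_) (ℤₚ.neg-involutive _) (neg-nonpos (subst₂ _≤_ left right
        (superadditive (reverse rs) good-B₀ (inj₁ l) (frozen y₁) (frozen y₂))))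
        where
        toX : ∀ w → run (reverse rs) B₀ w (inj₁ l) ≡ X rs w (inj₁ l)
        toX w = cong (λ v → v (inj₁ l)) (sym (X-run rs w))
        left : run (reverse rs) B₀ (frozen y₁) (inj₁ l) ℤ.+ run (reverse rs) B₀ (frozen y₂) (inj₁ l) ≡ ℤ.- (s ℤ.* g rs l)
        left = trans (cong₂ ℤ._+_ (trans (toX _) (y₁-zero l)) (trans (toX _) (y₂-value l))) (ℤₚ.+-identityˡ _)
        right : run (reverse rs) B₀ (frozen y₁ ⊞ frozen y₂) (inj₁ l) ≡ 0ℤ
        right = trans (toX _) (trans (X-cong rs frozen-sum (inj₁ l)) (sum-zero l))

      -- In the seed mutated at i the same two vectors add up with the extra r_i δ i of `step-bend`.
      -- This sum is r_i κ i plus a nonnegative frozen vector, so its value is r_i g, and -s g ≤ r_i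
      -- g follows.
      bend-bounded : ∀ l → 0ℤ ≤ (s ℤ.+ R i) ℤ.* g rs l
      bend-bounded l = subst (0ℤ ≤_) (lemma s (R i) (g rs l)) (ℤₚ.i≤j⇒0≤j-i (subst₂ _≤_ left right
        (superadditive (i ∷ reverse rs) (good-μ i good-B₀) (inj₁ l) (step i B₀ (frozen y₁)) (step i B₀ (frozen y₂)))))
        where
        lemma : ∀ s r g → r ℤ.* g ℤ.+ ℤ.- (ℤ.- (s ℤ.* g)) ≡ (s ℤ.+ r) ℤ.* g
        lemma = solve-∀
        back : ∀ w → run (i ∷ reverse rs) (μ i B₀) (step i B₀ w) (inj₁ l) ≡ X rs w (inj₁ l)
        back w = trans (run-step i good-B₀ (reverse rs) w (inj₁ l)) (cong (λ v → v (inj₁ l)) (sym (X-run rs w)))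
        left : run (i ∷ reverse rs) (μ i B₀) (step i B₀ (frozen y₁)) (inj₁ l) ℤ.+ run (i ∷ reverse rs) (μ i B₀) (step i B₀ (frozen y₂)) (inj₁ l)
          ≡ ℤ.- (s ℤ.* g rs l)
        left = trans (cong₂ ℤ._+_ (trans (back _) (y₁-zero l)) (trans (back _) (y₂-value l))) (ℤₚ.+-identityˡ _)
        u = frozen sum ⊞ (R i ℤ.* 1ℤ) ⊙ δ i
        u-eq : u ≗ frozen shifted ⊞ R i ⊙ κ i
        u-eq (inj₁ l) = cong (λ v → 0ℤ ℤ.+ v ℤ.* unit i l) (ℤₚ.*-identityʳ (R i))
        u-eq (inj₂ a) = lemma′ (sum a) (R i) (ε a i)
          where
          lemma′ : ∀ x r e → x ℤ.+ (r ℤ.* 1ℤ) ℤ.* 0ℤ ≡ (x ℤ.+ r ℤ.* e) ℤ.+ r ℤ.* (ℤ.- e)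
          lemma′ = solve-∀
        right : run (i ∷ reverse rs) (μ i B₀) (step i B₀ (frozen y₁) ⊞ step i B₀ (frozen y₂)) (inj₁ l) ≡ R i ℤ.* g rs l
        right = begin
          run (i ∷ reverse rs) (μ i B₀) (step i B₀ (frozen y₁) ⊞ step i B₀ (frozen y₂)) (inj₁ l)
            ≡⟨ run-cong (i ∷ reverse rs) {μ i B₀} {μ i B₀} (λ _ _ → refl)
                 (step-bend i good-B₀ y₁ y₂ 1ℤ (ℤ.+≤+ ℕ.z≤n) (trans (dot-unitˡ i y₁) (y±-i 1ℤ)) (trans (dot-unitˡ i y₂) (y±-i ℤ.-1ℤ))) (inj₁ l) ⟩
          run (i ∷ reverse rs) (μ i B₀) (step i B₀ u) (inj₁ l)        ≡⟨ back u ⟩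
          X rs u (inj₁ l)                                             ≡⟨ X-cong rs u-eq (inj₁ l) ⟩
          X rs (frozen shifted ⊞ R i ⊙ κ i) (inj₁ l)                  ≡⟨ X-linear rs (κ-ker i) (R i) (frozen shifted) (inj₁ l) ⟩
          X rs (frozen shifted) (inj₁ l) ℤ.+ R i ℤ.* g rs l           ≡⟨ cong (ℤ._+ R i ℤ.* g rs l) (shifted-zero l) ⟩
          0ℤ ℤ.+ R i ℤ.* g rs l                                       ≡⟨ ℤₚ.+-identityˡ _ ⟩
          R i ℤ.* g rs l                                              ∎
          where open ≡-Reasoning

      g-coherent : Coherent (g rs)
      g-coherent with ℤₚ.<-cmp s 0ℤ
      ... | Tri.tri> _ _ s>0 = inj₁ (λ l → *-cancel-nonneg s>0 (bend-nonneg l))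
      -- For s = 0 the initial seed gives no information, and the mutated seed yields r_i g ≥ 0.
      ... | Tri.tri≈ _ s≡0 _ = inj₁ (λ l → *-cancel-nonneg (R-pos i)
            (subst (λ v → 0ℤ ≤ v ℤ.* g rs l) (trans (cong (ℤ._+ R i) s≡0) (ℤₚ.+-identityˡ (R i))) (bend-bounded l)))
      ... | Tri.tri< s<0 _ _ = inj₂ (λ l → subst (_≤ 0ℤ) (ℤₚ.neg-involutive (g rs l)) (neg-nonneg
            (*-cancel-nonneg (ℤₚ.neg-mono-< s<0) (subst (0ℤ ≤_) (lemma s (g rs l)) (bend-nonneg l)))))
        where
        lemma : ∀ s g → s ℤ.* g ≡ (ℤ.- s) ℤ.* (ℤ.- g)
        lemma = solve-∀

-- Reading g-vectors off at positive points of the field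

module FieldPoints {c ℓ : Level} (F : Field c ℓ) (charZero : CharZero F) where
  open Field F hiding (zero) renaming (refl to ≈-refl; sym to ≈-sym; trans to ≈-trans; reflexive to ≈-reflexive)
  module ≈R = Relation.Binary.Reasoning.Setoid setoid
  module MS = Algebra.Solver.CommutativeMonoid *-commutativeMonoid
  open MS using (_⊕_; _⊜_)
  open Algebra.Properties.Ring ring using (+-cancelˡ)

  ν : ℕ → Carrier
  ν = natF F

  ν-+ : ∀ a b → ν (a ℕ.+ b) ≈ ν a + ν b
  ν-+ zero    b = ≈-sym (+-identityˡ (ν b))
  ν-+ (suc a) b = ≈-trans (+-congˡ (ν-+ a b)) (≈-sym (+-assoc 1# (ν a) (ν b)))

  ν-* : ∀ a b → ν (a ℕ.* b) ≈ ν a * ν b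
  ν-* zero    b = ≈-sym (zeroˡ (ν b))
  ν-* (suc a) b = ≈-trans (ν-+ b (a ℕ.* b)) (≈-trans (+-cong (≈-sym (*-identityˡ (ν b))) (ν-* a b)) (≈-sym (distribʳ (ν b) 1# (ν a))))

  unit-nonzero : ∀ {x y} → x * y ≈ 1# → ¬ (x ≈ 0#)
  unit-nonzero {x} {y} e x≈0 = 1≉0 (≈-trans (≈-sym e) (≈-trans (*-congʳ x≈0) (zeroˡ y)))

  inverse-unique : ∀ {x y} → x * y ≈ 1# → y ≈ x ⁻¹
  inverse-unique {x} {y} e = begin
    y                  ≈⟨ *-identityˡ y ⟨
    1# * y             ≈⟨ *-congʳ (⁻¹-inverse x (unit-nonzero e)) ⟨
    (x * x ⁻¹) * y     ≈⟨ MS.solve 3 (λ x x′ y → (x ⊕ x′) ⊕ y ⊜ x′ ⊕ (x ⊕ y)) ≈-refl x (x ⁻¹) y ⟩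
    x ⁻¹ * (x * y)     ≈⟨ *-congˡ e ⟩
    x ⁻¹ * 1#          ≈⟨ *-identityʳ (x ⁻¹) ⟩
    x ⁻¹               ∎
    where open ≈R

  -- Quotients of positive integers inside the field. In characteristic zero they are nonzero, and
  -- closure under sums, products and inverses keeps every cluster variable at the all-ones point
  -- among them.
  Positive : Carrier → Set ℓ
  Positive x = ∃ λ a → ∃ λ b → ν (suc b) * x ≈ ν (suc a)

  positive-nonzero : ∀ {x} → Positive x → ¬ (x ≈ 0#)
  positive-nonzero (a , b , e) x≈0 = charZero a (≈-trans (≈-sym e) (≈-trans (*-congˡ x≈0) (zeroʳ (ν (suc b)))))

  positive-resp : ∀ {x y} → x ≈ y → Positive x → Positive y
  positive-resp x≈y (a , b , e) = a , b , ≈-trans (*-congˡ (≈-sym x≈y)) e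

  positive-1 : Positive 1#
  positive-1 = 0 , 0 , *-identityʳ (ν 1)

  positive-+ : ∀ {x y} → Positive x → Positive y → Positive (x + y)
  positive-+ {x} {y} (a , b , e) (a′ , b′ , e′) = a ℕ.+ b′ ℕ.* suc a ℕ.+ suc b ℕ.* suc a′ , b′ ℕ.+ b ℕ.* suc b′ , (begin
    ν (suc b ℕ.* suc b′) * (x + y)                              ≈⟨ *-congʳ (ν-* (suc b) (suc b′)) ⟩
    (ν (suc b) * ν (suc b′)) * (x + y)                          ≈⟨ distribˡ _ x y ⟩
    (ν (suc b) * ν (suc b′)) * x + (ν (suc b) * ν (suc b′)) * y
      ≈⟨ +-cong (MS.solve 3 (λ p q x → (p ⊕ q) ⊕ x ⊜ q ⊕ (p ⊕ x)) ≈-refl (ν (suc b)) (ν (suc b′)) x) (*-assoc _ _ y) ⟩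
    ν (suc b′) * (ν (suc b) * x) + ν (suc b) * (ν (suc b′) * y) ≈⟨ +-cong (*-congˡ e) (*-congˡ e′) ⟩
    ν (suc b′) * ν (suc a) + ν (suc b) * ν (suc a′)             ≈⟨ +-cong (ν-* (suc b′) (suc a)) (ν-* (suc b) (suc a′)) ⟨
    ν (suc b′ ℕ.* suc a) + ν (suc b ℕ.* suc a′)                 ≈⟨ ν-+ (suc b′ ℕ.* suc a) (suc b ℕ.* suc a′) ⟨
    ν (suc b′ ℕ.* suc a ℕ.+ suc b ℕ.* suc a′)                   ∎)
    where open ≈R

  positive-* : ∀ {x y} → Positive x → Positive y → Positive (x * y)
  positive-* {x} {y} (a , b , e) (a′ , b′ , e′) = a′ ℕ.+ a ℕ.* suc a′ , b′ ℕ.+ b ℕ.* suc b′ , (begin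
    ν (suc b ℕ.* suc b′) * (x * y)          ≈⟨ *-congʳ (ν-* (suc b) (suc b′)) ⟩
    (ν (suc b) * ν (suc b′)) * (x * y)      ≈⟨ MS.solve 4 (λ p q x y → (p ⊕ q) ⊕ (x ⊕ y) ⊜ (p ⊕ x) ⊕ (q ⊕ y)) ≈-refl (ν (suc b)) (ν (suc b′)) x y ⟩
    (ν (suc b) * x) * (ν (suc b′) * y)      ≈⟨ *-cong e e′ ⟩
    ν (suc a) * ν (suc a′)                  ≈⟨ ν-* (suc a) (suc a′) ⟨
    ν (suc a ℕ.* suc a′)                    ∎)
    where open ≈R

  positive-⁻¹ : ∀ {x} → Positive x → Positive (x ⁻¹)
  positive-⁻¹ {x} px@(a , b , e) = b , a , (begin
    ν (suc a) * x ⁻¹           ≈⟨ *-congʳ e ⟨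
    (ν (suc b) * x) * x ⁻¹     ≈⟨ *-assoc _ x _ ⟩
    ν (suc b) * (x * x ⁻¹)     ≈⟨ *-congˡ (⁻¹-inverse x (positive-nonzero px)) ⟩
    ν (suc b) * 1#             ≈⟨ *-identityʳ _ ⟩
    ν (suc b)                  ∎)
    where open ≈R

  two : Carrier
  two = ν 2

  two-nonzero : ¬ (two ≈ 0#)
  two-nonzero = charZero 1

  module Equivariance {n : ℕ} (D : GenFixedData n) where
    open GenFixedData D using (r; ε)
    open GenCluster F D
    module Mu = Mutation D
    open Mu using (μ; R; _≗₂_)
    open GoodMatrices D
    open Good
    module E = Seeds D tropical
    open Kernel D using (Weight; Ker; ker-step; exchange-ker; unit)
    open Frames D using (B₀; good-B₀; κ; κ-ker)

    mutMat-μ : ∀ k B → B k (inj₁ k) ≡ 0ℤ → mutMat k B ≗₂ μ k B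
    mutMat-μ k B diag c l with c ≟ k
    ... | yes _ = refl
    mutMat-μ k B diag c (inj₂ l) | no _ = lemma (B c (inj₂ l)) (R k) (B c (inj₁ k) ⁺) (B k (inj₂ l)) (B c (inj₁ k)) ((ℤ.- B k (inj₂ l)) ⁺)
      where
      lemma : ∀ x r bp K b Km → x ℤ.+ r ℤ.* (bp ℤ.* K ℤ.+ b ℤ.* Km) ≡ (x ℤ.+ ((r ℤ.* bp) ℤ.* K ℤ.+ b ℤ.* (r ℤ.* Km))) ℤ.+ (ℤ.- + 2 ℤ.* b) ℤ.* 0ℤ
      lemma = solve-∀
    mutMat-μ k B diag c (inj₁ l) | no _ with l ≟ k
    ... | no _ = lemma (B c (inj₁ l)) (R k) (B c (inj₁ k) ⁺) (B k (inj₁ l)) (B c (inj₁ k)) ((ℤ.- B k (inj₁ l)) ⁺)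
      where
      lemma : ∀ x r bp K b Km → x ℤ.+ r ℤ.* (bp ℤ.* K ℤ.+ b ℤ.* Km) ≡ (x ℤ.+ ((r ℤ.* bp) ℤ.* K ℤ.+ b ℤ.* (r ℤ.* Km))) ℤ.+ (ℤ.- + 2 ℤ.* b) ℤ.* 0ℤ
      lemma = solve-∀
    ... | yes refl rewrite diag = lemma (B c (inj₁ k)) (R k) (B c (inj₁ k) ⁺)
      where
      lemma : ∀ b r bp → ℤ.- b ≡ (b ℤ.+ ((r ℤ.* bp) ℤ.* 0ℤ ℤ.+ b ℤ.* (r ℤ.* 0ℤ))) ℤ.+ (ℤ.- + 2 ℤ.* b) ℤ.* 1ℤ
      lemma = solve-∀

    initMat-B₀ : initMat ≗₂ B₀
    initMat-B₀ i (inj₁ j) = refl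
    initMat-B₀ i (inj₂ j) with i ≟ j | j ≟ i
    ... | yes _ | yes _ = refl
    ... | no _  | no _  = refl
    ... | yes e | no ne = ⊥-elim (ne (sym e))
    ... | no ne | yes e = ⊥-elim (ne (sym e))

    ^ℕ-cong : ∀ {x y} m → x ≈ y → x ^ℕ m ≈ y ^ℕ m
    ^ℕ-cong zero    e = ≈-refl
    ^ℕ-cong (suc m) e = *-cong e (^ℕ-cong m e)

    ^ℕ-+ : ∀ x a b → x ^ℕ (a ℕ.+ b) ≈ x ^ℕ a * x ^ℕ b
    ^ℕ-+ x zero    b = ≈-sym (*-identityˡ _)
    ^ℕ-+ x (suc a) b = ≈-trans (*-congˡ (^ℕ-+ x a b)) (≈-sym (*-assoc x _ _))

    ^ℕ-* : ∀ x y m → (x * y) ^ℕ m ≈ x ^ℕ m * y ^ℕ m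
    ^ℕ-* x y zero    = ≈-sym (*-identityˡ 1#)
    ^ℕ-* x y (suc m) = ≈-trans (*-congˡ (^ℕ-* x y m)) (MS.solve 4 (λ x y p q → (x ⊕ y) ⊕ (p ⊕ q) ⊜ (x ⊕ p) ⊕ (y ⊕ q)) ≈-refl x y (x ^ℕ m) (y ^ℕ m))

    ^ℕ-1 : ∀ m → 1# ^ℕ m ≈ 1#
    ^ℕ-1 zero    = ≈-refl
    ^ℕ-1 (suc m) = ≈-trans (*-identityˡ _) (^ℕ-1 m)

    ^ℤ-1 : ∀ {x} → x ≈ 1# → ∀ m → x ^ℤ m ≈ 1#
    ^ℤ-1 e (+ m)    = ≈-trans (^ℕ-cong m e) (^ℕ-1 m)
    ^ℤ-1 {x} e -[1+ m ] = ≈-trans (^ℕ-cong (suc m) (≈-sym (inverse-unique (≈-trans (*-identityʳ x) e)))) (^ℕ-1 (suc m))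

    pw : ℤ → Carrier
    pw a = two ^ℤ a

    pw-⊖ : ∀ a b → pw (a ℤ.⊖ b) ≈ two ^ℕ a * (two ⁻¹) ^ℕ b
    pw-⊖ zero    zero    = ≈-sym (*-identityˡ 1#)
    pw-⊖ zero    (suc b) = ≈-sym (*-identityˡ _)
    pw-⊖ (suc a) zero    = ≈-sym (*-identityʳ _)
    pw-⊖ (suc a) (suc b) = begin
      pw (suc a ℤ.⊖ suc b)                                   ≈⟨ ≈-reflexive (cong pw (ℤₚ.[1+m]⊖[1+n]≡m⊖n a b)) ⟩
      pw (a ℤ.⊖ b)                                           ≈⟨ pw-⊖ a b ⟩
      two ^ℕ a * (two ⁻¹) ^ℕ b                               ≈⟨ *-identityˡ _ ⟨
      1# * (two ^ℕ a * (two ⁻¹) ^ℕ b)                        ≈⟨ *-congʳ (⁻¹-inverse two two-nonzero) ⟨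
      (two * two ⁻¹) * (two ^ℕ a * (two ⁻¹) ^ℕ b)            ≈⟨ MS.solve 4 (λ x y p q → (x ⊕ y) ⊕ (p ⊕ q) ⊜ (x ⊕ p) ⊕ (y ⊕ q)) ≈-refl two (two ⁻¹) (two ^ℕ a) ((two ⁻¹) ^ℕ b) ⟩
      two ^ℕ suc a * (two ⁻¹) ^ℕ suc b                       ∎
      where open ≈R

    pw-+ : ∀ a b → pw (a ℤ.+ b) ≈ pw a * pw b
    pw-+ (+ a)    (+ b)    = ^ℕ-+ two a b
    pw-+ (+ a)    -[1+ b ] = pw-⊖ a (suc b)
    pw-+ -[1+ a ] (+ b)    = ≈-trans (pw-⊖ b (suc a)) (*-comm _ _)
    pw-+ -[1+ a ] -[1+ b ] = ≈-trans (≈-reflexive (cong (λ v → (two ⁻¹) ^ℕ suc v) (sym (ℕₚ.+-suc a b)))) (^ℕ-+ (two ⁻¹) (suc a) (suc b))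

    pw-pow : ∀ a m → (pw a) ^ℕ m ≈ pw (+ m ℤ.* a)
    pw-pow a zero    = ≈-reflexive (cong pw (sym (ℤₚ.*-zeroˡ a)))
    pw-pow a (suc m) = ≈-trans (*-congˡ (pw-pow a m)) (≈-trans (≈-sym (pw-+ a (+ m ℤ.* a))) (≈-reflexive (cong pw (sym (ℤₚ.suc-* (+ m) a)))))

    pw-cancel : ∀ a → pw a * pw (ℤ.- a) ≈ 1#
    pw-cancel a = ≈-trans (≈-sym (pw-+ a (ℤ.- a))) (≈-reflexive (cong pw (ℤₚ.+-inverseʳ a)))

    -- Written as q + 2, the power minus 1 is still a positive integer, hence nonzero in
    -- characteristic zero; so 2 has infinite order.
    two^-large : ∀ m → ∃ λ q → two ^ℕ suc m ≈ ν (suc (suc q))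
    two^-large zero    = 0 , *-identityʳ two
    two^-large (suc m) with two^-large m
    ... | q , e = q ℕ.+ 1 ℕ.* suc (suc q) , ≈-trans (*-congˡ e) (≈-sym (ν-* 2 (suc (suc q))))

    two^≉1 : ∀ m → ¬ (two ^ℕ suc m ≈ 1#)
    two^≉1 m e with two^-large m
    ... | q , e′ = charZero q (+-cancelˡ 1# (ν (suc q)) 0# (≈-trans (≈-sym e′) (≈-trans e (≈-sym (+-identityʳ 1#)))))

    pw≈1 : ∀ a → pw a ≈ 1# → a ≡ 0ℤ
    pw≈1 (+ zero)  e = refl
    pw≈1 (+ suc m) e = ⊥-elim (two^≉1 m e)
    pw≈1 -[1+ m ]  e = ⊥-elim (two^≉1 m (≈-trans (≈-sym (*-identityʳ _)) (≈-trans (*-congˡ (≈-sym e)) (pw-cancel (+ suc m)))))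

    pw-injective : ∀ a b {x} → ¬ (x ≈ 0#) → pw a * x ≈ pw b * x → a ≡ b
    pw-injective a b {x} x≉0 e = ℤₚ.i-j≡0⇒i≡j a b (pw≈1 _ (begin
      pw (a ℤ.+ ℤ.- b)                                ≈⟨ pw-+ a (ℤ.- b) ⟩
      pw a * pw (ℤ.- b)                               ≈⟨ *-congʳ cancel ⟩
      pw b * pw (ℤ.- b)                               ≈⟨ pw-cancel b ⟩
      1#                                              ∎))
      where
      open ≈R
      expand : ∀ y → y ≈ (y * x) * x ⁻¹
      expand y = ≈-sym (≈-trans (*-assoc y x _) (≈-trans (*-congˡ (⁻¹-inverse x x≉0)) (*-identityʳ y)))
      cancel : pw a ≈ pw b
      cancel = ≈-trans (expand (pw a)) (≈-trans (*-congʳ e) (≈-sym (expand (pw b))))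

    ∏-cong : ∀ {m} {f g : Fin m → Carrier} → (∀ l → f l ≈ g l) → ∏Fin f ≈ ∏Fin g
    ∏-cong {zero}  e = ≈-refl
    ∏-cong {suc m} e = *-cong (e zero) (∏-cong (e ∘ suc))

    ∏-one : ∀ {m} {f : Fin m → Carrier} → (∀ l → f l ≈ 1#) → ∏Fin f ≈ 1#
    ∏-one {zero}  e = ≈-refl
    ∏-one {suc m} e = ≈-trans (*-cong (e zero) (∏-one (e ∘ suc))) (*-identityˡ 1#)

    ∏-single : ∀ {m} (f : Fin m → Carrier) i → (∀ l → l ≢ i → f l ≈ 1#) → ∏Fin f ≈ f i
    ∏-single f zero    e = ≈-trans (*-congˡ (∏-one (λ l → e (suc l) λ ()))) (*-identityʳ _)
    ∏-single f (suc i) e = ≈-trans (*-cong (e zero λ ()) (∏-single (f ∘ suc) i (λ l ne → e (suc l) (λ { refl → ne refl })))) (*-identityˡ _)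

    ∏-scale : ∀ {m} (e : Fin m → ℕ) (v : Fin m → ℤ) {x y : Fin m → Carrier} → (∀ l → y l ≈ pw (v l) * x l)
      → ∏Fin (λ l → y l ^ℕ e l) ≈ pw (Trop.pairFin (λ l → + e l) v) * ∏Fin (λ l → x l ^ℕ e l)
    ∏-scale {zero}  e v h = ≈-sym (*-identityˡ 1#)
    ∏-scale {suc m} e v {x} {y} h = begin
      y zero ^ℕ e zero * ∏Fin (λ l → y (suc l) ^ℕ e (suc l))
        ≈⟨ *-cong (≈-trans (^ℕ-cong (e zero) (h zero)) (≈-trans (^ℕ-* _ _ (e zero)) (*-congʳ (pw-pow (v zero) (e zero))))) (∏-scale (e ∘ suc) (v ∘ suc) (h ∘ suc)) ⟩
      (pw (+ e zero ℤ.* v zero) * x zero ^ℕ e zero) * (pw q * ∏Fin (λ l → x (suc l) ^ℕ e (suc l)))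
        ≈⟨ MS.solve 4 (λ a b c d → (a ⊕ b) ⊕ (c ⊕ d) ⊜ (a ⊕ c) ⊕ (b ⊕ d)) ≈-refl _ _ _ _ ⟩
      (pw (+ e zero ℤ.* v zero) * pw q) * ∏Fin (λ l → x l ^ℕ e l)
        ≈⟨ *-congʳ (pw-+ (+ e zero ℤ.* v zero) q) ⟨
      pw (+ e zero ℤ.* v zero ℤ.+ q) * ∏Fin (λ l → x l ^ℕ e l) ∎
      where
      open ≈R
      q = Trop.pairFin (λ l → + e (suc l)) (v ∘ suc)

    ∏-positive : ∀ {m} (e : Fin m → ℕ) {x : Fin m → Carrier} → (∀ l → Positive (x l)) → Positive (∏Fin (λ l → x l ^ℕ e l))
    ∏-positive {zero}  e h = positive-1
    ∏-positive {suc m} e {x} h = positive-* (power (e zero)) (∏-positive (e ∘ suc) (h ∘ suc))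
      where
      power : ∀ k → Positive (x zero ^ℕ k)
      power zero    = positive-1
      power (suc k) = positive-* (h zero) (power k)

    sum-scale : ∀ m (h : ℕ → ℕ) w {f g : ℕ → Carrier} → (∀ j → j ℕ.< m → g (h j) ≈ w * f (h j))
      → foldr _+_ 0# (map g (applyUpTo h m)) ≈ w * foldr _+_ 0# (map f (applyUpTo h m))
    sum-scale zero    h w e = ≈-sym (zeroʳ w)
    sum-scale (suc m) h w e = ≈-trans (+-cong (e 0 (ℕ.s≤s ℕ.z≤n)) (sum-scale m (h ∘ suc) w (λ j lt → e (suc j) (ℕ.s≤s lt)))) (≈-sym (distribˡ w _ _))

    sum-positive : ∀ m (h : ℕ → ℕ) {f : ℕ → Carrier} → (∀ j → Positive (f (h j))) → Positive (foldr _+_ 0# (map f (applyUpTo h (suc m))))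
    sum-positive zero    h p = positive-resp (≈-sym (+-identityʳ _)) (p 0)
    sum-positive (suc m) h p = positive-+ (p 0) (sum-positive m (h ∘ suc) (λ j → p (suc j)))

    exponents : ExtMat n → Fin n → ℕ → Idx n → ℕ
    exponents B k j l = j ℕ.* [ B k l ]₊ ℕ.+ (r k ℕ.∸ j) ℕ.* [ ℤ.- B k l ]₊

    term : Point → State → Fin n → ℕ → Carrier
    term p s k j = coef p k j * (∏Fin (λ l → State.clu s l ^ℕ exponents (State.mat s) k j (inj₁ l))
                                * ∏Fin (λ l → Point.t p l ^ℕ exponents (State.mat s) k j (inj₂ l)))

    clu-same : ∀ p s k → State.clu (step p s k) k ≡ (State.clu s k ⁻¹) * Σupto (r k) (term p s k)
    clu-same p s k with k ≟ k
    ... | yes _ = refl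
    ... | no ne = ⊥-elim (ne refl)

    clu-other : ∀ p s k {l} → l ≢ k → State.clu (step p s k) l ≡ State.clu s l
    clu-other p s k {l} ne with l ≟ k
    ... | yes e = ⊥-elim (ne e)
    ... | no _  = refl

    -- The j-th exponent is j B + r_k [-B]₊, and a kernel vector kills the first summand. So every
    -- term of the exchange polynomial, middle terms included, has the weight of M⁻.
    pair-exponents : ∀ B k j v → Ker B v → j ℕ.≤ r k → ⟨ (λ l → + exponents B k j l) , v ⟩ ≡ E.M⁻ k B v
    pair-exponents B k j v kv j≤r = begin
      ⟨ (λ l → + exponents B k j l) , v ⟩                                        ≡⟨ Trop.pair-cong pointwise (λ _ → refl) ⟩
      ⟨ (λ l → + j ℤ.* B k l ℤ.+ R k ℤ.* (ℤ.- B k l) ⁺) , v ⟩                    ≡⟨ Trop.pair-+ _ _ v ⟩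
      ⟨ (λ l → + j ℤ.* B k l) , v ⟩ ℤ.+ E.M⁻ k B v                               ≡⟨ cong (ℤ._+ E.M⁻ k B v) (trans (Trop.pair-* (+ j) (B k) v) (trans (cong (+ j ℤ.*_) (kv k)) (ℤₚ.*-zeroʳ (+ j)))) ⟩
      0ℤ ℤ.+ E.M⁻ k B v                                                          ≡⟨ ℤₚ.+-identityˡ _ ⟩
      E.M⁻ k B v                                                                 ∎
      where
      open ≡-Reasoning
      lemma : ∀ j b m r → j ℤ.* (b ℤ.+ m) ℤ.+ (r ℤ.+ ℤ.- j) ℤ.* m ≡ j ℤ.* b ℤ.+ r ℤ.* m
      lemma = solve-∀
      pointwise : ∀ l → + exponents B k j l ≡ + j ℤ.* B k l ℤ.+ R k ℤ.* (ℤ.- B k l) ⁺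
      pointwise l = trans (ℤₚ.pos-+ (j ℕ.* [ B k l ]₊) _) (trans (cong₂ ℤ._+_
        (trans (ℤₚ.pos-* j [ B k l ]₊) (cong (+ j ℤ.*_) (⁺-split (B k l))))
        (trans (ℤₚ.pos-* (r k ℕ.∸ j) _) (cong (ℤ._* (ℤ.- B k l) ⁺) (trans (sym (ℤₚ.⊖-≥ j≤r)) (sym (ℤₚ.[+m]-[+n]≡m⊖n (r k) j))))))
        (lemma (+ j) (B k l) ((ℤ.- B k l) ⁺) (R k)))

    coef-1 : ∀ p k j → (∀ i j → Point.a p i j ≈ 1#) → coef p k j ≈ 1#
    coef-1 p k zero    h = ≈-refl
    coef-1 p k (suc j) h with suc j ℕ.≟ r k
    ... | yes _ = ≈-refl
    ... | no _  = h k (suc j)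

    module _ {p p′ : Point} (a≈1 : ∀ i j → Point.a p i j ≈ 1#) (a′≈1 : ∀ i j → Point.a p′ i j ≈ 1#)
      (t-positive : ∀ l → Positive (Point.t p l)) where

      -- Two runs in parallel: the second seed is the first translated by powers of 2 with exponents
      -- v, and v evolves by tropical mutation.
      record Related (s s′ : State) (B : ExtMat n) (v : Weight) : Set (c Level.⊔ ℓ) where
        field
          good     : Good B
          ker      : Ker B v
          mat-s    : State.mat s ≗₂ B
          mat-s′   : State.mat s′ ≗₂ B
          positive : ∀ l → Positive (State.clu s l)
          clu-rel  : ∀ l → State.clu s′ l ≈ pw (v (inj₁ l)) * State.clu s l
          t-rel    : ∀ l → Point.t p′ l ≈ pw (v (inj₂ l)) * Point.t p l

      related-step : ∀ {s s′ B v} k → Related s s′ B v → Related (step p s k) (step p′ s′ k) (μ k B) (E.step k B v)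
      related-step {s} {s′} {B} {v} k rel = record
        { good = good-μ k good ; ker = ker-step k good ker
        ; mat-s = mats mat-s ; mat-s′ = mats mat-s′
        ; positive = clu-positive ; clu-rel = clus ; t-rel = t-rel }
        where
        open Related rel
        mats : ∀ {A} → A ≗₂ B → mutMat k A ≗₂ μ k B
        mats {A} e c l = trans (mutMat-μ k A (trans (e k (inj₁ k)) (diag good k)) c l) (Mu.μ-cong k e c l)
        exponents-eq : ∀ {A} → A ≗₂ B → ∀ j l → exponents A k j l ≡ exponents B k j l
        exponents-eq e j l = cong (λ b → j ℕ.* [ b ]₊ ℕ.+ (r k ℕ.∸ j) ℕ.* [ ℤ.- b ]₊) (e k l)
        newPositive : Positive (Σupto (r k) (term p s k))
        newPositive = sum-positive (r k) (λ j → j) {term p s k} (λ j → positive-*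
          (positive-resp (≈-sym (coef-1 p k j a≈1)) positive-1)
          (positive-* (∏-positive (λ l → exponents (State.mat s) k j (inj₁ l)) positive) (∏-positive (λ l → exponents (State.mat s) k j (inj₂ l)) t-positive)))
        clu-positive : ∀ l → Positive (State.clu (step p s k) l)
        clu-positive l = cases (l ≟ k)
          where
          cases : Dec (l ≡ k) → Positive (State.clu (step p s k) l)
          cases (yes refl) = subst Positive (sym (clu-same p s k)) (positive-* (positive-⁻¹ (positive k)) newPositive)
          cases (no ne)    = subst Positive (sym (clu-other p s k ne)) (positive l)
        term-scale : ∀ j → j ℕ.< suc (r k) → term p′ s′ k j ≈ pw (E.M⁻ k B v) * term p s k j
        term-scale j (ℕ.s≤s j≤r) = begin
          coef p′ k j * (∏Fin (λ l → State.clu s′ l ^ℕ exponents (State.mat s′) k j (inj₁ l)) * ∏Fin (λ l → Point.t p′ l ^ℕ exponents (State.mat s′) k j (inj₂ l)))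
            ≈⟨ *-cong (≈-trans (coef-1 p′ k j a′≈1) (≈-sym (coef-1 p k j a≈1)))
                 (*-cong (∏-cong (λ l → ≈-reflexive (cong (State.clu s′ l ^ℕ_) (trans (exponents-eq mat-s′ j (inj₁ l)) (sym (exponents-eq mat-s j (inj₁ l)))))))
                         (∏-cong (λ l → ≈-reflexive (cong (Point.t p′ l ^ℕ_) (trans (exponents-eq mat-s′ j (inj₂ l)) (sym (exponents-eq mat-s j (inj₂ l)))))))) ⟩
          coef p k j * (∏Fin (λ l → State.clu s′ l ^ℕ ex (inj₁ l)) * ∏Fin (λ l → Point.t p′ l ^ℕ ex (inj₂ l)))
            ≈⟨ *-congˡ (*-cong (∏-scale (ex ∘ inj₁) (v ∘ inj₁) clu-rel) (∏-scale (ex ∘ inj₂) (v ∘ inj₂) t-rel)) ⟩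
          coef p k j * ((pw w₁ * P₁) * (pw w₂ * P₂))
            ≈⟨ MS.solve 5 (λ c a x b y → c ⊕ ((a ⊕ x) ⊕ (b ⊕ y)) ⊜ (a ⊕ b) ⊕ (c ⊕ (x ⊕ y))) ≈-refl (coef p k j) (pw w₁) P₁ (pw w₂) P₂ ⟩
          (pw w₁ * pw w₂) * (coef p k j * (P₁ * P₂))
            ≈⟨ *-congʳ (≈-trans (≈-sym (pw-+ w₁ w₂)) (≈-reflexive (cong pw weight))) ⟩
          pw (E.M⁻ k B v) * term p s k j ∎
          where
          open ≈R
          ex : Idx n → ℕ
          ex = exponents (State.mat s) k j
          w₁ = Trop.pairFin (λ l → + ex (inj₁ l)) (v ∘ inj₁)
          w₂ = Trop.pairFin (λ l → + ex (inj₂ l)) (v ∘ inj₂)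
          P₁ = ∏Fin (λ l → State.clu s l ^ℕ ex (inj₁ l))
          P₂ = ∏Fin (λ l → Point.t p l ^ℕ ex (inj₂ l))
          weight : w₁ ℤ.+ w₂ ≡ E.M⁻ k B v
          weight = trans (sym (Trop.pair-def (λ l → + ex l) v)) (trans (Trop.pair-cong (λ l → cong +_ (exponents-eq mat-s j l)) (λ _ → refl)) (pair-exponents B k j v ker j≤r))
        inverse-scale : State.clu s′ k ⁻¹ ≈ pw (ℤ.- v (inj₁ k)) * State.clu s k ⁻¹
        inverse-scale = ≈-sym (inverse-unique (begin
          State.clu s′ k * (pw (ℤ.- v (inj₁ k)) * State.clu s k ⁻¹)     ≈⟨ *-congʳ (clu-rel k) ⟩
          (pw (v (inj₁ k)) * State.clu s k) * (pw (ℤ.- v (inj₁ k)) * State.clu s k ⁻¹)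
            ≈⟨ MS.solve 4 (λ a b c d → (a ⊕ b) ⊕ (c ⊕ d) ⊜ (a ⊕ c) ⊕ (b ⊕ d)) ≈-refl _ _ _ _ ⟩
          (pw (v (inj₁ k)) * pw (ℤ.- v (inj₁ k))) * (State.clu s k * State.clu s k ⁻¹)
            ≈⟨ *-cong (pw-cancel (v (inj₁ k))) (⁻¹-inverse _ (positive-nonzero (positive k))) ⟩
          1# * 1#     ≈⟨ *-identityˡ 1# ⟩
          1#          ∎))
          where open ≈R
        clus : ∀ l → State.clu (step p′ s′ k) l ≈ pw (E.step k B v (inj₁ l)) * State.clu (step p s k) l
        clus l = cases (l ≟ k)
          where
          open ≈R
          cases : Dec (l ≡ k) → State.clu (step p′ s′ k) l ≈ pw (E.step k B v (inj₁ l)) * State.clu (step p s k) l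
          cases (yes refl) = begin
            State.clu (step p′ s′ k) k                               ≈⟨ ≈-reflexive (clu-same p′ s′ k) ⟩
            State.clu s′ k ⁻¹ * Σupto (r k) (term p′ s′ k)           ≈⟨ *-cong inverse-scale (sum-scale (suc (r k)) (λ j → j) (pw (E.M⁻ k B v)) {term p s k} {term p′ s′ k} term-scale) ⟩
            (pw (ℤ.- v (inj₁ k)) * State.clu s k ⁻¹) * (pw (E.M⁻ k B v) * Σupto (r k) (term p s k))
              ≈⟨ MS.solve 4 (λ a b c d → (a ⊕ b) ⊕ (c ⊕ d) ⊜ (a ⊕ c) ⊕ (b ⊕ d)) ≈-refl _ _ _ _ ⟩
            (pw (ℤ.- v (inj₁ k)) * pw (E.M⁻ k B v)) * (State.clu s k ⁻¹ * Σupto (r k) (term p s k))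
              ≈⟨ *-cong (≈-trans (≈-sym (pw-+ (ℤ.- v (inj₁ k)) (E.M⁻ k B v))) (≈-reflexive (cong pw weight))) (≈-reflexive (sym (clu-same p s k))) ⟩
            pw (E.step k B v (inj₁ k)) * State.clu (step p s k) k     ∎
            where
            weight : ℤ.- v (inj₁ k) ℤ.+ E.M⁻ k B v ≡ E.step k B v (inj₁ k)
            weight = sym (trans (E.step-same k B v) (trans (exchange-ker k {B} {v} ker) (cong (ℤ._+ E.M⁻ k B v) (ℤₚ.-1*i≡-i (v (inj₁ k))))))
          cases (no ne) = begin
            State.clu (step p′ s′ k) l                                ≈⟨ ≈-reflexive (clu-other p′ s′ k ne) ⟩
            State.clu s′ l                                            ≈⟨ clu-rel l ⟩
            pw (v (inj₁ l)) * State.clu s l                           ≈⟨ ≈-reflexive (cong₂ (λ a b → pw a * b) (sym (E.step-other k B v (inj₁ l) (λ { refl → ne refl }))) (sym (clu-other p s k ne))) ⟩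
            pw (E.step k B v (inj₁ l)) * State.clu (step p s k) l     ∎

      related-run : ∀ ks {s s′ B v} → Related s s′ B v → ∀ l
        → Positive (State.clu (runFrom p s ks) l)
        × State.clu (runFrom p′ s′ ks) l ≈ pw (E.run ks B v (inj₁ l)) * State.clu (runFrom p s ks) l
      related-run []       rel l = Related.positive rel l , Related.clu-rel rel l
      related-run (k ∷ ks) rel l = related-run ks (related-step k rel) l

      related-NZ : ∀ ks {s s′ B v} → Related s s′ B v → NZ p s ks
      related-NZ []       rel = λ i → positive-nonzero (Related.positive rel i)
      related-NZ (k ∷ ks) rel = (λ i → positive-nonzero (Related.positive rel i)) , related-NZ ks (related-step k rel)

    module _ (i : Fin n) where

      ones : Point
      ones = record { A = λ _ → 1# ; t = λ _ → 1# ; a = λ _ _ → 1# }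

      -- The i-th one-parameter subgroup at the value 2, whose infinite order lets an exponent be
      -- recovered from its power.
      λᵢ : Fin n → Carrier
      λᵢ l with l ≟ i
      ... | yes _ = two
      ... | no  _ = 1#

      λᵢ-other : ∀ {l} → l ≢ i → λᵢ l ≈ 1#
      λᵢ-other {l} ne with l ≟ i
      ... | yes e = ⊥-elim (ne e)
      ... | no _  = ≈-refl

      λᵢ-nonzero : ∀ l → ¬ (λᵢ l ≈ 0#)
      λᵢ-nonzero l with l ≟ i
      ... | yes _ = two-nonzero
      ... | no _  = 1≉0

      λᵢ-unit : ∀ l → λᵢ l ≈ pw (unit i l)
      λᵢ-unit l with l ≟ i
      ... | yes _ = ≈-sym (*-identityʳ two)
      ... | no _  = ≈-refl

      char-λᵢ : ∀ m → char λᵢ m ≈ pw (m i)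
      char-λᵢ m = ≈-trans (∏-single (λ l → λᵢ l ^ℤ m l) i (λ l ne → ^ℤ-1 (λᵢ-other ne) (m l))) (≈-reflexive (cong (_^ℤ m i) same))
        where
        same : λᵢ i ≡ two
        same with i ≟ i
        ... | yes _ = refl
        ... | no ne = ⊥-elim (ne refl)

      ones-good : GoodPoint ones
      ones-good = (λ _ → 1≉0) , (λ _ → 1≉0) , λ _ _ _ → ≈-refl

      related-init : Related {ones} {act λᵢ ones} (λ _ _ → ≈-refl) (λ _ _ → ≈-refl) (λ _ → positive-1)
        (initState ones) (initState (act λᵢ ones)) B₀ (κ i)
      related-init = record
        { good = good-B₀ ; ker = κ-ker i ; mat-s = initMat-B₀ ; mat-s′ = initMat-B₀
        ; positive = λ _ → positive-1
        ; clu-rel = λ l → *-congʳ (λᵢ-unit l)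
        ; t-rel = λ j → *-congʳ (char-λᵢ (λ l → ℤ.- ε j l)) }

      -- The coordinate of a g-vector along f i is read off at the all-ones point.
      gvector-run : ∀ ks l g → IsGVector ks l g → g i ≡ E.run ks B₀ (κ i) (inj₁ l)
      gvector-run ks l g isG = sym (pw-injective _ _ (positive-nonzero (proj₁ rel)) (begin
        pw (E.run ks B₀ (κ i) (inj₁ l)) * clusterVar ks ones l   ≈⟨ proj₂ rel ⟨
        clusterVar ks (act λᵢ ones) l                            ≈⟨ isG ones λᵢ ones-good nz λᵢ-nonzero ⟩
        char λᵢ g * clusterVar ks ones l                         ≈⟨ *-congʳ (char-λᵢ g) ⟩
        pw (g i) * clusterVar ks ones l                          ∎))
        where
        open ≈R
        rel = related-run (λ _ _ → ≈-refl) (λ _ _ → ≈-refl) (λ _ → positive-1) ks related-init l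
        nz = related-NZ (λ _ _ → ≈-refl) (λ _ _ → ≈-refl) (λ _ → positive-1) ks related-init

theorem4p15 : ∀ {c ℓ} (F : Field c ℓ) → CharZero F
    → (n : ℕ) (D : GenFixedData n) (ks : List (Fin n))
    → (g : Fin n → Fin n → ℤ)
    → (∀ l → GenCluster.IsGVector F D ks l (g l))
    → ∀ i → (∀ l → 0ℤ ≤ g l i) ⊎ (∀ l → g l i ≤ 0ℤ)
theorem4p15 F charZero n D ks g isG i =
  -- `X` reads its path backwards, so `ks` enters reversed.
  Sum.map (λ h l → subst (0ℤ ≤_) (eq l) (h l)) (λ h l → subst (_≤ 0ℤ) (eq l) (h l)) (Coherence.g-coherent D i (reverse ks))
  where
  open Frames D using (B₀; κ; X-run)
  open Seeds D tropical using (run)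
  eq : ∀ l → Coherence.g D i (reverse ks) l ≡ g l i
  eq l = trans (cong (λ w → w (inj₁ l)) (X-run (reverse ks) (κ i)))
    (trans (cong (λ p → run p B₀ (κ i) (inj₁ l)) (Listₚ.reverse-involutive ks))
           (sym (FieldPoints.Equivariance.gvector-run F charZero D i ks l (g l) (isG l))))
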